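{- The algorithm CountMatchings (specified in the context) provides an FPTAS for the problem $\#M(3,3)$ of counting the number of matchings in $(3,3)$-graphs, and runs in time $$O\left(n^2(n/\epsilon)^{\log_{50/49}144}\right),$$ where $n=|E(H)|$ is the number of edges of the input $(3,3)$-graph $H$.
   Context: **Hypergraphs and the counting problem.** A hypergraph $H=(V,E)$ is a finite set of vertices $V$ together with a family $E$ of distinct nonempty subsets of $V$ called edges. It is $k$-uniform (a $k$-graph) if every edge has size $k$. The degree of a vertex is the number of edges containing it, and $\Delta(H)$ is the maximum degree. A $(k,r)$-graph is a $k$-graph $H$ with $\Delta(H)\le r$. A matching is a (possibly empty) set of disjoint edges, and $Z_M(H)$ is the number of matchings of $H$, including the empty one. $\#M(k,r)$ is the problem of counting the matchings in $(k,r)$-graphs. The intersection graph $L(H)$ has vertex set $E(H)$, with two vertices adjacent when the corresponding edges of $H$ intersect. **FPTAS.** A fully polynomial time approximation scheme (FPTAS) for a function $f$ on $\{0,1\}^*$ is a deterministic algorithm which for every pair $(\epsilon,x)$ with $\epsilon>0$ and $x\in\{0,1\}^*$ returns a number $y(x)$ such that $|y(x)-f(x)|\le\epsilon f(x)$, and runs in time polynomial in $1/\epsilon$ and $|x|$. **Graph notation.** For a graph $G$: $N_G(v)$ is the neighborhood of $v$, $N_G[v]=N_G(v)\cup\{v\}$, $G[A]$ is the subgraph induced by $A$, $G-A=G[V(G)\setminus A]$, $G-v=G-\{v\}$, $\alpha$ is the size of a largest independent set, and $\delta$ is the minimum degree. A set $K\subseteq V(G)$ is a block in $G$ if $\alpha(G[K])\le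 2$, $|K|\le 4$, and $\delta(G[K])\ge 1$ whenever $|K|=4$ (the empty set is a block). A block $K$ is simplicial in $G$ if for every $v\in K$ the set $N_G(v)\setminus K$ is a block in $G-K$. **The function $\Phi$.** For a graph $G$, a simplicial block $K$ in $G$ and an integer $t\ge 0$, put $\Phi_G(K,0)=\Phi_G(K,1)=1$ and $\Phi_G(\emptyset,t)=1$, and for $t\ge 2$, $K\ne\emptyset$, $$\Phi_G(K,t)^{ -1}=1+\sum_{v\in K}\Phi_{G-K}(K_v,t-1)\Big(1+\tfrac12\sum_{u}\Phi_{G-K-K_v}(K_{uv},t-2)\Big),$$ where the inner sum is over all $u\in K$, $u\neq v$, not adjacent to $v$ in $G$, and $K_v=N_G(v)\setminus K$, $K_{uv}=N_G(u)\setminus(N_G(v)\cup K)$. **Subroutine CountIS$(G,K,t)$** ($G$ a connected induced subgraph of an intersection graph of a $(3,3)$-graph, $K$ a nonempty simplicial block in $G$): 1. Take a partition $V(G)=K_1\cup\dots\cup K_m$ with $K_1=K$ such that for every $i=2,\dots,m$ the set $K_i$ is a nonempty simplicial block in $G-\bigcup_{j<i}K_j$. (It is built step by step: if $R=V(G)\setminus\bigcup_{i\le s}K_i\neq\emptyset$, choose a vertex $v\in\bigcup_{i\le s}K_i$ having a neighbor in $R$ and set $K_{s+1}=N_G(v)\cap R$.) 2. Set $Z_I:=1$, $F:=G$. 3. For $i=1,\dots,m$: set $Z_I:=Z_I/\Phi_F(K_i,t)$, then $F:=F-K_i$. 4. Return $Z_I$. **Algorithm CountMatchings$(H,t)$**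 ($H$ a connected $(3,3)$-graph): 1. Set $G:=L(H)$, $Z_M:=1$, $F:=G$. 2. While $F\ne\emptyset$: - pick $v\in V(F)$ such that $F-v$ is connected, and set $F^v:=F-N_F[v]$; - if $F^v=\emptyset$, set $Z_M:=Z_M+1$; - otherwise let $F^v_1,\dots,F^v_c$ be the connected components of $F^v$; for each $i$ find $u_i\in N_F(v)$ with $K_i:=N_F(u_i)\cap V(F^v_i)\ne\emptyset$ (this $K_i$ is a simplicial block in $F_i^v$), and set $Z_M:=Z_M+\prod_{i=1}^c\mathrm{CountIS}(F_i^v,K_i,t)$; - set $F:=F-v$. 3. Return $Z_M$. For a disconnected $H$ the problem is reduced to connected ones by multiplying the values over the connected components of $L(H)$. For a given $\epsilon>0$ the algorithm is run with $t=2\lceil\log(18n/\epsilon)/\log(50/49)\rceil$.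
   Formalization: The tolerance is rational; t is computed with min(ε,1) instead of ε, since for very large ε (e.g. ε=17.64n, t=2, loose paths) the stated t is not accurate enough; the explicit O-bound is stated for 0<ε≤1 and n≥1, as its right side tends to 0 for large ε. -}

module Defs where

open import Algebra.Definitions.RawSemiring using ()
open import Data.Bool.Base using (Bool; true; false; not; _∧_; if_then_else_)
open import Data.Fin.Base as Fin using (Fin; toℕ)
import Data.Fin.Properties as Fin
open import Data.Fin.Subset using (Subset; inside; outside; _∈_; ∣_∣; Nonempty; Empty; _∩_)
open import Data.Fin.Subset.Properties using (_∈?_; nonempty?)
open import Data.Integer.Base using (+_; +[1+_]; -[1+_])
import Data.Integer.Base as ℤ
open import Data.List.Base as List using (List; []; _∷_; _++_; filter; length; map)
open import Data.List.Extrema.Nat using (max)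
open import Data.List.NonEmpty.Base as List⁺ using (List⁺; _∷_)
import Data.List.Membership.Propositional as List
open import Data.Maybe.Base using (Maybe; just; nothing)
open import Data.Nat.Base as ℕ using (ℕ; zero; suc)
open import Data.Nat.Binary.Base as ℕᵇ using (ℕᵇ; 2[1+_]; 1+[2_])
open import Data.Nat.Logarithm using (⌈log₂_⌉)
open import Data.Product.Base using (_×_; _,_; proj₁; Σ-syntax; ∃-syntax)
open import Data.Rational.Unnormalised.Base
  using (ℚᵘ; mkℚᵘ; 0ℚᵘ; 1ℚᵘ; ½; _+_; _*_; _-_; _/_; 1/_; _⊓_; _≤_; _≤ᵇ_; ↥_; ↧ₙ_; Positive; +-*-rawSemiring)
  renaming (∣_∣ to ∣_∣ℚ)
open import Data.Rational.Unnormalised.Properties using (pos⇒nonZero)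
open import Data.Vec.Base as Vec using (Vec; []; _∷_)
open import Relation.Binary.PropositionalEquality.Core using (_≡_; _≢_)
open import Relation.Nullary.Decidable using (Dec; ⌊_⌋; ¬?; _→-dec_)

open Algebra.Definitions.RawSemiring +-*-rawSemiring public using (_^_)

fromℕ : ℕ → ℚᵘ
fromℕ n = + n / 1

record Hypergraph : Set where
  field
    #V #E    : ℕ
    edge     : Fin #E → Subset #V
    nonempty : ∀ i → Nonempty (edge i)
    distinct : ∀ {i j} → edge i ≡ edge j → i ≡ j

open Hypergraph

IsUniform : ℕ → Hypergraph → Set
IsUniform k H = ∀ i → ∣ edge H i ∣ ≡ k

degree : (H : Hypergraph) → Fin (#V H) → ℕ
degree H v = length (filter (λ i → v ∈? edge H i) (List.allFin (#E H)))

Δ : Hypergraph → ℕ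
Δ H = max 0 (map (degree H) (List.allFin (#V H)))

IsKR : ℕ → ℕ → Hypergraph → Set
IsKR k r H = IsUniform k H × Δ H ℕ.≤ r

KRGraph : ℕ → ℕ → Set
KRGraph k r = Σ[ H ∈ Hypergraph ] IsKR k r H

-- A set of edges is a set of edge indices, since distinct indices carry
-- distinct edges.
IsMatching : (H : Hypergraph) → Subset (#E H) → Set
IsMatching H M = ∀ i j → i ∈ M → j ∈ M → i ≢ j → Empty (edge H i ∩ edge H j)

isMatching? : ∀ H M → Dec (IsMatching H M)
isMatching? H M = Fin.all? λ i → Fin.all? λ j →
  (i ∈? M) →-dec (j ∈? M) →-dec ¬? (i Fin.≟ j) →-dec ¬? (nonempty? (edge H i ∩ edge H j))

allSubsets : ∀ n → List (Subset n)
allSubsets zero    = [] ∷ []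
allSubsets (suc n) = map (inside ∷_) (allSubsets n) ++ map (outside ∷_) (allSubsets n)

Z-M : Hypergraph → ℕ
Z-M H = length (filter (isMatching? H) (allSubsets (#E H)))

-- A hypergraph is given to an algorithm as the lists of the vertices of
-- its edges.
members : ∀ {m} → Subset m → List (Fin m)
members {m} p = filter (_∈? p) (List.allFin m)

encodeℕᵇ : ℕᵇ → List Bool
encodeℕᵇ ℕᵇ.zero  = false ∷ []
encodeℕᵇ 1+[2 b ] = true ∷ false ∷ encodeℕᵇ b
encodeℕᵇ 2[1+ b ] = true ∷ true  ∷ encodeℕᵇ b

encodeℕ : ℕ → List Bool
encodeℕ n = encodeℕᵇ (ℕᵇ.fromℕ n)

encodeList : {A : Set} → (A → List Bool) → List A → List Bool
encodeList enc []       = false ∷ []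
encodeList enc (x ∷ xs) = true ∷ enc x ++ encodeList enc xs

encodeHypergraph : Hypergraph → List Bool
encodeHypergraph H =
  encodeℕ (#V H) ++
  encodeList (λ i → encodeList (λ v → encodeℕ (toℕ v)) (members (edge H i))) (List.allFin (#E H))

-- The machine is a random access machine.  A step on machine words
-- (vertices, edge indices, Booleans, pointers) costs one; an operation
-- on rationals, which are fractions of integers of unbounded length,
-- costs the bit length of its operands.  Recursions over data are
-- carried out inside the monad, where a result costs at least one step,
-- so no loop is free.

record Timed (A : Set) : Set where
  constructor _after_
  field
    value : A
    time  : ℕ

open Timed public

infixl 1 _>>=_
infix  0 _after_

return : {A : Set} → A → Timed A
return x = x after 1

_>>=_ : {A B : Set} → Timed A → (A → Timed B) → Timed B
(x after c) >>= f = value (f x) after c ℕ.+ time (f x)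

filterᵀ : {A : Set} → (A → Timed Bool) → List A → Timed (List A)
filterᵀ p []       = return []
filterᵀ p (x ∷ xs) = do
  b  ← p x
  ys ← filterᵀ p xs
  return (if b then x ∷ ys else ys)

anyᵀ : {A : Set} → (A → Timed Bool) → List A → Timed Bool
anyᵀ p []       = return false
anyᵀ p (x ∷ xs) = do
  true ← p x
    where false → anyᵀ p xs
  return true

appendᵀ : {A : Set} → List A → List A → Timed (List A)
appendᵀ []       ys = return ys
appendᵀ (x ∷ xs) ys = do
  zs ← appendᵀ xs ys
  return (x ∷ zs)

tabulateᵀ : {A : Set} → ∀ {n} → (Fin n → Timed A) → Timed (Vec A n)
tabulateᵀ {n = zero}  f = return []
tabulateᵀ {n = suc n} f = do
  x  ← f Fin.zero
  xs ← tabulateᵀ (λ i → f (Fin.suc i))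
  return (x ∷ xs)

allFinᵀ : ∀ n → Timed (List (Fin n))
allFinᵀ n = List.allFin n after suc n

isNonemptyᵀ : {A : Set} → List A → Timed Bool
isNonemptyᵀ []      = return false
isNonemptyᵀ (_ ∷ _) = return true

_≟ᵀ_ : ∀ {n} → Fin n → Fin n → Timed Bool
u ≟ᵀ v = ⌊ u Fin.≟ v ⌋ after 1

_∈ᵀ_ : ∀ {n} → Fin n → List (Fin n) → Timed Bool
v ∈ᵀ xs = anyᵀ (v ≟ᵀ_) xs

_∖_ : ∀ {n} → List (Fin n) → List (Fin n) → Timed (List (Fin n))
xs ∖ ys = filterᵀ (λ x → do b ← x ∈ᵀ ys; return (not b)) xs

bits : ℚᵘ → ℕ
bits p = ⌈log₂ suc ℤ.∣ ↥ p ∣ ⌉ ℕ.+ ⌈log₂ suc (↧ₙ p) ⌉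

-- The reciprocal of zero is never used by the algorithm.
inverse : ℚᵘ → ℚᵘ
inverse (mkℚᵘ (+ 0) d)      = 0ℚᵘ
inverse p@(mkℚᵘ +[1+ _ ] _) = 1/ p
inverse p@(mkℚᵘ -[1+ _ ] _) = 1/ p

_+ᵀ_ _*ᵀ_ : ℚᵘ → ℚᵘ → Timed ℚᵘ
p +ᵀ q = p + q after suc (bits p ℕ.+ bits q)
p *ᵀ q = p * q after suc (bits p ℕ.+ bits q)

inverseᵀ : ℚᵘ → Timed ℚᵘ
inverseᵀ p = inverse p after suc (bits p)

sumᵀ : {A : Set} → (A → Timed ℚᵘ) → List A → Timed ℚᵘ
sumᵀ f []       = return 0ℚᵘ
sumᵀ f (x ∷ xs) = do
  p ← f x
  q ← sumᵀ f xs
  p +ᵀ q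

productᵀ : {A : Set} → (A → Timed ℚᵘ) → List A → Timed ℚᵘ
productᵀ f []       = return 1ℚᵘ
productᵀ f (x ∷ xs) = do
  p ← f x
  q ← productᵀ f xs
  p *ᵀ q

-- A rule resolving the choices which the algorithm leaves open: it
-- selects one of the admissible candidates.
record TieBreak : Set where
  field
    select   : ∀ {n} → List⁺ (Fin n) → Fin n
    select-∈ : ∀ {n} (xs : List⁺ (Fin n)) → select xs List.∈ List⁺.toList xs

-- A fixed graph is given by its adjacency matrix, and an induced subgraph
-- G of it by the list of its vertices.  For the natural numbers
-- called `fuel', which only bound the depth of recursion, the number of
-- vertices of the fixed graph is always sufficient.

AdjacencyMatrix : ℕ → Set
AdjacencyMatrix n = Vec (Vec Bool n) n

module InducedSubgraphs {n : ℕ} (adjacency : AdjacencyMatrix n) where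

  V = Fin n

  adjacentᵀ : V → V → Timed Bool
  adjacentᵀ u v = Vec.lookup (Vec.lookup adjacency u) v after 1

  -- N G v lists the neighbours of v in G; v itself may lie outside G.
  N : List V → V → Timed (List V)
  N G v = filterᵀ (adjacentᵀ v) G

  -- grow fuel S R: the vertices of S together with those of R reachable
  -- from S, and the remaining vertices of R.
  grow : (fuel : ℕ) → List V → List V → Timed (List V × List V)
  grow zero       S       R = return (S , R)
  grow (suc fuel) []      R = return ([] , R)
  grow (suc fuel) (v ∷ S) R = do
    new     ← N R v
    R′      ← R ∖ new
    S′      ← appendᵀ new S
    (C , Q) ← grow fuel S′ R′
    return (v ∷ C , Q)

  componentsFrom : (fuel : ℕ) → List V → Timed (List (List V))
  componentsFrom zero       G       = return []
  componentsFrom (suc fuel) []      = return []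
  componentsFrom (suc fuel) (v ∷ G) = do
    (C , R) ← grow n (v ∷ []) G
    Cs      ← componentsFrom fuel R
    return (C ∷ Cs)

  components : List V → Timed (List (List V))
  components = componentsFrom n

  isConnected : List V → Timed Bool
  isConnected G = do
    (_ ∷ _ ∷ _) ← components G
      where _ → return true
    return false

  notAdjacentᵀ : V → V → Timed Bool
  notAdjacentᵀ v u = do
    e ← u ≟ᵀ v
    a ← adjacentᵀ v u
    return (not e ∧ not a)

  -- The recursive case of Φ, with Φ₁ and Φ₂ in place of Φ at t - 1 and
  -- t - 2.
  module Step (Φ₁ Φ₂ : List V → List V → Timed ℚᵘ) (G K : List V) where

    innerTerm : (G-K-Kv NGv : List V) → V → Timed ℚᵘ
    innerTerm G-K-Kv NGv u = do
      NGu     ← N G u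
      NGu∖NGv ← NGu ∖ NGv
      Kuv     ← NGu∖NGv ∖ K
      Φ₂ G-K-Kv Kuv

    term : (G-K : List V) → V → Timed ℚᵘ
    term G-K v = do
      NGv    ← N G v
      Kv     ← NGv ∖ K
      φ      ← Φ₁ G-K Kv
      G-K-Kv ← G-K ∖ Kv
      us     ← filterᵀ (notAdjacentᵀ v) K
      s      ← sumᵀ (innerTerm G-K-Kv NGv) us
      h      ← ½ *ᵀ s
      r      ← 1ℚᵘ +ᵀ h
      φ *ᵀ r

    step : Timed ℚᵘ
    step = do
      G-K ← G ∖ K
      s   ← sumᵀ (term G-K) K
      r   ← 1ℚᵘ +ᵀ s
      inverseᵀ r

  Φ : List V → List V → ℕ → Timed ℚᵘ
  Φ G K         0             = return 1ℚᵘ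
  Φ G K         1             = return 1ℚᵘ
  Φ G []        (suc (suc t)) = return 1ℚᵘ
  Φ G K@(_ ∷ _) (suc (suc t)) =
    Step.step (λ G′ K′ → Φ G′ K′ (suc t)) (λ G′ K′ → Φ G′ K′ t) G K

  module _ (tieBreak : TieBreak) where
    open TieBreak tieBreak

    pick : List V → Timed (Maybe V)
    pick []       = return nothing
    pick (v ∷ vs) = return (just (select (v ∷ vs)))

    -- S lists the vertices already covered and R the others.
    partitionFrom : (fuel : ℕ) → List V → List V → Timed (List (List V))
    partitionFrom zero       S R         = return []
    partitionFrom (suc fuel) S []        = return []
    partitionFrom (suc fuel) S R@(_ ∷ _) = do
      vs     ← filterᵀ (λ v → do NRv ← N R v; isNonemptyᵀ NRv) S
      just v ← pick vs
        where nothing → return []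
      K      ← N R v
      R′     ← R ∖ K
      S′     ← appendᵀ S K
      Ks     ← partitionFrom fuel S′ R′
      return (K ∷ Ks)

    divideByΦs : ℕ → ℚᵘ → List V → List (List V) → Timed ℚᵘ
    divideByΦs t Z F []       = return Z
    divideByΦs t Z F (K ∷ Ks) = do
      φ   ← Φ F K t
      φ⁻¹ ← inverseᵀ φ
      Z′  ← Z *ᵀ φ⁻¹
      F′  ← F ∖ K
      divideByΦs t Z′ F′ Ks

    countIS : List V → List V → ℕ → Timed ℚᵘ
    countIS G K t = do
      R  ← G ∖ K
      Ks ← partitionFrom n K R
      divideByΦs t 1ℚᵘ G (K ∷ Ks)

    countComponent : List V → ℕ → List V → Timed ℚᵘ
    countComponent NFv t C = do
      us     ← filterᵀ (λ u → do NCu ← N C u; isNonemptyᵀ NCu) NFv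
      just u ← pick us
        where nothing → return 1ℚᵘ
      K      ← N C u
      countIS C K t

    -- The number by which the body of the while loop increases Z_M.
    increment : List V → V → ℕ → Timed ℚᵘ
    increment F v t = do
      NFv        ← N F v
      Fv@(_ ∷ _) ← F ∖ (v ∷ NFv)
        where [] → return 1ℚᵘ
      Cs         ← components Fv
      productᵀ (countComponent NFv t) Cs

    countLoop : (fuel : ℕ) → ℚᵘ → List V → ℕ → Timed ℚᵘ
    countLoop zero       Z F         t = return Z
    countLoop (suc fuel) Z []        t = return Z
    countLoop (suc fuel) Z F@(_ ∷ _) t = do
      vs     ← filterᵀ (λ v → do F-v ← F ∖ (v ∷ []); isConnected F-v) F
      just v ← pick vs
        where nothing → return Z
      z      ← increment F v t
      Z′     ← Z +ᵀ z
      F-v    ← F ∖ (v ∷ [])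
      countLoop fuel Z′ F-v t

    countConnected : List V → ℕ → Timed ℚᵘ
    countConnected G t = countLoop n 1ℚᵘ G t

readEdge : (H : Hypergraph) → Fin (#E H) → Timed (List (Fin (#V H)))
readEdge H i = members (edge H i) after 1

intersectᵀ : (H : Hypergraph) → Fin (#E H) → Fin (#E H) → Timed Bool
intersectᵀ H i j = do
  e ← readEdge H i
  f ← readEdge H j
  anyᵀ (_∈ᵀ f) e

intersectionGraph : (H : Hypergraph) → Timed (AdjacencyMatrix (#E H))
intersectionGraph H = tabulateᵀ λ i → tabulateᵀ λ j → do
  false ← i ≟ᵀ j
    where true → return false
  intersectᵀ H i j

countMatchings : TieBreak → Hypergraph → ℕ → Timed ℚᵘ
countMatchings tieBreak H t = do
  adjacency ← intersectionGraph H
  let open InducedSubgraphs adjacency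
  G  ← allFinᵀ (#E H)
  Gs ← components G
  productᵀ (λ G′ → countConnected tieBreak G′ t) Gs

-- The least s' ≥ s with 18n(49/50)^s' ≤ min(ε,1), given q = 18n(49/50)^s.
-- The tolerance ε is accessed only through comparisons with rationals,
-- and a comparison costs the length of that rational.
searchLogSteps : ℚᵘ → (fuel : ℕ) → (s : ℕ) (q : ℚᵘ) → Timed ℕ
searchLogSteps ε zero       s q = return s
searchLogSteps ε (suc fuel) s q = do
  false ← (q ≤ᵇ (ε ⊓ 1ℚᵘ)) after suc (bits q)
    where true → return s
  q′ ← q *ᵀ (+ 49 / 50)
  searchLogSteps ε fuel (suc s) q′

-- For 0 < ε ≤ 1 and n > 0 this is ⌈log(18n/ε)/log(50/49)⌉.  With this
-- number accuracy ε is guaranteed only for ε ≤ 1; for a larger ε the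
-- algorithm achieves accuracy 1, which is enough.  The fuel is
-- sufficient because, by Bernoulli's inequality, the search stops at
-- the latest at s = 49 · 18n/min(ε,1).
logSteps : ℕ → ℚᵘ → Timed ℕ
logSteps n ε = searchLogSteps ε (882 ℕ.* n ℕ.* ↧ₙ ε) 0 (fromℕ (18 ℕ.* n))

approximateMatchings : TieBreak → ℚᵘ → Hypergraph → Timed ℚᵘ
approximateMatchings tieBreak ε H = do
  s ← logSteps (#E H) ε
  countMatchings tieBreak H (2 ℕ.* s)

record CountingProblem : Set₁ where
  field
    Instance : Set
    encode   : Instance → List Bool
    count    : Instance → ℕ

#M : ℕ → ℕ → CountingProblem
#M k r = record
  { Instance = KRGraph k r
  ; encode   = λ (H , _) → encodeHypergraph H
  ; count    = λ (H , _) → Z-M H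
  }

-- A function of 1/ε and |x| is bounded by a polynomial if and only if
-- it is bounded by c(1 + 1/ε + |x|)^d for some c and d.
record IsFPTAS (P : CountingProblem)
               (A : ℚᵘ → CountingProblem.Instance P → Timed ℚᵘ) : Set where
  open CountingProblem P
  field
    accurate   : ∀ ε .{{_ : Positive ε}} x →
                 ∣ value (A ε x) - fromℕ (count x) ∣ℚ ≤ ε * fromℕ (count x)
    polynomial : ∃[ c ] ∃[ d ] ∀ ε .{{_ : Positive ε}} x →
                 fromℕ (time (A ε x)) ≤
                 fromℕ c * (1ℚᵘ + (1/ ε) {{pos⇒nonZero ε}} + fromℕ (length (encode x))) ^ d

-- T ≤ y · x^(log_b a), for x ≥ 1, b > 1 and a ≥ 1.  The real number
-- x^(log_b a) is the infimum of the powers x^(p/q) over the rationals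
-- p/q ≥ log_b a, that is, over those with a^q ≤ b^p.
BoundedByLogPower : (T y x b a : ℚᵘ) → Set
BoundedByLogPower T y x b a =
  ∀ p q .{{_ : ℕ.NonZero q}} → a ^ q ≤ b ^ p → T ^ q ≤ y ^ q * x ^ p

{-# OPTIONS --safe #-}

-- Let Π(G, K) be the probability that a uniformly random independent set of G
-- avoids the block K.  The recursion defining Φ is satisfied exactly by Π, so
-- that Φ errs only by being cut off at depth t.  The error is measured through
-- the potential 2/x - 1, which is 1 + 2S for x = 1/(1 + S).  Because a block has
-- at most four vertices, each nonadjacent to at most two others, a factor
-- 1 + η in the potentials of the smaller blocks becomes a factor of at most
-- 1 + (97/100) η.  Hence Φ(G, K, t) approximates Π(G, K) up to a factor
-- 1 + 16 (97/100)^⌊t/2⌋, and dividing by the numbers Π along a partition into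
-- simplicial blocks telescopes to the number of independent sets.
--
-- A call of Φ leads to at most 4 calls at depth t - 1 and 8 calls at depth
-- t - 2, so that, the cost of rational arithmetic included, the running time is
-- polynomial in n times 7^t.  As 7² ≤ (50/49)^193 while 144 ≥ (50/49)^205, the
-- polynomial in n is absorbed by the exponent.

module Submission where

open import Defs
open import Data.Bool.Base using (Bool; true; false; not; _∧_; if_then_else_; T)
import Data.Bool.Properties as Bool
open import Data.Fin.Base as Fin using (Fin; toℕ)
import Data.Fin.Properties as Fin
open import Data.Fin.Subset using (Subset; inside; outside; ∣_∣) renaming (_∈_ to _∈ₛ_)
import Data.Fin.Subset.Properties as Subset
open import Data.Integer.Base using (+_; +[1+_]; -[1+_])
import Data.Integer.Base as ℤ
import Data.Integer.Properties as ℤ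
open import Data.List.Base as List using (List; []; _∷_; _++_; filter; length; map)
import Data.List.Properties as List
import Data.List.Extrema.Nat as Extrema
open import Data.List.NonEmpty.Base using (_∷_)
open import Data.List.Membership.Propositional using (_∈_; _∉_; find; lose)
import Data.List.Membership.Propositional.Properties as ∈
open import Data.List.Relation.Unary.Any as Any using (here; there)
open import Data.List.Relation.Unary.All as All using (All; []; _∷_)
import Data.List.Relation.Unary.All.Properties as All
open import Data.List.Relation.Unary.AllPairs using ([]; _∷_)
open import Data.List.Relation.Unary.Unique.Propositional using (Unique)
import Data.List.Relation.Unary.Unique.Propositional.Properties as Unique
open import Data.List.Relation.Binary.BagAndSetEquality using (∼bag⇒↭)
open import Data.List.Membership.Propositional.Properties.WithK using (unique∧set⇒bag)
open import Data.List.Relation.Binary.Permutation.Propositional as ↭ using (_↭_)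
import Data.List.Relation.Binary.Permutation.Propositional.Properties as ↭
import Data.List.Relation.Binary.Permutation.Setoid.Properties as Setoid
open import Data.Maybe.Base using (just)
open import Data.Nat.Base as ℕ using (ℕ; zero; suc; z≤n; s≤s)
import Data.Nat.Properties as ℕ
open import Data.Nat.ListAction using (sum)
open import Data.Nat.Logarithm using (⌈log₂_⌉; ⌈log₂⌉-mono-≤; ⌈log₂2^n⌉≡n)
open import Data.Nat.Tactic.RingSolver using (solve-∀)
open import Data.Product.Base using (_×_; _,_; proj₁; proj₂; ∃-syntax)
open import Data.Rational.Unnormalised.Base
  using (ℚᵘ; mkℚᵘ; 0ℚᵘ; 1ℚᵘ; ½; _+_; _*_; _-_; -_; _/_; _÷_; 1/_; _⊓_; _≤_; _<_; _≤ᵇ_; _≃_; *≡*; *≤*; *<*;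
         ↥_; ↧ₙ_; Positive)
import Data.Rational.Unnormalised.Base as ℚ
open import Data.Rational.Unnormalised.Properties using (pos⇒nonZero; ≃-refl; ≃-sym)
import Data.Rational.Unnormalised.Properties as ℚ
import Data.Rational.Unnormalised.Solver as ℚ
open import Data.Sum.Base using (_⊎_; inj₁; inj₂)
open import Data.Unit.Base using (tt)
open import Data.Vec.Base as Vec using (Vec; []; _∷_)
open import Function.Base using (_∘_; id)
open import Function.Bundles using (mk⇔)
open import Relation.Binary.PropositionalEquality
  using (_≡_; _≢_; refl; sym; trans; cong; cong₂; subst; subst₂; setoid; module ≡-Reasoning)
open import Relation.Nullary.Decidable using (Dec; yes; no; does)
open import Relation.Nullary.Negation using (¬_; contradiction)
open ℚ.+-*-Solver using (Polynomial; solve; _:=_; _:+_; _:*_; _:-_; con)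

-- Ordered field arithmetic

-- The values themselves need not contract. Take four vertices with two nonneighbours each and let
-- all smaller values be 1, so that S = 8. A factor 1 + η in the smaller values changes S by about
-- 12 η, and 1 + S by a factor of about 1 + (12/9) η. The potential weights errors differently: a
-- factor 1 + η in 2/x - 1 changes x only by a factor of about 1 + (1 - x/2) η in the other
-- direction. Values near 1, which make S large, thus carry half of the error, and the same block
-- yields 12/17. The number of levels is prescribed through 49/50. A call descends by one or two
-- levels, so a factor 97/100 is certain only for every two levels, that is, for each of the s steps
-- in t = 2s. As 97/100 is smaller than 49/50, the initial error 16 has become at most 9 (49/50)^s
-- when s ≥ 60, and for n ≥ 1 the stopping rule of the search enforces s ≥ 60. Finally, n factors 1
-- + η cost at most 2 n η, which explains the constant 18.

≤-gap : ∀ {p q} r → 0ℚᵘ ≤ r → p + r ≃ q → p ≤ q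
≤-gap {p} {q} r 0≤r p+r≃q = begin
  p        ≃⟨ ℚ.+-identityʳ p ⟨
  p + 0ℚᵘ  ≤⟨ ℚ.+-monoʳ-≤ p 0≤r ⟩
  p + r    ≃⟨ p+r≃q ⟩
  q        ∎
  where open ℚ.≤-Reasoning

gap-≥0 : ∀ {p q} → p ≤ q → 0ℚᵘ ≤ q - p
gap-≥0 = ℚ.p≤q⇒0≤q-p

+-≥0 : ∀ {p q} → 0ℚᵘ ≤ p → 0ℚᵘ ≤ q → 0ℚᵘ ≤ p + q
+-≥0 0≤p 0≤q = ℚ.≤-respˡ-≃ (ℚ.+-identityˡ 0ℚᵘ) (ℚ.+-mono-≤ 0≤p 0≤q)

*-mono-≤ : ∀ {p q r s} → 0ℚᵘ ≤ p → 0ℚᵘ ≤ r → p ≤ q → r ≤ s → p * r ≤ q * s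
*-mono-≤ {p} {q} {r} {s} 0≤p 0≤r p≤q r≤s =
  ℚ.*-mono-≤-nonNeg {p} {q} {r} {s} {{ℚ.nonNegative 0≤p}} {{ℚ.nonNegative 0≤r}} p≤q r≤s

*-monoʳ-≤ : ∀ {p q} r → 0ℚᵘ ≤ r → p ≤ q → r * p ≤ r * q
*-monoʳ-≤ r 0≤r = ℚ.*-monoʳ-≤-nonNeg r {{ℚ.nonNegative 0≤r}}

*-monoˡ-≤ : ∀ {p q} r → 0ℚᵘ ≤ r → p ≤ q → p * r ≤ q * r
*-monoˡ-≤ r 0≤r = ℚ.*-monoˡ-≤-nonNeg r {{ℚ.nonNegative 0≤r}}

*-≥0 : ∀ {p q} → 0ℚᵘ ≤ p → 0ℚᵘ ≤ q → 0ℚᵘ ≤ p * q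
*-≥0 {p} {q} 0≤p 0≤q = ℚ.≤-respˡ-≃ (ℚ.*-zeroʳ p) (*-monoʳ-≤ p 0≤p 0≤q)

*->0 : ∀ {p q} → 0ℚᵘ < p → 0ℚᵘ < q → 0ℚᵘ < p * q
*->0 {p} {q} 0<p 0<q = ℚ.<-respˡ-≃ (ℚ.*-zeroʳ p) (ℚ.*-monoʳ-<-pos p {{ℚ.positive 0<p}} 0<q)

+->0 : ∀ {p q} → 0ℚᵘ < p → 0ℚᵘ ≤ q → 0ℚᵘ < p + q
+->0 {p} {q} 0<p 0≤q = ℚ.<-respˡ-≃ (ℚ.+-identityʳ 0ℚᵘ) (ℚ.+-mono-<-≤ 0<p 0≤q)

*-cancelˡ-≤ : ∀ {p q} r → 0ℚᵘ < r → r * p ≤ r * q → p ≤ q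
*-cancelˡ-≤ r 0<r = ℚ.*-cancelˡ-≤-pos r {{ℚ.positive 0<r}}

*-cancel-≥0 : ∀ {p} r → 0ℚᵘ < r → 0ℚᵘ ≤ r * p → 0ℚᵘ ≤ p
*-cancel-≥0 r 0<r 0≤rp = *-cancelˡ-≤ r 0<r (ℚ.≤-respˡ-≃ (≃-sym (ℚ.*-zeroʳ r)) 0≤rp)

square-≥0 : ∀ p → 0ℚᵘ ≤ p * p
square-≥0 (mkℚᵘ (+ n) d)      = *-≥0 0≤p 0≤p
  where 0≤p = ℚ.nonNegative⁻¹ (mkℚᵘ (+ n) d)
square-≥0 p@(mkℚᵘ -[1+ n ] d) = ℚ.nonNegative⁻¹ (p * p)

c : ℕ → ℚᵘ
c = fromℕ

0≤c : ∀ k → 0ℚᵘ ≤ c k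
0≤c k = ℚ.nonNegative⁻¹ (c k)

0<c : ∀ k → 0ℚᵘ < c (suc k)
0<c k = ℚ.positive⁻¹ (c (suc k))

k : ∀ {m} → ℕ → Polynomial m
k n = con (c n)

-- The potential of x ∈ (0 , 1] is 2/x - 1, and x ⊲[ η ] y says that the
-- potential of x is at most 1 + η times that of y.
_⊲[_]_ : ℚᵘ → ℚᵘ → ℚᵘ → Set
x ⊲[ η ] y = y * (c 2 - x) ≤ (1ℚᵘ + η) * (x * (c 2 - y))

-- Contraction of the potential in one branch

module Contraction
  (δ a b : ℚᵘ) (0≤δ : 0ℚᵘ ≤ δ) (0≤a : 0ℚᵘ ≤ a) (0≤b : 0ℚᵘ ≤ b) (b≤1 : b ≤ 1ℚᵘ)
  where

  -- With `η` = 100 `δ` all coefficients are integers, the contracted error being 97 `δ`. Once the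
  -- bounds on the smaller values are inserted and the denominators cleared, the gap of the claim is
  -- 2 `δ` (5 `f` + `rest`). Here `rest` is visibly nonnegative, whereas `f` is a quadratic in `a`
  -- with one negative term, so that its discriminant matters.
  η P D Q f rest : ℚᵘ
  η    = c 100 * δ
  P    = c 15 * ((1ℚᵘ + η) * (1ℚᵘ + b))
  D    = c 2 + η * b
  Q    = (1ℚᵘ + η) * (b * (c 2 - b))
  f    = D * (c 5 * P * (a * a) + c 16) - c 160 * (a * Q)
  rest = D * (c 5 + c 6 * (1ℚᵘ - b) + c 4850 * (a * δ)
              + (1ℚᵘ + b) * (c 6 * ((c 2 * a - 1ℚᵘ) * (c 2 * a - 1ℚᵘ)) + (a * a) * (1ℚᵘ + c 13 * η)))

  0≤η : 0ℚᵘ ≤ η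
  0≤η = *-≥0 (0≤c 100) 0≤δ

  0<1+η : 0ℚᵘ < 1ℚᵘ + η
  0<1+η = +->0 (0<c 0) 0≤η

  0<1+b : 0ℚᵘ < 1ℚᵘ + b
  0<1+b = +->0 (0<c 0) 0≤b

  0<P : 0ℚᵘ < P
  0<P = *->0 (0<c 14) (*->0 0<1+η 0<1+b)

  0<D : 0ℚᵘ < D
  0<D = +->0 (0<c 1) (*-≥0 0≤η 0≤b)

  -- The discriminant of the quadratic f in a is nonpositive because of
  -- 3 (1 + b) - 4 b (2 - b)² = (2 b - 1)² (3 - b).
  completed-square : P * D * f ≃
    c 5 * ((D * P * a - c 16 * Q) * (D * P * a - c 16 * Q))
    + (c 320 * ((1ℚᵘ + η) * (1ℚᵘ + η) * b * ((c 2 * b - 1ℚᵘ) * (c 2 * b - 1ℚᵘ)) * (c 2 + (1ℚᵘ - b)))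
       + c 240 * ((c 4 * (1ℚᵘ - b) + (η * η) * (b * b)) * ((1ℚᵘ + η) * (1ℚᵘ + b))))
  completed-square = solve 3 (λ η a b →
      let P = k 15 :* ((k 1 :+ η) :* (k 1 :+ b))
          D = k 2 :+ η :* b
          Q = (k 1 :+ η) :* (b :* (k 2 :- b))
          f = D :* (k 5 :* P :* (a :* a) :+ k 16) :- k 160 :* (a :* Q)
      in P :* D :* f :=
         k 5 :* ((D :* P :* a :- k 16 :* Q) :* (D :* P :* a :- k 16 :* Q))
         :+ (k 320 :* ((k 1 :+ η) :* (k 1 :+ η) :* b :* ((k 2 :* b :- k 1) :* (k 2 :* b :- k 1)) :* (k 2 :+ (k 1 :- b)))
             :+ k 240 :* ((k 4 :* (k 1 :- b) :+ (η :* η) :* (b :* b)) :* ((k 1 :+ η) :* (k 1 :+ b)))))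
    ≃-refl η a b

  0≤1-b : 0ℚᵘ ≤ 1ℚᵘ - b
  0≤1-b = gap-≥0 b≤1

  0≤f : 0ℚᵘ ≤ f
  0≤f = *-cancel-≥0 (P * D) (*->0 0<P 0<D) (ℚ.≤-respʳ-≃ (≃-sym completed-square)
    (+-≥0 (*-≥0 (0≤c 5) (square-≥0 (D * P * a - c 16 * Q)))
    (+-≥0 (*-≥0 (0≤c 320) (*-≥0 (*-≥0 (*-≥0 (*-≥0 0≤1+η 0≤1+η) 0≤b) (square-≥0 (c 2 * b - 1ℚᵘ))) (+-≥0 (0≤c 2) 0≤1-b)))
          (*-≥0 (0≤c 240) (*-≥0 (+-≥0 (*-≥0 (0≤c 4) 0≤1-b) (*-≥0 (square-≥0 η) (square-≥0 b)))
                                (*-≥0 0≤1+η (ℚ.<⇒≤ 0<1+b)))))))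
    where
    0≤1+η = ℚ.<⇒≤ 0<1+η

  0≤rest : 0ℚᵘ ≤ rest
  0≤rest = *-≥0 (ℚ.<⇒≤ 0<D)
    (+-≥0 (+-≥0 (+-≥0 (0≤c 5) (*-≥0 (0≤c 6) 0≤1-b)) (*-≥0 (0≤c 4850) (*-≥0 0≤a 0≤δ)))
          (*-≥0 (ℚ.<⇒≤ 0<1+b) (+-≥0 (*-≥0 (0≤c 6) (square-≥0 (c 2 * a - 1ℚᵘ)))
                                     (*-≥0 (square-≥0 a) (+-≥0 (0≤c 1) (*-≥0 (0≤c 13) 0≤η))))))

  E X Y bound : ℚᵘ
  E     = c 2 + η * a
  X     = c 2 * ((1ℚᵘ + η) * a)
  Y     = c 2 * ((1ℚᵘ + η) * b)
  bound = c 8 * ((1ℚᵘ + c 97 * δ) * (a * (1ℚᵘ + b))) + c 97 * δ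

  cleared : c 8 * (X * (D + Y)) + c 2 * δ * (c 5 * f + rest) ≃ E * D * bound
  cleared = solve 3 (λ δ a b →
      let η = k 100 :* δ
          D = k 2 :+ η :* b
          f = D :* (k 5 :* (k 15 :* ((k 1 :+ η) :* (k 1 :+ b))) :* (a :* a) :+ k 16)
              :- k 160 :* (a :* ((k 1 :+ η) :* (b :* (k 2 :- b))))
          rest = D :* (k 5 :+ k 6 :* (k 1 :- b) :+ k 4850 :* (a :* δ)
            :+ (k 1 :+ b) :* (k 6 :* ((k 2 :* a :- k 1) :* (k 2 :* a :- k 1)) :+ (a :* a) :* (k 1 :+ k 13 :* η)))
          X = k 2 :* ((k 1 :+ η) :* a)
          Y = k 2 :* ((k 1 :+ η) :* b)
          bound = k 8 :* ((k 1 :+ k 97 :* δ) :* (a :* (k 1 :+ b))) :+ k 97 :* δ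
      in k 8 :* (X :* (D :+ Y)) :+ k 2 :* δ :* (k 5 :* f :+ rest) := (k 2 :+ η :* a) :* D :* bound)
    ≃-refl δ a b

  -- The relation is linear in `y`: collecting terms gives y ≤ 2 (1 + η) x / (2 + η x). The
  -- denominator is `E` for `a` and `D` for `b`.
  ⊲-solved : ∀ x y → x ⊲[ η ] y → (c 2 + η * x) * y ≤ c 2 * ((1ℚᵘ + η) * x)
  ⊲-solved x y x⊲y = ≤-gap _ (gap-≥0 x⊲y)
    (solve 3 (λ η x y → (k 2 :+ η :* x) :* y :+ ((k 1 :+ η) :* (x :* (k 2 :- y)) :- y :* (k 2 :- x))
                        := k 2 :* ((k 1 :+ η) :* x)) ≃-refl η x y)

  -- `a` belongs to a vertex of the block and `b` to one nonneighbour of it. The summand `c 97 * δ`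
  -- in `bound` is the share of a single vertex in the constant term 1 of the potential 1 + 2S,
  -- which at most four vertices divide among them.
  contraction : ∀ {a′ b′} → 0ℚᵘ ≤ a′ → 0ℚᵘ ≤ b′ → a ⊲[ η ] a′ → b ⊲[ η ] b′ →
                c 8 * (a′ * (1ℚᵘ + b′)) ≤ bound
  contraction {a′} {b′} 0≤a′ 0≤b′ a⊲a′ b⊲b′ = *-cancelˡ-≤ (E * D) (*->0 0<E 0<D) (begin
    E * D * (c 8 * (a′ * (1ℚᵘ + b′)))
      ≃⟨ solve 4 (λ E D a′ b′ → E :* D :* (k 8 :* (a′ :* (k 1 :+ b′))) := k 8 :* ((E :* a′) :* (D :+ D :* b′)))
           ≃-refl E D a′ b′ ⟩
    c 8 * ((E * a′) * (D + D * b′))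
      ≤⟨ *-monoʳ-≤ (c 8) (0≤c 8) (*-mono-≤ (*-≥0 (ℚ.<⇒≤ 0<E) 0≤a′) (+-≥0 0≤D (*-≥0 0≤D 0≤b′))
           (⊲-solved a a′ a⊲a′) (ℚ.+-monoʳ-≤ D (⊲-solved b b′ b⊲b′))) ⟩
    c 8 * (X * (D + Y))
      ≤⟨ ≤-gap _ (*-≥0 (*-≥0 (0≤c 2) 0≤δ) (+-≥0 (*-≥0 (0≤c 5) 0≤f) 0≤rest)) cleared ⟩
    E * D * bound ∎)
    where
    open ℚ.≤-Reasoning
    0≤D = ℚ.<⇒≤ 0<D
    0<E = +->0 (0<c 1) (*-≥0 0≤η 0≤a)

-- Counting independent sets

filterᵇ : {A : Set} → (A → Bool) → List A → List A
filterᵇ = List.filterᵇ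

≡true⇒T : ∀ {b} → b ≡ true → T b
≡true⇒T refl = tt

T⇒≡true : ∀ {b} → T b → b ≡ true
T⇒≡true {true} _ = refl

interchange : ∀ a b c d → (a ℕ.+ b) ℕ.+ (c ℕ.+ d) ≡ (a ℕ.+ c) ℕ.+ (b ℕ.+ d)
interchange a b c d = begin
  (a ℕ.+ b) ℕ.+ (c ℕ.+ d) ≡⟨ ℕ.+-assoc a b (c ℕ.+ d) ⟩
  a ℕ.+ (b ℕ.+ (c ℕ.+ d)) ≡⟨ cong (a ℕ.+_) (ℕ.+-assoc b c d) ⟨
  a ℕ.+ ((b ℕ.+ c) ℕ.+ d) ≡⟨ cong (λ x → a ℕ.+ (x ℕ.+ d)) (ℕ.+-comm b c) ⟩
  a ℕ.+ ((c ℕ.+ b) ℕ.+ d) ≡⟨ cong (a ℕ.+_) (ℕ.+-assoc c b d) ⟩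
  a ℕ.+ (c ℕ.+ (b ℕ.+ d)) ≡⟨ ℕ.+-assoc a c (b ℕ.+ d) ⟨
  (a ℕ.+ c) ℕ.+ (b ℕ.+ d) ∎
  where open ≡-Reasoning

module _ {A : Set} where

  ∈-filterᵇ⁺ : ∀ (p : A → Bool) {x xs} → x ∈ xs → p x ≡ true → x ∈ filterᵇ p xs
  ∈-filterᵇ⁺ p x∈xs px = ∈.∈-filter⁺ (Bool.T? ∘ p) x∈xs (≡true⇒T px)

  ∈-filterᵇ⁻ : ∀ (p : A → Bool) {x xs} → x ∈ filterᵇ p xs → x ∈ xs × p x ≡ true
  ∈-filterᵇ⁻ p {xs = xs} x∈ with ∈.∈-filter⁻ (Bool.T? ∘ p) {xs = xs} x∈
  ... | x∈xs , px = x∈xs , T⇒≡true px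

  same-elements⇒↭ : {xs ys : List A} → Unique xs → Unique ys →
                    (∀ {x} → x ∈ xs → x ∈ ys) → (∀ {x} → x ∈ ys → x ∈ xs) → xs ↭ ys
  same-elements⇒↭ !xs !ys to from = ∼bag⇒↭ (unique∧set⇒bag !xs !ys (mk⇔ to from))

  ∑ : (A → ℕ) → List A → ℕ
  ∑ f xs = sum (map f xs)

  ∑-cong : ∀ {f g : A → ℕ} xs → (∀ {x} → x ∈ xs → f x ≡ g x) → ∑ f xs ≡ ∑ g xs
  ∑-cong []       f≡g = refl
  ∑-cong (x ∷ xs) f≡g = cong₂ ℕ._+_ (f≡g (here refl)) (∑-cong xs (f≡g ∘ there))

  ∑-+ : ∀ (f g : A → ℕ) xs → ∑ (λ x → f x ℕ.+ g x) xs ≡ ∑ f xs ℕ.+ ∑ g xs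
  ∑-+ f g []       = refl
  ∑-+ f g (x ∷ xs) = trans (cong (f x ℕ.+ g x ℕ.+_) (∑-+ f g xs)) (interchange (f x) (g x) _ _)

  if-filterᵇ : ∀ (p : A → Bool) f xs → ∑ f (filterᵇ p xs) ≡ ∑ (λ x → if p x then f x else 0) xs
  if-filterᵇ p f []       = refl
  if-filterᵇ p f (x ∷ xs) with p x
  ... | true  = cong (f x ℕ.+_) (if-filterᵇ p f xs)
  ... | false = if-filterᵇ p f xs

module IndependentSets {A : Set} (adj : A → A → Bool) where

  -- Excluded vertices are recorded in the predicate and not deleted from the list, so that counts
  -- after different deletions run over the same list and can be compared term by term.
  independent : List A → (A → Bool) → ℕ
  independent []      p = 1
  independent (v ∷ L) p =
    independent L p ℕ.+ (if p v then independent L (λ w → p w ∧ not (adj v w)) else 0)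

  Z : List A → ℕ
  Z L = independent L (λ _ → true)

  independent-cong : ∀ L {p q : A → Bool} → (∀ {w} → w ∈ L → p w ≡ q w) → independent L p ≡ independent L q
  independent-cong []      p≡q = refl
  independent-cong (v ∷ L) {p} {q} p≡q = cong₂ ℕ._+_ (independent-cong L (p≡q ∘ there)) tail
    where
    tail : (if p v then independent L (λ w → p w ∧ not (adj v w)) else 0) ≡
           (if q v then independent L (λ w → q w ∧ not (adj v w)) else 0)
    tail rewrite p≡q (here refl) with q v
    ... | true  = independent-cong L (λ {w} w∈L → cong (_∧ not (adj v w)) (p≡q (there w∈L)))
    ... | false = refl

  independent-filterᵇ : ∀ q L p → independent (filterᵇ q L) p ≡ independent L (λ w → q w ∧ p w)
  independent-filterᵇ q []      p = refl
  independent-filterᵇ q (v ∷ L) p with q v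
  ... | false = trans (independent-filterᵇ q L p) (sym (ℕ.+-identityʳ _))
  ... | true with p v
  ...   | false = cong (ℕ._+ 0) (independent-filterᵇ q L p)
  ...   | true  = cong₂ ℕ._+_ (independent-filterᵇ q L p)
    (trans (independent-filterᵇ q L _) (independent-cong L (λ {w} _ → sym (Bool.∧-assoc (q w) (p w) _))))

  Z-filterᵇ : ∀ q L → Z (filterᵇ q L) ≡ independent L q
  Z-filterᵇ q L = trans (independent-filterᵇ q L _) (independent-cong L (λ {w} _ → Bool.∧-identityʳ (q w)))

  Z>0 : ∀ L p → 0 ℕ.< independent L p
  Z>0 []      p = s≤s z≤n
  Z>0 (v ∷ L) p = ℕ.≤-trans (Z>0 L p) (ℕ.m≤m+n _ _)

  independent-mono : ∀ L {p q : A → Bool} → (∀ {w} → w ∈ L → p w ≡ true → q w ≡ true) →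
                     independent L p ℕ.≤ independent L q
  independent-mono []      p⇒q = s≤s z≤n
  independent-mono (v ∷ L) {p} {q} p⇒q = ℕ.+-mono-≤ (independent-mono L (p⇒q ∘ there)) tail
    where
    tail : (if p v then independent L (λ w → p w ∧ not (adj v w)) else 0) ℕ.≤
           (if q v then independent L (λ w → q w ∧ not (adj v w)) else 0)
    tail with p v in pv
    ... | false = z≤n
    ... | true rewrite p⇒q (here refl) pv = independent-mono L step
      where
      step : ∀ {w} → w ∈ L → p w ∧ not (adj v w) ≡ true → q w ∧ not (adj v w) ≡ true
      step {w} w∈L eq with p w in pw | eq
      ... | true | eq′ rewrite p⇒q (there w∈L) pw = eq′

  independent-none : ∀ K R {p} → (∀ {u} → u ∈ K → p u ≡ false) → independent (K ++ R) p ≡ independent R p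
  independent-none []      R none = refl
  independent-none (u ∷ K) R none rewrite none (here refl) =
    trans (ℕ.+-identityʳ _) (independent-none K R (none ∘ there))

  independent-++ : ∀ K R p → (∀ {u v} → u ∈ K → v ∈ R → adj u v ≡ false) →
                   independent (K ++ R) p ≡ independent K p ℕ.* independent R p
  independent-++ []      R p apart = sym (ℕ.+-identityʳ _)
  independent-++ (u ∷ K) R p apart with p u
  ... | false rewrite ℕ.+-identityʳ (independent (K ++ R) p) | ℕ.+-identityʳ (independent K p) =
    independent-++ K R p (apart ∘ there)
  ... | true  = begin
    independent (K ++ R) p ℕ.+ independent (K ++ R) p′
      ≡⟨ cong₂ ℕ._+_ (independent-++ K R p (apart ∘ there)) (independent-++ K R p′ (apart ∘ there)) ⟩
    independent K p ℕ.* independent R p ℕ.+ independent K p′ ℕ.* independent R p′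
      ≡⟨ cong (λ z → independent K p ℕ.* independent R p ℕ.+ independent K p′ ℕ.* z) (independent-cong R same) ⟩
    independent K p ℕ.* independent R p ℕ.+ independent K p′ ℕ.* independent R p
      ≡⟨ ℕ.*-distribʳ-+ (independent R p) (independent K p) (independent K p′) ⟨
    (independent K p ℕ.+ independent K p′) ℕ.* independent R p ∎
    where
    open ≡-Reasoning
    p′ = λ w → p w ∧ not (adj u w)
    same : ∀ {w} → w ∈ R → p w ∧ not (adj u w) ≡ p w
    same {w} w∈R rewrite apart (here refl) w∈R = Bool.∧-identityʳ (p w)

  -- Every independent set meets K in at most one vertex.
  independent-clique : ∀ K R p → Unique K →
    (∀ {u v} → u ∈ K → v ∈ K → p u ≡ true → p v ≡ true → u ≢ v → adj u v ≡ true) →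
    independent (K ++ R) p ≡
    independent R p ℕ.+ ∑ (λ u → if p u then independent R (λ w → p w ∧ not (adj u w)) else 0) K
  independent-clique []      R p !K clique = sym (ℕ.+-identityʳ _)
  independent-clique (u ∷ K) R p (u∉K ∷ !K) clique with p u in pu
  ... | false = trans (ℕ.+-identityʳ _) (independent-clique K R p !K (λ a b → clique (there a) (there b)))
  ... | true  = begin
    independent (K ++ R) p ℕ.+ independent (K ++ R) p′
      ≡⟨ cong₂ ℕ._+_ (independent-clique K R p !K (λ a b → clique (there a) (there b)))
                     (independent-none K R none) ⟩
    independent R p ℕ.+ S ℕ.+ independent R p′
      ≡⟨ ℕ.+-assoc (independent R p) S _ ⟩
    independent R p ℕ.+ (S ℕ.+ independent R p′)
      ≡⟨ cong (independent R p ℕ.+_) (ℕ.+-comm S _) ⟩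
    independent R p ℕ.+ (independent R p′ ℕ.+ S) ∎
    where
    open ≡-Reasoning
    p′ = λ w → p w ∧ not (adj u w)
    S  = ∑ (λ u → if p u then independent R (λ w → p w ∧ not (adj u w)) else 0) K
    none : ∀ {w} → w ∈ K → p w ∧ not (adj u w) ≡ false
    none {w} w∈K with p w in pw
    ... | false = refl
    ... | true rewrite clique (here refl) (there w∈K) pu pw (All.lookup u∉K w∈K) = refl

  pairs : List A → List A → ℕ
  pairs R []      = 0
  pairs R (v ∷ K) =
    ∑ (λ u → if not (adj v u) then independent R (λ w → not (adj v w) ∧ not (adj u w)) else 0) K ℕ.+ pairs R K

  -- An independent set meets `K` in nothing, in one vertex or in a nonadjacent pair. In the
  -- induction the nonneighbours of `v` within the rest of the block form a clique, so that
  -- `independent-clique` counts the sets containing `v`.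
  independent-block : ∀ K R → Unique K →
    (∀ {u v w} → u ∈ K → v ∈ K → w ∈ K → u ≢ v → u ≢ w → v ≢ w →
       adj u v ≡ false → adj u w ≡ false → adj v w ≡ true) →
    Z (K ++ R) ≡ Z R ℕ.+ ∑ (λ v → independent R (λ w → not (adj v w))) K ℕ.+ pairs R K
  independent-block []      R !K α≤2 = sym (trans (ℕ.+-identityʳ _) (ℕ.+-identityʳ _))
  independent-block (v ∷ K) R (v∉K ∷ !K) α≤2 = begin
    Z (K ++ R) ℕ.+ independent (K ++ R) (λ w → not (adj v w))
      ≡⟨ cong₂ ℕ._+_ (independent-block K R !K (λ a b c → α≤2 (there a) (there b) (there c)))
                     (independent-clique K R _ !K clique) ⟩
    (Z R ℕ.+ S ℕ.+ pairs R K) ℕ.+ (cᵥ ℕ.+ T′)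
      ≡⟨ interchange (Z R ℕ.+ S) (pairs R K) cᵥ T′ ⟩
    (Z R ℕ.+ S ℕ.+ cᵥ) ℕ.+ (pairs R K ℕ.+ T′)
      ≡⟨ cong₂ ℕ._+_ (trans (ℕ.+-assoc (Z R) S cᵥ) (cong (Z R ℕ.+_) (ℕ.+-comm S cᵥ))) (ℕ.+-comm (pairs R K) T′) ⟩
    (Z R ℕ.+ (cᵥ ℕ.+ S)) ℕ.+ (T′ ℕ.+ pairs R K) ∎
    where
    open ≡-Reasoning
    S  = ∑ (λ v → independent R (λ w → not (adj v w))) K
    cᵥ = independent R (λ w → not (adj v w))
    T′ = ∑ (λ u → if not (adj v u) then independent R (λ w → not (adj v w) ∧ not (adj u w)) else 0) K
    not-true : ∀ {b} → not b ≡ true → b ≡ false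
    not-true {false} _ = refl
    clique : ∀ {a b} → a ∈ K → b ∈ K → not (adj v a) ≡ true → not (adj v b) ≡ true → a ≢ b → adj a b ≡ true
    clique a∈K b∈K va vb a≢b = α≤2 (here refl) (there a∈K) (there b∈K)
      (All.lookup v∉K a∈K) (All.lookup v∉K b∈K) a≢b (not-true va) (not-true vb)

  module _ (adj-sym : ∀ u v → adj u v ≡ adj v u) where

    independent-swap : ∀ u v L p → independent (u ∷ v ∷ L) p ≡ independent (v ∷ u ∷ L) p
    independent-swap u v L p rewrite adj-sym v u with p u | p v | adj u v
    ... | false | false | _     = refl
    ... | false | true  | _     = interchange (independent L p) _ 0 0
    ... | true  | false | _     = interchange (independent L p) 0 _ 0
    ... | true  | true  | true  = interchange (independent L p) _ _ 0
    ... | true  | true  | false = trans (interchange (independent L p) _ _ _)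
      (cong (λ z → (independent L p ℕ.+ _) ℕ.+ (_ ℕ.+ z)) (independent-cong L (λ {w} _ →
        trans (Bool.∧-assoc (p w) _ _) (trans (cong (p w ∧_) (Bool.∧-comm (not (adj u w)) _)) (sym (Bool.∧-assoc (p w) _ _))))))

    -- Different deletions produce the same vertex set in different orders. Adjacency is tested only
    -- from earlier to later vertices, and its symmetry makes the count independent of the order.
    independent-↭ : ∀ {L L′} p → L ↭ L′ → independent L p ≡ independent L′ p
    independent-↭ p ↭.refl           = refl
    independent-↭ p (↭.prep v σ)     with p v
    ... | true  = cong₂ ℕ._+_ (independent-↭ p σ) (independent-↭ _ σ)
    ... | false = cong (ℕ._+ 0) (independent-↭ p σ)
    independent-↭ p (↭.swap {xs} {ys} u v σ) = trans (independent-swap u v xs p) (lemma v u)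
      where
      two : ∀ u q → independent (u ∷ xs) q ≡ independent (u ∷ ys) q
      two u q with q u
      ... | true  = cong₂ ℕ._+_ (independent-↭ q σ) (independent-↭ _ σ)
      ... | false = cong (ℕ._+ 0) (independent-↭ q σ)
      lemma : ∀ v u → independent (v ∷ u ∷ xs) p ≡ independent (v ∷ u ∷ ys) p
      lemma v u with p v
      ... | true  = cong₂ ℕ._+_ (two u p) (two u _)
      ... | false = cong (ℕ._+ 0) (two u p)
    independent-↭ p (↭.trans σ τ)    = trans (independent-↭ p σ) (independent-↭ p τ)

    Z-same : ∀ {L L′} → Unique L → Unique L′ → (∀ {x} → x ∈ L → x ∈ L′) → (∀ {x} → x ∈ L′ → x ∈ L) → Z L ≡ Z L′
    Z-same !L !L′ to from = independent-↭ _ (same-elements⇒↭ !L !L′ to from)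

    module _ (apart : A → A → Bool) (apart-irrefl : ∀ v → apart v v ≡ false)
             (apart-adj : ∀ {u v} → u ≢ v → apart v u ≡ not (adj v u)) where

      c₁ : List A → A → ℕ
      c₁ R v = independent R (λ w → not (adj v w))

      c₂ : List A → A → A → ℕ
      c₂ R v u = independent R (λ w → not (adj v w) ∧ not (adj u w))

      -- The origin of the factor ½ in the recursion: it sums over ordered nonadjacent pairs, while
      -- `c₂ R` is symmetric in its two vertices.
      ordered-pairs : ∀ K R → Unique K →
        ∑ (λ v → ∑ (c₂ R v) (filterᵇ (apart v) K)) K ≡ 2 ℕ.* pairs R K
      ordered-pairs K R !K =
        trans (∑-cong K (λ {v} _ → if-filterᵇ (apart v) (c₂ R v) K)) (go K !K)
        where
        open ≡-Reasoning
        t : A → A → ℕ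
        t v u = if apart v u then c₂ R v u else 0
        t-irrefl : ∀ v → t v v ≡ 0
        t-irrefl v rewrite apart-irrefl v = refl
        t-adj : ∀ {u v} → v ≢ u → t v u ≡ (if not (adj v u) then c₂ R v u else 0)
        t-adj {u} {v} v≢u rewrite apart-adj {u} {v} (v≢u ∘ sym) = refl
        t-sym : ∀ {u v} → v ≢ u → t u v ≡ (if not (adj v u) then c₂ R v u else 0)
        t-sym {u} {v} v≢u rewrite apart-adj {v} {u} v≢u | adj-sym u v =
          cong (λ z → if not (adj v u) then z else 0) (independent-cong R (λ {w} _ → Bool.∧-comm (not (adj u w)) _))
        go : ∀ K → Unique K → ∑ (λ v → ∑ (t v) K) K ≡ 2 ℕ.* pairs R K
        go []      _          = refl
        go (v ∷ K) (v∉K ∷ !K) = begin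
          (t v v ℕ.+ ∑ (t v) K) ℕ.+ ∑ (λ u → t u v ℕ.+ ∑ (t u) K) K
            ≡⟨ cong₂ ℕ._+_ (cong₂ ℕ._+_ (t-irrefl v) (∑-cong K (λ u∈K → t-adj (All.lookup v∉K u∈K))))
                           (∑-+ (λ u → t u v) (λ u → ∑ (t u) K) K) ⟩
          S ℕ.+ (∑ (λ u → t u v) K ℕ.+ ∑ (λ u → ∑ (t u) K) K)
            ≡⟨ cong (S ℕ.+_) (cong₂ ℕ._+_ (∑-cong K (λ u∈K → t-sym (All.lookup v∉K u∈K))) (go K !K)) ⟩
          S ℕ.+ (S ℕ.+ 2 ℕ.* P)
            ≡⟨ ℕ.+-assoc S S (2 ℕ.* P) ⟨
          S ℕ.+ S ℕ.+ (P ℕ.+ (P ℕ.+ 0))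
            ≡⟨ cong (λ z → S ℕ.+ S ℕ.+ (P ℕ.+ z)) (ℕ.+-identityʳ P) ⟩
          S ℕ.+ S ℕ.+ (P ℕ.+ P)
            ≡⟨ interchange S S P P ⟩
          (S ℕ.+ P) ℕ.+ (S ℕ.+ P)
            ≡⟨ cong ((S ℕ.+ P) ℕ.+_) (ℕ.+-identityʳ (S ℕ.+ P)) ⟨
          2 ℕ.* (S ℕ.+ P) ∎
          where
          S = ∑ (λ u → if not (adj v u) then c₂ R v u else 0) K
          P = pairs R K

-- Values of the basic operations

module _ {A : Set} where

  value-filterᵀ : ∀ (p : A → Timed Bool) xs → value (filterᵀ p xs) ≡ filterᵇ (value ∘ p) xs
  value-filterᵀ p []       = refl
  value-filterᵀ p (x ∷ xs) with value (p x)
  ... | true  = cong (x ∷_) (value-filterᵀ p xs)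
  ... | false = value-filterᵀ p xs

  ∈-filterᵀ⁺ : ∀ (p : A → Timed Bool) {x xs} → x ∈ xs → value (p x) ≡ true → x ∈ value (filterᵀ p xs)
  ∈-filterᵀ⁺ p {xs = xs} x∈xs px rewrite value-filterᵀ p xs = ∈-filterᵇ⁺ (value ∘ p) x∈xs px

  ∈-filterᵀ⁻ : ∀ (p : A → Timed Bool) {x xs} → x ∈ value (filterᵀ p xs) → x ∈ xs × value (p x) ≡ true
  ∈-filterᵀ⁻ p {xs = xs} x∈ rewrite value-filterᵀ p xs = ∈-filterᵇ⁻ (value ∘ p) x∈

  filterᵀ-unique : ∀ (p : A → Timed Bool) {xs} → Unique xs → Unique (value (filterᵀ p xs))
  filterᵀ-unique p {xs} !xs rewrite value-filterᵀ p xs = Unique.filter⁺ (Bool.T? ∘ value ∘ p) !xs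

  length-filterᵀ : ∀ (p : A → Timed Bool) xs → length (value (filterᵀ p xs)) ℕ.≤ length xs
  length-filterᵀ p xs rewrite value-filterᵀ p xs = List.length-filter (Bool.T? ∘ value ∘ p) xs

  anyᵀ⁺ : ∀ (p : A → Timed Bool) {x xs} → x ∈ xs → value (p x) ≡ true → value (anyᵀ p xs) ≡ true
  anyᵀ⁺ p {xs = y ∷ ys} x∈ px with value (p y) in py | x∈
  ... | true  | _          = refl
  ... | false | here refl  = contradiction (trans (sym py) px) λ ()
  ... | false | there x∈ys = anyᵀ⁺ p x∈ys px

  anyᵀ⁻ : ∀ (p : A → Timed Bool) xs → value (anyᵀ p xs) ≡ true → ∃[ x ] x ∈ xs × value (p x) ≡ true
  anyᵀ⁻ p (y ∷ ys) eq with value (p y) in py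
  ... | true  = y , here refl , py
  ... | false with anyᵀ⁻ p ys eq
  ...   | x , x∈ys , px = x , there x∈ys , px

  value-appendᵀ : ∀ (xs ys : List A) → value (appendᵀ xs ys) ≡ xs ++ ys
  value-appendᵀ []       ys = refl
  value-appendᵀ (x ∷ xs) ys = cong (x ∷_) (value-appendᵀ xs ys)

  value-tabulateᵀ : ∀ {n} (f : Fin n → Timed A) i → Vec.lookup (value (tabulateᵀ f)) i ≡ value (f i)
  value-tabulateᵀ f Fin.zero    = refl
  value-tabulateᵀ f (Fin.suc i) = value-tabulateᵀ (f ∘ Fin.suc) i

  isNonemptyᵀ⁺ : ∀ {x : A} {xs} → x ∈ xs → value (isNonemptyᵀ xs) ≡ true
  isNonemptyᵀ⁺ {xs = _ ∷ _} _ = refl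

  isNonemptyᵀ⁻ : ∀ (xs : List A) → value (isNonemptyᵀ xs) ≡ true → ∃[ x ] x ∈ xs
  isNonemptyᵀ⁻ (x ∷ xs) _ = x , here refl

  ⊆⇒length-≤ : ∀ {xs ys : List A} → Unique xs → (∀ {x} → x ∈ xs → x ∈ ys) → length xs ℕ.≤ length ys
  ⊆⇒length-≤ {[]}     _          sub = z≤n
  ⊆⇒length-≤ {x ∷ xs} (x∉xs ∷ !xs) sub with ∈.∈-∃++ (sub (here refl))
  ... | as , bs , refl = subst (suc (length xs) ℕ.≤_) (sym len) (s≤s (⊆⇒length-≤ !xs sub′))
    where
    len : length (as ++ x ∷ bs) ≡ suc (length (as ++ bs))
    len = trans (List.length-++ as) (trans (ℕ.+-suc _ _) (cong suc (sym (List.length-++ as))))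
    sub′ : ∀ {y} → y ∈ xs → y ∈ as ++ bs
    sub′ y∈xs with ∈.∈-++⁻ as (sub (there y∈xs))
    ... | inj₁ y∈as         = ∈.∈-++⁺ˡ y∈as
    ... | inj₂ (here refl)  = contradiction refl (All.lookup x∉xs y∈xs)
    ... | inj₂ (there y∈bs) = ∈.∈-++⁺ʳ as y∈bs

unique-length : ∀ {n} {xs : List (Fin n)} → Unique xs → length xs ℕ.≤ n
unique-length {n} {xs} !xs = subst (length xs ℕ.≤_) (List.length-tabulate {n = n} id) (⊆⇒length-≤ !xs (λ _ → ∈.∈-allFin _))

≡false : ∀ {b} → b ≢ true → b ≡ false
≡false {false} _  = refl
≡false {true}  ≢t = contradiction refl ≢t

true≢false : ∀ {b} → b ≡ true → b ≢ false
true≢false refl ()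

module _ {n : ℕ} where

  ≟ᵀ-refl : ∀ (v : Fin n) → value (v ≟ᵀ v) ≡ true
  ≟ᵀ-refl v with v Fin.≟ v
  ... | yes _  = refl
  ... | no v≢v = contradiction refl v≢v

  ≟ᵀ-≡ : ∀ {u v : Fin n} → value (u ≟ᵀ v) ≡ true → u ≡ v
  ≟ᵀ-≡ {u} {v} eq with u Fin.≟ v
  ... | yes u≡v = u≡v

  ≟ᵀ-≢ : ∀ {u v : Fin n} → u ≢ v → value (u ≟ᵀ v) ≡ false
  ≟ᵀ-≢ u≢v = ≡false (u≢v ∘ ≟ᵀ-≡)

  elem : Fin n → List (Fin n) → Bool
  elem v xs = value (v ∈ᵀ xs)

  elem⁺ : ∀ {v} xs → v ∈ xs → elem v xs ≡ true
  elem⁺ {v} xs v∈xs = anyᵀ⁺ (v ≟ᵀ_) v∈xs (≟ᵀ-refl v)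

  elem⁻ : ∀ {v} xs → elem v xs ≡ true → v ∈ xs
  elem⁻ {v} xs eq with anyᵀ⁻ (v ≟ᵀ_) xs eq
  ... | x , x∈xs , v≡x rewrite ≟ᵀ-≡ v≡x = x∈xs

  ∉⇒elem : ∀ {v} xs → v ∉ xs → elem v xs ≡ false
  ∉⇒elem xs v∉xs = ≡false (v∉xs ∘ elem⁻ xs)

  elem⇒∉ : ∀ {v} xs → elem v xs ≡ false → v ∉ xs
  elem⇒∉ xs eq v∈xs = true≢false (elem⁺ xs v∈xs) eq

  infixl 6 _⊝_
  _⊝_ : List (Fin n) → List (Fin n) → List (Fin n)
  xs ⊝ ys = value (xs ∖ ys)

  ∈-⊝⁺ : ∀ {x xs} ys → x ∈ xs → x ∉ ys → x ∈ xs ⊝ ys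
  ∈-⊝⁺ ys x∈xs x∉ys = ∈-filterᵀ⁺ (λ x → do b ← x ∈ᵀ ys; return (not b)) x∈xs (cong not (∉⇒elem ys x∉ys))

  ∈-⊝⁻ : ∀ {x} xs ys → x ∈ xs ⊝ ys → x ∈ xs × x ∉ ys
  ∈-⊝⁻ {x} xs ys x∈ with ∈-filterᵀ⁻ (λ x → do b ← x ∈ᵀ ys; return (not b)) {xs = xs} x∈
  ... | x∈xs , eq = x∈xs , λ x∈ys → contradiction (trans (sym eq) (cong not (elem⁺ ys x∈ys))) λ ()

  ⊝-unique : ∀ {xs} ys → Unique xs → Unique (xs ⊝ ys)
  ⊝-unique ys = filterᵀ-unique (λ x → do b ← x ∈ᵀ ys; return (not b))

  length-⊝ : ∀ xs ys → length (xs ⊝ ys) ℕ.≤ length xs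
  length-⊝ xs ys = length-filterᵀ (λ x → do b ← x ∈ᵀ ys; return (not b)) xs

  ++-⊝-↭ : ∀ {G K : List (Fin n)} → Unique G → Unique K → (∀ {x} → x ∈ K → x ∈ G) → K ++ (G ⊝ K) ↭ G
  ++-⊝-↭ {G} {K} !G !K K⊆G = same-elements⇒↭
    (Unique.++⁺ !K (⊝-unique K !G) (λ (x∈K , x∈G⊝K) → proj₂ (∈-⊝⁻ G K x∈G⊝K) x∈K)) !G to from
    where
    to : ∀ {x} → x ∈ K ++ (G ⊝ K) → x ∈ G
    to x∈ with ∈.∈-++⁻ K x∈
    ... | inj₁ x∈K   = K⊆G x∈K
    ... | inj₂ x∈G⊝K = proj₁ (∈-⊝⁻ G K x∈G⊝K)
    from : ∀ {x} → x ∈ G → x ∈ K ++ (G ⊝ K)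
    from {x} x∈G with elem x K in eq
    ... | true  = ∈.∈-++⁺ˡ (elem⁻ K eq)
    ... | false = ∈.∈-++⁺ʳ K (∈-⊝⁺ K x∈G (elem⇒∉ K eq))


length-filterᵇ-map : ∀ {A B : Set} (q : B → Bool) (f : A → B) xs →
                     length (filterᵇ q (map f xs)) ≡ length (filterᵇ (q ∘ f) xs)
length-filterᵇ-map q f []       = refl
length-filterᵇ-map q f (x ∷ xs) with q (f x)
... | true  = cong suc (length-filterᵇ-map q f xs)
... | false = length-filterᵇ-map q f xs

-- Connectivity

module Graph {n : ℕ} (adjacency : AdjacencyMatrix n) where

  open InducedSubgraphs adjacency public

  adj : V → V → Bool
  adj u v = Vec.lookup (Vec.lookup adjacency u) v

  nbrs : List V → V → List V
  nbrs G v = value (N G v)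

  ∈-nbrs⁺ : ∀ {v w G} → w ∈ G → adj v w ≡ true → w ∈ nbrs G v
  ∈-nbrs⁺ {v} = ∈-filterᵀ⁺ (adjacentᵀ v)

  ∈-nbrs⁻ : ∀ {v w} G → w ∈ nbrs G v → w ∈ G × adj v w ≡ true
  ∈-nbrs⁻ {v} G = ∈-filterᵀ⁻ (adjacentᵀ v)

  nbrs-unique : ∀ {G} v → Unique G → Unique (nbrs G v)
  nbrs-unique v = filterᵀ-unique (adjacentᵀ v)

  length-nbrs : ∀ G v → length (nbrs G v) ℕ.≤ length G
  length-nbrs G v = length-filterᵀ (adjacentᵀ v) G

  infix 4 _≈_
  record _≈_ (G G′ : List V) : Set where
    constructor same
    field
      to   : ∀ {x} → x ∈ G → x ∈ G′
      from : ∀ {x} → x ∈ G′ → x ∈ G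
  open _≈_

  ↭⇒≈ : ∀ {G G′} → G ↭ G′ → G ≈ G′
  ↭⇒≈ σ = same (↭.∈-resp-↭ σ) (↭.∈-resp-↭ (↭.↭-sym σ))

  ↭-unique : ∀ {G G′ : List V} → G ↭ G′ → Unique G → Unique G′
  ↭-unique σ = Setoid.Unique-resp-↭ (setoid V) (↭.↭⇒↭ₛ σ)

  Crossing : List V → (V → Bool) → Set
  Crossing G A = ∃[ u ] ∃[ v ] u ∈ G × v ∈ G × A u ≡ true × A v ≡ false × adj u v ≡ true

  -- Connectivity is stated through cuts and not through paths, because the applications start from
  -- a vertex set and ask for an edge that leaves it.
  Connected : List V → Set
  Connected G = ∀ (A : V → Bool) {x y} → x ∈ G → y ∈ G → A x ≡ true → A y ≡ false → Crossing G A

  Connected-resp : ∀ {G G′} → G ≈ G′ → Connected G → Connected G′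
  Connected-resp G≈G′ conn A x∈ y∈ Ax Ay with conn A (from G≈G′ x∈) (from G≈G′ y∈) Ax Ay
  ... | u , v , u∈ , v∈ , rest = u , v , to G≈G′ u∈ , to G≈G′ v∈ , rest

  Apart : List V → List V → Set
  Apart C R = ∀ {u v} → u ∈ C → v ∈ R → adj u v ≡ false

  -- `spreads` replaces reachability by paths: a property that holds on the seeds and is passed
  -- along the edges inside `C` holds on all of `C`. In this form it combines directly with
  -- connectivity by cuts.
  record Grown (S R C Q : List V) : Set where
    field
      all      : C ++ Q ↭ S ++ R
      apart    : Apart C Q
      seeds    : ∀ {x} → x ∈ S → x ∈ C
      rest     : ∀ {x} → x ∈ Q → x ∈ R
      spreads  : ∀ (A : V → Bool) → (∀ {u w} → u ∈ C → w ∈ C → adj u w ≡ true → A u ≡ true → A w ≡ true) →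
                 (∀ {x} → x ∈ S → A x ≡ true) → ∀ {x} → x ∈ C → A x ≡ true

  nbrs-⊝-↭ : ∀ v {R} → Unique R → nbrs R v ++ (R ⊝ nbrs R v) ↭ R
  nbrs-⊝-↭ v {R} !R = ++-⊝-↭ !R (nbrs-unique v !R) (proj₁ ∘ ∈-nbrs⁻ R)

  -- Every round finishes one vertex of the work list, while new vertices only move from `R` to that
  -- list. Hence `length S + length R` falls by exactly one, and the fuel lasts.
  grow-spec : ∀ fuel S R → Unique R → length S ℕ.+ length R ℕ.≤ fuel →
              let (C , Q) = value (grow fuel S R) in Grown S R C Q
  grow-spec zero       []      []      !R _ = record
    { all = ↭.refl ; apart = λ () ; seeds = λ () ; rest = λ () ; spreads = λ _ _ _ () }
  grow-spec (suc fuel) []      R       !R _ = record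
    { all = ↭.refl ; apart = λ () ; seeds = λ () ; rest = id ; spreads = λ _ _ _ () }
  grow-spec (suc fuel) (v ∷ S) R       !R (s≤s le) =
    subst (λ S′ → let (C , Q) = value (grow fuel S′ R′) in Grown (v ∷ S) R (v ∷ C) Q)
      (sym (value-appendᵀ new S)) conclusion
    where
    new = nbrs R v
    R′  = R ⊝ new
    split : new ++ R′ ↭ R
    split = nbrs-⊝-↭ v !R
    len : length (new ++ S) ℕ.+ length R′ ℕ.≤ fuel
    len = subst (ℕ._≤ fuel) (sym eq) le
      where
      open ≡-Reasoning
      eq : length (new ++ S) ℕ.+ length R′ ≡ length S ℕ.+ length R
      eq = begin
        length (new ++ S) ℕ.+ length R′           ≡⟨ cong (ℕ._+ length R′) (trans (List.length-++ new) (ℕ.+-comm (length new) _)) ⟩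
        length S ℕ.+ length new ℕ.+ length R′     ≡⟨ ℕ.+-assoc (length S) _ _ ⟩
        length S ℕ.+ (length new ℕ.+ length R′)   ≡⟨ cong (length S ℕ.+_) (List.length-++ new) ⟨
        length S ℕ.+ length (new ++ R′)           ≡⟨ cong (length S ℕ.+_) (↭.↭-length split) ⟩
        length S ℕ.+ length R                     ∎
    conclusion : let (C , Q) = value (grow fuel (new ++ S) R′) in Grown (v ∷ S) R (v ∷ C) Q
    conclusion with value (grow fuel (new ++ S) R′) | grow-spec fuel (new ++ S) R′ (⊝-unique new !R) len
    ... | C , Q | ih = record
      { all     = ↭.prep v (↭.↭-trans (Grown.all ih) (↭.↭-trans (↭.++⁺ʳ R′ (↭.++-comm new S))
                    (↭.↭-trans (↭.↭-reflexive (List.++-assoc S new R′)) (↭.++⁺ˡ S split))))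
      ; apart   = λ { (here refl) w∈Q → ≡false λ vw → proj₂ (rest⁻ w∈Q) (∈-nbrs⁺ (proj₁ (rest⁻ w∈Q)) vw)
                    ; (there u∈C) w∈Q → Grown.apart ih u∈C w∈Q }
      ; seeds   = λ { (here refl) → here refl ; (there x∈S) → there (Grown.seeds ih (∈.∈-++⁺ʳ new x∈S)) }
      ; rest    = proj₁ ∘ rest⁻
      ; spreads = λ A closed seeds → λ
          { (here refl) → seeds (here refl)
          ; (there x∈C) → Grown.spreads ih A (λ u∈ w∈ → closed (there u∈) (there w∈))
              (λ x∈ → from-new A closed seeds (∈.∈-++⁻ new x∈)) x∈C } }
      where
      rest⁻ : ∀ {w} → w ∈ Q → w ∈ R × w ∉ new
      rest⁻ w∈Q = ∈-⊝⁻ R new (Grown.rest ih w∈Q)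
      from-new : ∀ A → (∀ {u w} → u ∈ v ∷ C → w ∈ v ∷ C → adj u w ≡ true → A u ≡ true → A w ≡ true) →
                 (∀ {x} → x ∈ v ∷ S → A x ≡ true) → ∀ {x} → x ∈ new ⊎ x ∈ S → A x ≡ true
      from-new A closed seeds (inj₁ x∈new) = closed (here refl) (there (Grown.seeds ih (∈.∈-++⁺ˡ x∈new)))
        (proj₂ (∈-nbrs⁻ R x∈new)) (seeds (here refl))
      from-new A closed seeds (inj₂ x∈S)   = seeds (there x∈S)

  crossing? : ∀ G A → Crossing G A ⊎ (∀ {u w} → u ∈ G → w ∈ G → adj u w ≡ true → A u ≡ true → A w ≡ true)
  crossing? G A with Any.any? (λ u → Any.any? (λ v → Bool.T? (A u ∧ not (A v) ∧ adj u v)) G) G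
  ... | yes any with find any
  ...   | u , u∈G , any′ with find any′
  ...     | v , v∈G , ok with A u in Au | A v in Av | adj u v in uv
  ...       | true | false | true = inj₁ (u , v , u∈G , v∈G , Au , Av , uv)
  crossing? G A | no none = inj₂ λ {u} {w} u∈G w∈G uw Au → closed u∈G w∈G uw Au
    where
    closed : ∀ {u w} → u ∈ G → w ∈ G → adj u w ≡ true → A u ≡ true → A w ≡ true
    closed {u} {w} u∈G w∈G uw Au with A w in Aw
    ... | true  = refl
    ... | false = contradiction (lose u∈G (lose w∈G ok)) none
      where
      ok : T (A u ∧ not (A w) ∧ adj u w)
      ok rewrite Au | Aw | uw = tt

  module Symmetric (adj-sym : ∀ u v → adj u v ≡ adj v u) where

    -- If no edge leaves A, then A contains either all or nothing, according
    -- to the seed.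
    grown-connected : ∀ {v R C Q} → Grown (v ∷ []) R C Q → Connected C
    grown-connected {v} {C = C} g A {x} {y} x∈C y∈C Ax Ay with A v in Av
    ... | true  with crossing? C A
    ...   | inj₁ crossing = crossing
    ...   | inj₂ closed   = contradiction Ay
      (true≢false (Grown.spreads g A closed (λ { (here refl) → Av }) y∈C))
    grown-connected {v} {C = C} g A {x} {y} x∈C y∈C Ax Ay | false with crossing? C (not ∘ A)
    ...   | inj₁ (u , w , u∈C , w∈C , ¬Au , ¬Aw , uw) =
      w , u , w∈C , u∈C , Bool.not-injective ¬Aw , Bool.not-injective ¬Au , trans (adj-sym w u) uw
    ...   | inj₂ closed   = contradiction (cong not Ax)
      (true≢false (Grown.spreads g (not ∘ A) closed (λ { (here refl) → cong not Av }) x∈C))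

    data Components : List V → List (List V) → Set where
      []  : Components [] []
      add : ∀ {G C R Cs x} → x ∈ C → Connected C → G ↭ C ++ R → Apart C R → Components R Cs →
            Components G (C ∷ Cs)

    componentsFrom-spec : ∀ fuel G → Unique G → length G ℕ.≤ fuel → Components G (value (componentsFrom fuel G))
    componentsFrom-spec zero       []      !G _ = []
    componentsFrom-spec (suc fuel) []      !G _ = []
    componentsFrom-spec (suc fuel) (v ∷ G) !vG@(_ ∷ !G) (s≤s le)
      with value (grow n (v ∷ []) G) | grow-spec n (v ∷ []) G !G (unique-length !vG)
    ... | C , R | g = add (Grown.seeds g (here refl)) (grown-connected g) (↭.↭-sym (Grown.all g)) (Grown.apart g)
      (componentsFrom-spec fuel R !R (ℕ.≤-trans (⊆⇒length-≤ !R (Grown.rest g)) le))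
      where
      !R : Unique R
      !R = Unique-++⁻ʳ C (↭-unique (↭.↭-sym (Grown.all g)) !vG)
        where
        Unique-++⁻ʳ : ∀ (xs : List V) {ys} → Unique (xs ++ ys) → Unique ys
        Unique-++⁻ʳ []       !ys        = !ys
        Unique-++⁻ʳ (x ∷ xs) (_ ∷ !xsys) = Unique-++⁻ʳ xs !xsys

    components-spec : ∀ {G} → Unique G → Components G (value (components G))
    components-spec {G} !G = componentsFrom-spec n G !G (unique-length !G)

    -- If there were a second component, membership in the first would be a cut without a crossing
    -- edge.
    isConnected⁺ : ∀ {G} → Unique G → Connected G → value (isConnected G) ≡ true
    isConnected⁺ {G} !G conn with value (components G) | components-spec !G
    ... | []          | _ = refl
    ... | C ∷ []      | _ = refl
    ... | C ∷ D ∷ Cs  | add {C = C} {R = R} x∈C _ σ apart (add y∈D _ τ _ _)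
      with conn (λ v → elem v C) (↭.∈-resp-↭ (↭.↭-sym σ) (∈.∈-++⁺ˡ x∈C)) (↭.∈-resp-↭ (↭.↭-sym σ) (∈.∈-++⁺ʳ C y∈R))
                (elem⁺ C x∈C) (≡false λ e → contradiction e (y∉C ∘ elem⁻ C))
      where
      y∈R = ↭.∈-resp-↭ (↭.↭-sym τ) (∈.∈-++⁺ˡ y∈D)
      y∉C : _ ∉ C
      y∉C y∈C = disjoint C (↭-unique σ !G) y∈C y∈R
        where
        disjoint : ∀ (xs : List V) {ys} → Unique (xs ++ ys) → ∀ {x} → x ∈ xs → x ∉ ys
        disjoint (x ∷ xs) (x∉ ∷ _) (here refl) x∈ys = All.lookup x∉ (∈.∈-++⁺ʳ xs x∈ys) refl
        disjoint (x ∷ xs) (_ ∷ !)  (there x∈)  x∈ys = disjoint xs ! x∈ x∈ys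
    ...   | u , v , u∈G , v∈G , Cu , Cv , uv with ∈.∈-++⁻ C (↭.∈-resp-↭ σ v∈G)
    ...     | inj₁ v∈C = contradiction Cv (true≢false (elem⁺ C v∈C))
    ...     | inj₂ v∈R = contradiction (apart (elem⁻ C Cu) v∈R) (true≢false uv)

    isConnected⁻ : ∀ {G} → Unique G → value (isConnected G) ≡ true → Connected G
    isConnected⁻ {G} !G eq with value (components G) | components-spec !G
    ... | []     | [] = λ A ()
    ... | C ∷ [] | add {R = .[]} _ conn σ _ [] =
      Connected-resp (↭⇒≈ (↭.↭-sym (↭.↭-trans σ (↭.↭-reflexive (List.++-identityʳ C))))) conn

-- Blocks

length-split : ∀ {A : Set} (p : A → Bool) xs →
               length xs ≡ length (filterᵇ p xs) ℕ.+ length (filterᵇ (not ∘ p) xs)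
length-split p []       = refl
length-split p (x ∷ xs) with p x
... | true  = cong suc (length-split p xs)
... | false = trans (cong suc (length-split p xs)) (sym (ℕ.+-suc _ _))

length-≤2 : ∀ {A : Set} {xs : List A} → Unique xs →
            (∀ {a b c} → a ∈ xs → b ∈ xs → c ∈ xs → a ≡ b ⊎ a ≡ c ⊎ b ≡ c) → length xs ℕ.≤ 2
length-≤2 {xs = []}            _  _ = z≤n
length-≤2 {xs = a ∷ []}        _  _ = s≤s z≤n
length-≤2 {xs = a ∷ b ∷ []}    _  _ = s≤s (s≤s z≤n)
length-≤2 {xs = a ∷ b ∷ c ∷ _} ((a≢b ∷ a≢c ∷ _) ∷ (b≢c ∷ _) ∷ _) two
  with two (here refl) (there (here refl)) (there (there (here refl)))
... | inj₁ a≡b        = contradiction a≡b a≢b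
... | inj₂ (inj₁ a≡c) = contradiction a≡c a≢c
... | inj₂ (inj₂ b≡c) = contradiction b≡c b≢c

same-side : ∀ {x y z : Bool} → x ≢ y → x ≢ z → y ≡ z
same-side {true}  {true}          x≢y _   = contradiction refl x≢y
same-side {true}  {false} {true}  _   x≢z = contradiction refl x≢z
same-side {true}  {false} {false} _   _   = refl
same-side {false} {false}         x≢y _   = contradiction refl x≢y
same-side {false} {true}  {false} _   x≢z = contradiction refl x≢z
same-side {false} {true}  {true}  _   _   = refl

∧-true : ∀ {x y} → x ∧ y ≡ true → x ≡ true × y ≡ true
∧-true {true} {true} _ = refl , refl

not-true : ∀ {x} → not x ≡ true → x ≡ false
not-true {false} _ = refl

next : Fin 3 → Fin 3
next Fin.zero                     = Fin.suc Fin.zero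
next (Fin.suc Fin.zero)           = Fin.suc (Fin.suc Fin.zero)
next (Fin.suc (Fin.suc Fin.zero)) = Fin.zero

-- Among the two labels different from `l` exactly one is `next l`. A comparison with `next l`
-- therefore turns three labels, one of them excluded, into the two sides of a block.
two-others : ∀ (l i j : Fin 3) → i ≢ l → j ≢ l →
             value (i ≟ᵀ next l) ≡ value (j ≟ᵀ next l) → i ≡ j
two-others Fin.zero Fin.zero _ i≢l _ _ = contradiction refl i≢l
two-others Fin.zero (Fin.suc _) Fin.zero _ j≢l _ = contradiction refl j≢l
two-others Fin.zero (Fin.suc Fin.zero) (Fin.suc Fin.zero) _ _ _ = refl
two-others Fin.zero (Fin.suc (Fin.suc Fin.zero)) (Fin.suc (Fin.suc Fin.zero)) _ _ _ = refl
two-others (Fin.suc Fin.zero) (Fin.suc Fin.zero) _ i≢l _ _ = contradiction refl i≢l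
two-others (Fin.suc Fin.zero) _ (Fin.suc Fin.zero) _ j≢l _ = contradiction refl j≢l
two-others (Fin.suc Fin.zero) Fin.zero Fin.zero _ _ _ = refl
two-others (Fin.suc Fin.zero) (Fin.suc (Fin.suc Fin.zero)) (Fin.suc (Fin.suc Fin.zero)) _ _ _ = refl
two-others (Fin.suc Fin.zero) Fin.zero (Fin.suc (Fin.suc Fin.zero)) _ _ ()
two-others (Fin.suc Fin.zero) (Fin.suc (Fin.suc Fin.zero)) Fin.zero _ _ ()
two-others (Fin.suc (Fin.suc Fin.zero)) (Fin.suc (Fin.suc Fin.zero)) _ i≢l _ _ = contradiction refl i≢l
two-others (Fin.suc (Fin.suc Fin.zero)) _ (Fin.suc (Fin.suc Fin.zero)) _ j≢l _ = contradiction refl j≢l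
two-others (Fin.suc (Fin.suc Fin.zero)) Fin.zero Fin.zero _ _ _ = refl
two-others (Fin.suc (Fin.suc Fin.zero)) (Fin.suc Fin.zero) (Fin.suc Fin.zero) _ _ _ = refl

-- The neighbours of every vertex are covered by three cliques of at most
-- two vertices each, as in the intersection graph of a (3,3)-graph.
record Local {n : ℕ} (adjacency : AdjacencyMatrix n) : Set where
  open Graph adjacency using (V; adj)
  field
    adj-sym    : ∀ u v → adj u v ≡ adj v u
    adj-irrefl : ∀ v → adj v v ≡ false
    label      : V → V → Fin 3
    clique     : ∀ {v a b} → adj v a ≡ true → adj v b ≡ true → label v a ≡ label v b → a ≢ b → adj a b ≡ true
    small      : ∀ {v a b c} → adj v a ≡ true → adj v b ≡ true → adj v c ≡ true →
                 label v a ≡ label v b → label v a ≡ label v c → a ≡ b ⊎ a ≡ c ⊎ b ≡ c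

module Blocks {n : ℕ} {adjacency : AdjacencyMatrix n} (local : Local adjacency) where

  open Graph adjacency public
  open Local local public using (adj-sym; adj-irrefl)
  open Symmetric adj-sym public
  open Local local using (label)
  open _≈_

  adj-flip : ∀ {u v b} → adj u v ≡ b → adj v u ≡ b
  adj-flip {u} {v} uv = trans (adj-sym v u) uv

  -- The vertices appear in reverse order of construction: the head was attached last, so that
  -- removing it leaves a tree.
  data Tree : List V → Set where
    root : ∀ v → Tree (v ∷ [])
    leaf : ∀ {w x T} → x ∈ T → adj w x ≡ true → Tree T → Tree (w ∷ T)

  Crossing-⊆ : ∀ {G G′ A} → (∀ {x} → x ∈ G → x ∈ G′) → Crossing G A → Crossing G′ A
  Crossing-⊆ sub (u , v , u∈ , v∈ , rest) = u , v , sub u∈ , sub v∈ , rest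

  tree-connected : ∀ {T} → Tree T → Connected T
  tree-connected (root v) A (here refl) (here refl) Ax Ay = contradiction Ay (true≢false Ax)
  tree-connected (leaf x∈T wx t) A (here refl) (here refl) Aw Aw′ = contradiction Aw′ (true≢false Aw)
  tree-connected (leaf x∈T wx t) A (there a∈) (there b∈) Aa Ab = Crossing-⊆ there (tree-connected t A a∈ b∈ Aa Ab)
  tree-connected (leaf {w} {x} x∈T wx t) A (here refl) (there b∈) Aw Ab with A x in Ax
  ... | true  = Crossing-⊆ there (tree-connected t A x∈T b∈ Ax Ab)
  ... | false = w , x , here refl , there x∈T , Aw , Ax , wx
  tree-connected (leaf {w} {x} x∈T wx t) A (there a∈) (here refl) Aa Aw with A x in Ax
  ... | true  = x , w , there x∈T , here refl , Ax , Aw , adj-flip wx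
  ... | false = Crossing-⊆ there (tree-connected t A a∈ x∈T Aa Ax)

  tree-nonempty : ∀ {T} → Tree T → ∃[ x ] x ∈ T
  tree-nonempty (root v)       = v , here refl
  tree-nonempty (leaf _ _ _)   = _ , here refl

  -- As long as `T` misses a vertex of `F`, connectivity gives an edge leaving `T`, and its outer
  -- end becomes the next leaf. The fuel bounds the number of missing vertices.
  spanning-tree : ∀ {F} → Unique F → Connected F → ∀ fuel {T} → Tree T → Unique T → (∀ {x} → x ∈ T → x ∈ F) →
                  length (F ⊝ T) ℕ.≤ fuel → ∃[ T′ ] Tree T′ × Unique T′ × T′ ≈ F
  spanning-tree {F} !F conn fuel {T} t !T T⊆F le with F ⊝ T in eq | fuel | le
  ... | [] | _ | _ = T , t , !T , same T⊆F F⊆T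
    where
    F⊆T : ∀ {x} → x ∈ F → x ∈ T
    F⊆T {x} x∈F with elem x T in xT
    ... | true  = elem⁻ T xT
    ... | false with subst (x ∈_) eq (∈-⊝⁺ T x∈F (elem⇒∉ T xT))
    ...   | ()
  ... | y ∷ ys | suc fuel′ | s≤s le′ with tree-nonempty t | ∈-⊝⁻ F T (subst (y ∈_) (sym eq) (here refl))
  ...   | x , x∈T | y∈F , y∉T with conn (λ v → elem v T) (T⊆F x∈T) y∈F (elem⁺ T x∈T) (∉⇒elem T y∉T)
  ...     | u , v , u∈F , v∈F , Tu , Tv , uv =
    spanning-tree !F conn fuel′ (leaf (elem⁻ T Tu) (adj-flip uv) t) (All.¬Any⇒All¬ T v∉T ∷ !T)
      (λ { (here refl) → v∈F ; (there x∈) → T⊆F x∈ }) (ℕ.≤-trans (ℕ.s≤s⁻¹ smaller) le′)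
    where
    v∉T = elem⇒∉ T Tv
    smaller : suc (length (F ⊝ (v ∷ T))) ℕ.≤ suc (length ys)
    smaller = subst (λ L → suc (length (F ⊝ (v ∷ T))) ℕ.≤ length L) eq
      (⊆⇒length-≤ {xs = v ∷ F ⊝ (v ∷ T)}
        (All.¬Any⇒All¬ _ (λ v∈ → proj₂ (∈-⊝⁻ F (v ∷ T) v∈) (here refl)) ∷ ⊝-unique (v ∷ T) !F)
        (λ { (here refl) → ∈-⊝⁺ T v∈F v∉T
           ; (there x∈)  → ∈-⊝⁺ T (proj₁ (∈-⊝⁻ F (v ∷ T) x∈)) (proj₂ (∈-⊝⁻ F (v ∷ T) x∈) ∘ there) }))

  -- The last leaf of a spanning tree is not a cut vertex.
  noncut-vertex : ∀ {F x} → Unique F → Connected F → x ∈ F → ∃[ v ] v ∈ F × Connected (F ⊝ (v ∷ []))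
  noncut-vertex {F} {x} !F conn x∈F
    with spanning-tree !F conn (length (F ⊝ (x ∷ []))) (root x) ([] ∷ []) (λ { (here refl) → x∈F }) ℕ.≤-refl
  ... | _ , root v , _ , T≈F = v , to T≈F (here refl) , λ A a∈ _ _ _ → contradiction (only a∈) (λ ())
    where
    only : ∀ {a} → a ∈ F ⊝ (v ∷ []) → a ∈ []
    only a∈ = contradiction (from T≈F (proj₁ (∈-⊝⁻ F (v ∷ []) a∈))) (proj₂ (∈-⊝⁻ F (v ∷ []) a∈))
  ... | _ , leaf {w} {T = T} _ _ t , (w∉T ∷ _) , T≈F = w , to T≈F (here refl) ,
    Connected-resp (same (λ x∈T → ∈-⊝⁺ (w ∷ []) (to T≈F (there x∈T)) λ { (here refl) → All.lookup w∉T x∈T refl }) back)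
      (tree-connected t)
    where
    back : ∀ {x} → x ∈ F ⊝ (w ∷ []) → x ∈ T
    back x∈ with from T≈F (proj₁ (∈-⊝⁻ F (w ∷ []) x∈))
    ... | here refl = contradiction (here refl) (proj₂ (∈-⊝⁻ F (w ∷ []) x∈))
    ... | there x∈T = x∈T

  -- A covering by two cliques of at most two vertices.  It implies the
  -- conditions on a block in the paper.
  record Block (L : List V) : Set where
    field
      side   : V → Bool
      clique : ∀ {a b} → a ∈ L → b ∈ L → a ≢ b → side a ≡ side b → adj a b ≡ true
      small  : ∀ {a b c} → a ∈ L → b ∈ L → c ∈ L → side a ≡ side b → side a ≡ side c → a ≡ b ⊎ a ≡ c ⊎ b ≡ c

  Block-⊆ : ∀ {L L′} → (∀ {x} → x ∈ L′ → x ∈ L) → Block L → Block L′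
  Block-⊆ sub b = record
    { side   = Block.side b
    ; clique = λ a∈ b∈ → Block.clique b (sub a∈) (sub b∈)
    ; small  = λ a∈ b∈ c∈ → Block.small b (sub a∈) (sub b∈) (sub c∈) }

  -- Of the three cliques around `u`, the one containing `r` has no vertex in `L`, since its members
  -- other than `r` are adjacent to `r`. The two remaining cliques are the sides of the block. In
  -- each use `r` is a vertex outside the current graph.
  next-block : ∀ {r u L} → adj u r ≡ true →
               (∀ {w} → w ∈ L → adj u w ≡ true × adj r w ≡ false × w ≢ r) → Block L
  next-block {r} {u} {L} ur L⊆ = record
    { side   = λ w → value (label u w ≟ᵀ next (label u r))
    ; clique = λ {a} {b} a∈ b∈ a≢b eq → Local.clique local (near a∈) (near b∈) (same-label a∈ b∈ eq) a≢b
    ; small  = λ a∈ b∈ c∈ ab ac →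
        Local.small local (near a∈) (near b∈) (near c∈) (same-label a∈ b∈ ab) (same-label a∈ c∈ ac) }
    where
    near : ∀ {w} → w ∈ L → adj u w ≡ true
    near w∈ = proj₁ (L⊆ w∈)
    other : ∀ {w} → w ∈ L → label u w ≢ label u r
    other w∈ eq with L⊆ w∈
    ... | uw , rw , w≢r = true≢false (adj-flip (Local.clique local uw ur eq w≢r)) rw
    same-label : ∀ {a b} → a ∈ L → b ∈ L →
                 value (label u a ≟ᵀ next (label u r)) ≡ value (label u b ≟ᵀ next (label u r)) → label u a ≡ label u b
    same-label a∈ b∈ = two-others (label u r) _ _ (other a∈) (other b∈)

  module _ {K : List V} (block : Block K) where
    open Block block

    block-sides : ∀ {a b} → a ∈ K → b ∈ K → a ≢ b → adj a b ≡ false → side a ≢ side b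
    block-sides a∈ b∈ a≢b ab eq = true≢false (clique a∈ b∈ a≢b eq) ab

    -- Nonadjacency forces opposite sides, so `v` and `w` are both on the side that does not contain
    -- `u`.
    block-α≤2 : ∀ {u v w} → u ∈ K → v ∈ K → w ∈ K → u ≢ v → u ≢ w → v ≢ w →
                adj u v ≡ false → adj u w ≡ false → adj v w ≡ true
    block-α≤2 u∈ v∈ w∈ u≢v u≢w v≢w uv uw =
      clique v∈ w∈ v≢w (same-side (block-sides u∈ v∈ u≢v uv) (block-sides u∈ w∈ u≢w uw))

    block-length : Unique K → length K ℕ.≤ 4
    block-length !K = subst (ℕ._≤ 4) (sym (length-split side K)) (ℕ.+-mono-≤ (half side id) (half (not ∘ side) Bool.not-injective))
      where
      half : ∀ p → (∀ {a b} → p a ≡ p b → side a ≡ side b) → length (filterᵇ p K) ℕ.≤ 2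
      half p inj = length-≤2 (Unique.filter⁺ (Bool.T? ∘ p) !K) λ a∈ b∈ c∈ →
        let (a∈K , pa) = ∈-filterᵇ⁻ p a∈
            (b∈K , pb) = ∈-filterᵇ⁻ p b∈
            (c∈K , pc) = ∈-filterᵇ⁻ p c∈
        in small a∈K b∈K c∈K (inj (trans pa (sym pb))) (inj (trans pa (sym pc)))

    apart⁻ : ∀ {v u} → value (notAdjacentᵀ v u) ≡ true → u ≢ v × adj v u ≡ false
    apart⁻ {v} {u} eq with ∧-true {not (value (u ≟ᵀ v))} eq
    ... | u≢v , vu = (λ { refl → true≢false (≟ᵀ-refl v) (not-true u≢v) }) , not-true vu

    -- All nonneighbours of `v` in the block lie on the opposite side, which has at most two
    -- vertices. This bounds the number of terms of the inner sum in the recursion.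
    block-apart : Unique K → ∀ {v} → v ∈ K → length (value (filterᵀ (notAdjacentᵀ v) K)) ℕ.≤ 2
    block-apart !K {v} v∈K = length-≤2 (filterᵀ-unique (notAdjacentᵀ v) !K) λ a∈ b∈ c∈ →
      let (a∈K , va) = ∈-filterᵀ⁻ (notAdjacentᵀ v) {xs = K} a∈
          (b∈K , vb) = ∈-filterᵀ⁻ (notAdjacentᵀ v) {xs = K} b∈
          (c∈K , vc) = ∈-filterᵀ⁻ (notAdjacentᵀ v) {xs = K} c∈
      in small a∈K b∈K c∈K (same-side (opposite a∈K va) (opposite b∈K vb))
                           (same-side (opposite a∈K va) (opposite c∈K vc))
      where
      opposite : ∀ {u} → u ∈ K → value (notAdjacentᵀ v u) ≡ true → side v ≢ side u
      opposite u∈K eq = let (u≢v , vu) = apart⁻ eq in block-sides v∈K u∈K (u≢v ∘ sym) vu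

  -- K is the neighbourhood in G of a vertex outside G.  This makes K a
  -- simplicial block, and it is inherited by the recursive calls of Φ.
  record Valid (G K : List V) : Set where
    field
      !G       : Unique G
      !K       : Unique K
      centre   : V
      centre∉G : centre ∉ G
      K⊆G      : ∀ {w} → w ∈ K → w ∈ G
      adjacent : ∀ {w} → w ∈ K → adj centre w ≡ true
      complete : ∀ {w} → w ∈ G → adj centre w ≡ true → w ∈ K
      block    : Block K

  module _ {G K : List V} (valid : Valid G K) where
    open Valid valid

    -- The centre plays the part of `r` in `next-block`: by `complete` it has no neighbour in `G`
    -- outside `K`.
    valid-next-block : ∀ {v L} → v ∈ K → (∀ {w} → w ∈ L → w ∈ G × w ∉ K × adj v w ≡ true) → Block L
    valid-next-block v∈K L⊆ = next-block (adj-flip (adjacent v∈K)) λ w∈L → let (w∈G , w∉K , vw) = L⊆ w∈L in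
      vw , ≡false (λ rw → w∉K (complete w∈G rw)) , λ { refl → centre∉G w∈G }

    valid-next : ∀ {v} → v ∈ K → Valid (G ⊝ K) (nbrs G v ⊝ K)
    valid-next {v} v∈K = record
      { !G       = ⊝-unique K !G
      ; !K       = ⊝-unique K (nbrs-unique v !G)
      ; centre   = v
      ; centre∉G = λ v∈ → proj₂ (∈-⊝⁻ G K v∈) v∈K
      ; K⊆G      = λ w∈ → let (w∈N , w∉K) = ∈-⊝⁻ (nbrs G v) K w∈ in ∈-⊝⁺ K (proj₁ (∈-nbrs⁻ G w∈N)) w∉K
      ; adjacent = λ w∈ → proj₂ (∈-nbrs⁻ G (proj₁ (∈-⊝⁻ (nbrs G v) K w∈)))
      ; complete = λ w∈ vw → let (w∈G , w∉K) = ∈-⊝⁻ G K w∈ in ∈-⊝⁺ K (∈-nbrs⁺ w∈G vw) w∉K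
      ; block    = valid-next-block v∈K λ w∈ → let (w∈N , w∉K) = ∈-⊝⁻ (nbrs G v) K w∈
                                                   (w∈G , vw)  = ∈-nbrs⁻ G w∈N in w∈G , w∉K , vw }

    -- The new centre is `u`. A neighbour of `u` that survives the removal of `K` and of
    -- `nbrs G v ⊝ K` is not adjacent to `v`, so that leaving out `nbrs G v` loses nothing and
    -- `complete` holds.
    valid-next₂ : ∀ {v u} → v ∈ K → u ∈ K → Valid ((G ⊝ K) ⊝ (nbrs G v ⊝ K)) ((nbrs G u ⊝ nbrs G v) ⊝ K)
    valid-next₂ {v} {u} v∈K u∈K = record
      { !G       = ⊝-unique (nbrs G v ⊝ K) (⊝-unique K !G)
      ; !K       = ⊝-unique K (⊝-unique (nbrs G v) (nbrs-unique u !G))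
      ; centre   = u
      ; centre∉G = λ u∈ → proj₂ (∈-⊝⁻ G K (proj₁ (∈-⊝⁻ (G ⊝ K) (nbrs G v ⊝ K) u∈))) u∈K
      ; K⊆G      = λ w∈ → let (w∈G , w∉K , w∉Nv , uw) = K⁻ w∈ in
                   ∈-⊝⁺ (nbrs G v ⊝ K) (∈-⊝⁺ K w∈G w∉K) (λ w∈Kv → w∉Nv (proj₁ (∈-⊝⁻ (nbrs G v) K w∈Kv)))
      ; adjacent = λ w∈ → let (_ , _ , _ , uw) = K⁻ w∈ in uw
      ; complete = λ {w} w∈ uw → let (w∈G⊝K , w∉Kv) = ∈-⊝⁻ (G ⊝ K) (nbrs G v ⊝ K) w∈
                                     (w∈G , w∉K)    = ∈-⊝⁻ G K w∈G⊝K in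
                   ∈-⊝⁺ K (∈-⊝⁺ (nbrs G v) (∈-nbrs⁺ w∈G uw) (λ w∈Nv → w∉Kv (∈-⊝⁺ K w∈Nv w∉K))) w∉K
      ; block    = valid-next-block u∈K λ w∈ → let (w∈G , w∉K , _ , uw) = K⁻ w∈ in w∈G , w∉K , uw }
      where
      K⁻ : ∀ {w} → w ∈ (nbrs G u ⊝ nbrs G v) ⊝ K → w ∈ G × w ∉ K × w ∉ nbrs G v × adj u w ≡ true
      K⁻ w∈ = let (w∈₁ , w∉K)  = ∈-⊝⁻ (nbrs G u ⊝ nbrs G v) K w∈
                  (w∈₂ , w∉Nv) = ∈-⊝⁻ (nbrs G u) (nbrs G v) w∈₁
                  (w∈G , uw)   = ∈-nbrs⁻ G w∈₂ in w∈G , w∉K , w∉Nv , uw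

-- Partitions into blocks, connected components and removable vertices

module Chains {n : ℕ} {adjacency : AdjacencyMatrix n} (local : Local adjacency) (tieBreak : TieBreak) where

  open Blocks local public
  open _≈_

  data Chain : List V → List (List V) → Set where
    []  : Chain [] []
    add : ∀ {G K Ks x} → Valid G K → x ∈ K → Chain (G ⊝ K) Ks → Chain G (K ∷ Ks)

  pick-spec : ∀ xs {x} → x ∈ xs → ∃[ v ] v ∈ xs × value (pick tieBreak xs) ≡ just v
  pick-spec (y ∷ ys) _ = TieBreak.select tieBreak (y ∷ ys) , TieBreak.select-∈ tieBreak (y ∷ ys) , refl

  hasNeighbourᵀ : List V → V → Timed Bool
  hasNeighbourᵀ R v = do NRv ← N R v; isNonemptyᵀ NRv

  hasNeighbour⁺ : ∀ {R v w} → w ∈ R → adj v w ≡ true → value (hasNeighbourᵀ R v) ≡ true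
  hasNeighbour⁺ {R} {v} w∈R vw = isNonemptyᵀ⁺ (∈-nbrs⁺ {v} w∈R vw)

  ∈-nbrs-⊝⁻ : ∀ R K {v w} → w ∈ nbrs (R ⊝ K) v → w ∈ R × w ∉ K × adj v w ≡ true
  ∈-nbrs-⊝⁻ R K w∈ with ∈-nbrs⁻ (R ⊝ K) w∈
  ... | w∈R⊝K , vw with ∈-⊝⁻ R K w∈R⊝K
  ...   | w∈R , w∉K = w∈R , w∉K , vw

  -- Invariant: `S` and `R` split `G`, and each covered vertex has a block as its neighbourhood in
  -- `R`. Connectivity supplies an edge from `S` to `R`, so there is a candidate; whichever one is
  -- selected, its neighbourhood in `R` is valid with the candidate as centre. For newly covered
  -- vertices the invariant follows from `valid-next-block`, for the others it persists because `R`
  -- shrinks.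
  partition-spec : ∀ fuel {G x} S R → Connected G → x ∈ S →
    (∀ {x} → x ∈ S → x ∈ G) → (∀ {x} → x ∈ R → x ∈ G) → (∀ {x} → x ∈ G → x ∉ S → x ∈ R) → (∀ {x} → x ∈ S → x ∉ R) →
    Unique R → (∀ {v} → v ∈ S → Block (nbrs R v)) → length R ℕ.≤ fuel →
    Chain R (value (partitionFrom tieBreak fuel S R))
  partition-spec zero       S []         _    _   _   _   _     _    _  _      _  = []
  partition-spec (suc fuel) S []         _    _   _   _   _     _    _  _      _  = []
  partition-spec (suc fuel) {G} {x} S R@(y ∷ _) conn x∈S S⊆G R⊆G cover disj !R blocks (s≤s le)
    with conn (λ v → elem v S) (S⊆G x∈S) (R⊆G (here refl)) (elem⁺ S x∈S) (∉⇒elem S (λ y∈S → disj y∈S (here refl)))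
  ... | u , w , u∈G , w∈G , Su , Sw , uw
    with pick-spec (value (filterᵀ (hasNeighbourᵀ R) S))
           (∈-filterᵀ⁺ (hasNeighbourᵀ R) (elem⁻ S Su) (hasNeighbour⁺ (cover w∈G (elem⇒∉ S Sw)) uw))
  ... | v , v∈ , picked with ∈-filterᵀ⁻ (hasNeighbourᵀ R) {xs = S} v∈
  ...   | v∈S , nonempty with isNonemptyᵀ⁻ (nbrs R v) nonempty
  ...     | z , z∈K rewrite picked = add valid z∈K
    (subst (λ S′ → Chain R′ (value (partitionFrom tieBreak fuel S′ R′))) (sym (value-appendᵀ S K))
      (partition-spec fuel (S ++ K) R′ conn (∈.∈-++⁺ˡ x∈S) S′⊆G R′⊆G cover′ disj′ (⊝-unique K !R) blocks′ smaller))
    where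
    K  = nbrs R v
    R′ = R ⊝ K
    valid : Valid R K
    valid = record
      { !G = !R ; !K = nbrs-unique v !R ; centre = v ; centre∉G = disj v∈S
      ; K⊆G = λ w∈ → proj₁ (∈-nbrs⁻ R w∈) ; adjacent = λ w∈ → proj₂ (∈-nbrs⁻ R w∈)
      ; complete = ∈-nbrs⁺ ; block = blocks v∈S }
    R′⊆R : ∀ {x} → x ∈ R′ → x ∈ R
    R′⊆R x∈ = proj₁ (∈-⊝⁻ R K x∈)
    R′⊆G : ∀ {x} → x ∈ R′ → x ∈ G
    R′⊆G = R⊆G ∘ R′⊆R
    S′⊆G : ∀ {x} → x ∈ S ++ K → x ∈ G
    S′⊆G x∈ with ∈.∈-++⁻ S x∈
    ... | inj₁ x∈S = S⊆G x∈S
    ... | inj₂ x∈K = R⊆G (Valid.K⊆G valid x∈K)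
    cover′ : ∀ {x} → x ∈ G → x ∉ S ++ K → x ∈ R′
    cover′ x∈G x∉ = ∈-⊝⁺ K (cover x∈G (x∉ ∘ ∈.∈-++⁺ˡ)) (x∉ ∘ ∈.∈-++⁺ʳ S)
    disj′ : ∀ {x} → x ∈ S ++ K → x ∉ R′
    disj′ x∈ x∈R′ with ∈.∈-++⁻ S x∈
    ... | inj₁ x∈S = disj x∈S (R′⊆R x∈R′)
    ... | inj₂ x∈K = proj₂ (∈-⊝⁻ R K x∈R′) x∈K
    blocks′ : ∀ {v} → v ∈ S ++ K → Block (nbrs R′ v)
    blocks′ {v′} v′∈ with ∈.∈-++⁻ S v′∈
    ... | inj₁ v′∈S = Block-⊆ (λ w∈ → let (w∈R′ , vw) = ∈-nbrs⁻ R′ w∈ in ∈-nbrs⁺ (R′⊆R w∈R′) vw) (blocks v′∈S)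
    ... | inj₂ v′∈K = valid-next-block valid v′∈K (∈-nbrs-⊝⁻ R K)
    smaller : length R′ ℕ.≤ fuel
    smaller = ℕ.≤-trans (ℕ.s≤s⁻¹ (⊆⇒length-≤ {xs = z ∷ R′}
      (All.¬Any⇒All¬ R′ (λ z∈ → proj₂ (∈-⊝⁻ R K z∈) z∈K) ∷ ⊝-unique K !R)
      (λ { (here refl) → Valid.K⊆G valid z∈K ; (there x∈) → R′⊆R x∈ }))) le

  blocks-of : List V → List V → List (List V)
  blocks-of G K = K ∷ value (partitionFrom tieBreak n K (G ⊝ K))

  blocks-chain : ∀ {G K x} → Valid G K → x ∈ K → Connected G → Chain G (blocks-of G K)
  blocks-chain {G} {K} valid x∈K conn = add valid x∈K
    (partition-spec n K (G ⊝ K) conn x∈K K⊆G (λ x∈ → proj₁ (∈-⊝⁻ G K x∈)) (∈-⊝⁺ K)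
      (λ x∈K x∈ → proj₂ (∈-⊝⁻ G K x∈) x∈K) (⊝-unique K !G)
      (λ v∈K → valid-next-block valid v∈K (∈-nbrs-⊝⁻ G K))
      (unique-length (⊝-unique K !G)))
    where open Valid valid

  chain-length : ∀ {G Ks} → Chain G Ks → length Ks ℕ.≤ length G
  chain-length []                             = z≤n
  chain-length (add {G} {K} {x = x} valid x∈K chain) = ℕ.≤-trans (s≤s (chain-length chain))
    (⊆⇒length-≤ {xs = x ∷ G ⊝ K} (All.¬Any⇒All¬ _ (λ x∈ → proj₂ (∈-⊝⁻ G K x∈) x∈K) ∷ ⊝-unique K (Valid.!G valid))
      (λ { (here refl) → Valid.K⊆G valid x∈K ; (there y∈) → proj₁ (∈-⊝⁻ G K y∈) }))

  record Component (G C : List V) : Set where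
    field
      unique    : Unique C
      nonempty  : ∃[ x ] x ∈ C
      connected : Connected C
      C⊆G       : ∀ {x} → x ∈ C → x ∈ G
      closed    : ∀ {a b} → a ∈ C → b ∈ G → b ∉ C → adj a b ≡ false

  Unique-++⁻ˡ : ∀ (xs : List V) {ys} → Unique (xs ++ ys) → Unique xs
  Unique-++⁻ˡ []       _        = []
  Unique-++⁻ˡ (x ∷ xs) (x∉ ∷ !) = All.++⁻ˡ xs x∉ ∷ Unique-++⁻ˡ xs !

  Unique-++⁻ʳ : ∀ (xs : List V) {ys} → Unique (xs ++ ys) → Unique ys
  Unique-++⁻ʳ []       !       = !
  Unique-++⁻ʳ (x ∷ xs) (_ ∷ !) = Unique-++⁻ʳ xs !

  components-all : ∀ {G Cs} → Unique G → Components G Cs → All (Component G) Cs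
  components-all !G [] = []
  components-all {G} !G (add {C = C} {R} x∈C conn σ apart comps) = record
    { unique = Unique-++⁻ˡ C !CR ; nonempty = _ , x∈C ; connected = conn
    ; C⊆G = λ x∈ → ↭.∈-resp-↭ (↭.↭-sym σ) (∈.∈-++⁺ˡ x∈) ; closed = closed }
    ∷ All.map weaken (components-all (Unique-++⁻ʳ C !CR) comps)
    where
    !CR = ↭-unique σ !G
    closed : ∀ {a b} → a ∈ C → b ∈ G → b ∉ C → adj a b ≡ false
    closed a∈ b∈G b∉C with ∈.∈-++⁻ C (↭.∈-resp-↭ σ b∈G)
    ... | inj₁ b∈C = contradiction b∈C b∉C
    ... | inj₂ b∈R = apart a∈ b∈R
    weaken : ∀ {D} → Component R D → Component G D
    weaken {D} D-comp = record
      { unique = unique ; nonempty = nonempty ; connected = connected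
      ; C⊆G = λ x∈ → ↭.∈-resp-↭ (↭.↭-sym σ) (∈.∈-++⁺ʳ C (C⊆G x∈)) ; closed = closed′ }
      where
      open Component D-comp renaming (closed to closedᴿ)
      closed′ : ∀ {a b} → a ∈ D → b ∈ G → b ∉ D → adj a b ≡ false
      closed′ a∈ b∈G b∉D with ∈.∈-++⁻ C (↭.∈-resp-↭ σ b∈G)
      ... | inj₁ b∈C = adj-flip (apart b∈C (C⊆G a∈))
      ... | inj₂ b∈R = closedᴿ a∈ b∈R b∉D

  -- Fᵛ in the paper
  remote : List V → V → List V
  remote F v = F ⊝ (v ∷ nbrs F v)

  ∈-remote⁻ : ∀ F v {w} → w ∈ remote F v → w ∈ F × w ≢ v × adj v w ≡ false
  ∈-remote⁻ F v {w} w∈ with ∈-⊝⁻ F (v ∷ nbrs F v) w∈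
  ... | w∈F , w∉ = w∈F , (λ w≡v → w∉ (here w≡v)) , ≡false λ vw → w∉ (there (∈-nbrs⁺ w∈F vw))

  -- An edge of `F` leaving `C` ends neither in another part of `remote F v` nor in `v`, so it ends
  -- in a neighbour of `v`, and there is a candidate. The selected `u` can serve as centre: being
  -- adjacent to `v` it lies outside `C`, and since `v` has no neighbour in `C`, `next-block`
  -- applies with `v` as `r`.
  attachment : ∀ {F v C} → Unique F → Connected F → v ∈ F → Component (remote F v) C →
    ∃[ u ] ∃[ x ] value (pick tieBreak (value (filterᵀ (hasNeighbourᵀ C) (nbrs F v)))) ≡ just u
                  × Valid C (nbrs C u) × x ∈ nbrs C u
  attachment {F} {v} {C} !F conn v∈F comp with Component.nonempty comp
  ... | x , x∈C with conn (λ w → elem w C) (proj₁ (∈-remote⁻ F v (Component.C⊆G comp x∈C))) v∈F (elem⁺ C x∈C) (∉⇒elem C v∉C)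
    where
    v∉C : v ∉ C
    v∉C v∈C = proj₁ (proj₂ (∈-remote⁻ F v (Component.C⊆G comp v∈C))) refl
  ... | a , b , a∈F , b∈F , Ca , Cb , ab
    with pick-spec (value (filterᵀ (hasNeighbourᵀ C) (nbrs F v)))
           (∈-filterᵀ⁺ (hasNeighbourᵀ C) b∈N (hasNeighbour⁺ (elem⁻ C Ca) (adj-flip ab)))
    where
    open Component comp
    va : adj v a ≡ false
    va = proj₂ (proj₂ (∈-remote⁻ F v (C⊆G (elem⁻ C Ca))))
    b∈N : b ∈ nbrs F v
    b∈N with elem b (v ∷ nbrs F v) in eq
    ... | false = contradiction (closed (elem⁻ C Ca) (∈-⊝⁺ (v ∷ nbrs F v) b∈F (elem⇒∉ (v ∷ nbrs F v) eq)) (elem⇒∉ C Cb)) (true≢false ab)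
    ... | true with elem⁻ {v = b} (v ∷ nbrs F v) eq
    ...   | here refl = contradiction va (true≢false (adj-flip ab))
    ...   | there b∈  = b∈
  ... | u , u∈ , picked with ∈-filterᵀ⁻ (hasNeighbourᵀ C) {xs = nbrs F v} u∈
  ...   | u∈N , nonempty with isNonemptyᵀ⁻ (nbrs C u) nonempty
  ...     | z , z∈K = u , z , picked , valid , z∈K
    where
    open Component comp hiding (nonempty)
    vu = proj₂ (∈-nbrs⁻ F u∈N)
    valid : Valid C (nbrs C u)
    valid = record
      { !G = unique ; !K = nbrs-unique u unique ; centre = u
      ; centre∉G = λ u∈C → true≢false vu (proj₂ (proj₂ (∈-remote⁻ F v (C⊆G u∈C))))
      ; K⊆G = λ w∈ → proj₁ (∈-nbrs⁻ C w∈) ; adjacent = λ w∈ → proj₂ (∈-nbrs⁻ C w∈) ; complete = ∈-nbrs⁺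
      ; block = next-block (adj-flip vu) near }
      where
      near : ∀ {w} → w ∈ nbrs C u → adj u w ≡ true × adj v w ≡ false × w ≢ v
      near w∈ with ∈-nbrs⁻ C w∈
      ... | w∈C , uw with ∈-remote⁻ F v (C⊆G w∈C)
      ...   | _ , w≢v , vw = uw , vw , w≢v

  removable : List V → List V
  removable F = value (filterᵀ (λ v → do F-v ← F ∖ (v ∷ []); isConnected F-v) F)

  -- The noncut vertex only shows that the list of candidates is nonempty. The rule may select
  -- another vertex, and that vertex is certified by having passed the connectivity test itself.
  removal : ∀ {F x} → Unique F → Connected F → x ∈ F →
    ∃[ v ] v ∈ F × Connected (F ⊝ (v ∷ [])) × value (pick tieBreak (removable F)) ≡ just v
  removal {F} !F conn x∈F with noncut-vertex !F conn x∈F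
  ... | w , w∈F , conn-w with pick-spec (removable F)
    (∈-filterᵀ⁺ (λ v → do F-v ← F ∖ (v ∷ []); isConnected F-v) w∈F (isConnected⁺ (⊝-unique (w ∷ []) !F) conn-w))
  ...   | v , v∈ , picked with ∈-filterᵀ⁻ (λ v → do F-v ← F ∖ (v ∷ []); isConnected F-v) {xs = F} v∈
  ...     | v∈F , conn-v = v , v∈F , isConnected⁻ (⊝-unique (v ∷ []) !F) conn-v , picked

  -- The `do` block matches on the result of the selection, so that value and time unfold only once
  -- this result is known; a single rewriting yields both.
  countComponent-picked : ∀ t L C {u} → let us = filterᵀ (hasNeighbourᵀ C) L in
    value (pick tieBreak (value us)) ≡ just u →
    value (countComponent tieBreak L t C) ≡ value (countIS tieBreak C (nbrs C u) t) ×
    time (countComponent tieBreak L t C) ≡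
      time us ℕ.+ (time (pick tieBreak (value us)) ℕ.+ (time (N C u) ℕ.+ time (countIS tieBreak C (nbrs C u) t)))
  countComponent-picked t L C picked rewrite picked = refl , refl

  removableᵀ : List V → V → Timed Bool
  removableᵀ F v = do F-v ← F ∖ (v ∷ []); isConnected F-v

  countLoop-picked : ∀ t fuel z x xs {v} → let F = x ∷ xs ; z′ = increment tieBreak F v t in
    value (pick tieBreak (removable F)) ≡ just v →
    value (countLoop tieBreak (suc fuel) z F t) ≡ value (countLoop tieBreak fuel (z + value z′) (F ⊝ (v ∷ [])) t) ×
    time (countLoop tieBreak (suc fuel) z F t) ≡
      time (filterᵀ (removableᵀ F) F) ℕ.+ (time (pick tieBreak (removable F)) ℕ.+ (time z′ ℕ.+
        (suc (bits z ℕ.+ bits (value z′)) ℕ.+ (time (F ∖ (v ∷ [])) ℕ.+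
         time (countLoop tieBreak fuel (z + value z′) (F ⊝ (v ∷ [])) t)))))
  countLoop-picked t fuel z x xs picked rewrite picked = refl , refl

  components-[] : value (components []) ≡ []
  components-[] = go n
    where
    go : ∀ m → value (componentsFrom m []) ≡ []
    go zero    = refl
    go (suc m) = refl

  -- If nothing remains, the algorithm adds 1 directly. This is the empty product over no
  -- components, so that one formula covers both cases.
  increment-components : ∀ t F v → let product = productᵀ (countComponent tieBreak (nbrs F v) t) (value (components (remote F v))) in
    value (increment tieBreak F v t) ≡ value product ×
    time (increment tieBreak F v t) ℕ.≤ time (N F v) ℕ.+ (time (F ∖ (v ∷ nbrs F v)) ℕ.+ (1 ℕ.+ (time (components (remote F v)) ℕ.+ time product)))
  increment-components t F v with remote F v
  ... | []    = sym (cong (λ Cs → value (productᵀ (countComponent tieBreak (nbrs F v) t) Cs)) components-[]) ,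
                ℕ.+-monoʳ-≤ (time (N F v)) (ℕ.+-monoʳ-≤ (time (F ∖ (v ∷ nbrs F v))) (ℕ.m≤m+n 1 _))
  ... | _ ∷ _ = refl , ℕ.+-monoʳ-≤ (time (N F v)) (ℕ.+-monoʳ-≤ (time (F ∖ (v ∷ nbrs F v))) (ℕ.n≤1+n _))

-- Correlation decay

∑ℚ : {A : Set} → (A → ℚᵘ) → List A → ℚᵘ
∑ℚ f []       = 0ℚᵘ
∑ℚ f (x ∷ xs) = f x + ∑ℚ f xs

value-sumᵀ : ∀ {A : Set} (f : A → Timed ℚᵘ) xs → value (sumᵀ f xs) ≡ ∑ℚ (value ∘ f) xs
value-sumᵀ f []       = refl
value-sumᵀ f (x ∷ xs) = cong (λ s → value (f x) + s) (value-sumᵀ f xs)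

c-+ : ∀ m n → c (m ℕ.+ n) ≃ c m + c n
c-+ m n = *≡* (cong (ℤ._* + 1) (sym (cong₂ ℤ._+_ (ℤ.*-identityʳ (+ m)) (ℤ.*-identityʳ (+ n)))))

c-* : ∀ m n → c (m ℕ.* n) ≃ c m * c n
c-* m n = *≡* (cong (ℤ._* + 1) (ℤ.pos-* m n))

c-mono : ∀ {m n} → m ℕ.≤ n → c m ≤ c n
c-mono m≤n = *≤* (ℤ.*-monoʳ-≤-nonNeg (+ 1) (ℤ.+≤+ m≤n))

module _ {A : Set} where

  ∑ℚ-≥0 : ∀ {f : A → ℚᵘ} xs → (∀ {x} → x ∈ xs → 0ℚᵘ ≤ f x) → 0ℚᵘ ≤ ∑ℚ f xs
  ∑ℚ-≥0 []       _   = ℚ.≤-refl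
  ∑ℚ-≥0 (x ∷ xs) 0≤f = +-≥0 (0≤f (here refl)) (∑ℚ-≥0 xs (0≤f ∘ there))

  ∑ℚ-≤ : ∀ {f : A → ℚᵘ} {b} xs → (∀ {x} → x ∈ xs → f x ≤ b) → ∑ℚ f xs ≤ c (length xs) * b
  ∑ℚ-≤ {b = b} []       _   = ℚ.≤-reflexive (≃-sym (ℚ.*-zeroˡ b))
  ∑ℚ-≤ {f} {b} (x ∷ xs) f≤b = begin
    f x + ∑ℚ f xs            ≤⟨ ℚ.+-mono-≤ (f≤b (here refl)) (∑ℚ-≤ xs (f≤b ∘ there)) ⟩
    b + c (length xs) * b    ≃⟨ solve 2 (λ b l → b :+ l :* b := (k 1 :+ l) :* b) ≃-refl b (c (length xs)) ⟩
    (c 1 + c (length xs)) * b ≃⟨ ℚ.*-congʳ {b} (c-+ 1 (length xs)) ⟨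
    c (suc (length xs)) * b  ∎
    where open ℚ.≤-Reasoning

  ∑ℚ-scale : ∀ r {f : A → ℚᵘ} {g : A → ℕ} xs → (∀ {x} → x ∈ xs → r * f x ≃ c (g x)) → r * ∑ℚ f xs ≃ c (∑ g xs)
  ∑ℚ-scale r []       _  = ℚ.*-zeroʳ r
  ∑ℚ-scale r {f} {g} (x ∷ xs) rf≃g = begin-equality
    r * (f x + ∑ℚ f xs)       ≃⟨ ℚ.*-distribˡ-+ r (f x) (∑ℚ f xs) ⟩
    r * f x + r * ∑ℚ f xs     ≃⟨ ℚ.+-cong (rf≃g (here refl)) (∑ℚ-scale r xs (rf≃g ∘ there)) ⟩
    c (g x) + c (∑ g xs)      ≃⟨ c-+ (g x) (∑ g xs) ⟨
    c (g x ℕ.+ ∑ g xs)        ∎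
    where open ℚ.≤-Reasoning

two-half : ∀ s → c 2 * (1ℚᵘ + ½ * s) ≃ c 2 + s
two-half s = begin-equality
  c 2 * (1ℚᵘ + ½ * s)   ≃⟨ solve 2 (λ h s → k 2 :* (k 1 :+ h :* s) := k 2 :+ (k 2 :* h) :* s) ≃-refl ½ s ⟩
  c 2 + (c 2 * ½) * s   ≃⟨ ℚ.+-congʳ (c 2) (ℚ.*-congʳ {s} {c 2 * ½} {1ℚᵘ} (*≡* refl)) ⟩
  c 2 + 1ℚᵘ * s         ≃⟨ ℚ.+-congʳ (c 2) (ℚ.*-identityˡ s) ⟩
  c 2 + s               ∎
  where open ℚ.≤-Reasoning

⊲-weaken : ∀ {η η′ x y} → η ≤ η′ → 0ℚᵘ ≤ x → y ≤ 1ℚᵘ → x ⊲[ η ] y → x ⊲[ η′ ] y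
⊲-weaken {x = x} {y} η≤η′ 0≤x y≤1 x⊲y = ℚ.≤-trans x⊲y
  (*-monoˡ-≤ (x * (c 2 - y)) (*-≥0 0≤x (ℚ.≤-trans (0≤c 1) 1≤2-y)) (ℚ.+-monoʳ-≤ 1ℚᵘ η≤η′))
  where
  1≤2-y : 1ℚᵘ ≤ c 2 - y
  1≤2-y = ≤-gap (1ℚᵘ - y) (gap-≥0 y≤1) (solve 1 (λ y → k 1 :+ (k 1 :- y) := k 2 :- y) ≃-refl y)

-- Both directions are carried along because the reciprocal exchanges them: upper bounds on the
-- smaller values yield a lower bound on the result. The bounds by 1 keep the factors 2 - x and 2 -
-- y positive.
record Near (δ x y : ℚᵘ) : Set where
  field
    0<x : 0ℚᵘ < x
    x≤1 : x ≤ 1ℚᵘ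
    0<y : 0ℚᵘ < y
    y≤1 : y ≤ 1ℚᵘ
    x⊲y : x ⊲[ c 100 * δ ] y
    y⊲x : y ⊲[ c 100 * δ ] x

Near-sym : ∀ {δ x y} → Near δ x y → Near δ y x
Near-sym near = record { 0<x = 0<y ; x≤1 = y≤1 ; 0<y = 0<x ; y≤1 = x≤1 ; x⊲y = y⊲x ; y⊲x = x⊲y }
  where open Near near

Near-weaken : ∀ {δ δ′ x y} → δ ≤ δ′ → Near δ x y → Near δ′ x y
Near-weaken δ≤δ′ near = record
  { 0<x = 0<x ; x≤1 = x≤1 ; 0<y = 0<y ; y≤1 = y≤1
  ; x⊲y = ⊲-weaken η≤η′ (ℚ.<⇒≤ 0<x) y≤1 x⊲y ; y⊲x = ⊲-weaken η≤η′ (ℚ.<⇒≤ 0<y) x≤1 y⊲x }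
  where
  open Near near
  η≤η′ = *-monoʳ-≤ (c 100) (0≤c 100) δ≤δ′

branch : {V : Set} → (V → ℚᵘ) → (V → V → ℚᵘ) → (V → List V) → V → ℚᵘ
branch x₁ x₂ us v = x₁ v * (1ℚᵘ + ½ * ∑ℚ (x₂ v) (us v))

module _ {V : Set} (δ : ℚᵘ) (0≤δ : 0ℚᵘ ≤ δ) where

  module _ (x₁ y₁ : V → ℚᵘ) (x₂ y₂ : V → V → ℚᵘ) (us : V → List V) where

    -- Twice a branch with nonneighbours of values b₁ and b₂ is a (1 + b₁) + a (1 + b₂). Doubling
    -- thus removes the ½ and splits the branch into two instances of `contraction`, one for each
    -- nonneighbour.
    branch-≤ : ∀ {v} → length (us v) ℕ.≤ 2 → Near δ (x₁ v) (y₁ v) →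
      (∀ {u} → u ∈ us v → Near δ (x₂ v u) (y₂ v u)) →
      c 8 * branch y₁ y₂ us v ≤ c 8 * ((1ℚᵘ + c 97 * δ) * branch x₁ x₂ us v) + c 97 * δ
    branch-≤ {v} len near₁ near₂ = *-cancelˡ-≤ (c 2) (0<c 1) (begin
      c 2 * (c 8 * (y * (1ℚᵘ + ½ * t)))      ≃⟨ solve 2 (λ y z → k 2 :* (k 8 :* (y :* z)) := k 8 :* (y :* (k 2 :* z))) ≃-refl y (1ℚᵘ + ½ * t) ⟩
      c 8 * (y * (c 2 * (1ℚᵘ + ½ * t)))      ≃⟨ ℚ.*-congˡ {c 8} (ℚ.*-congˡ {y} (two-half t)) ⟩
      c 8 * (y * (c 2 + t))                  ≤⟨ doubled (us v) len near₂ ⟩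
      c 8 * (κ * (x * (c 2 + s))) + c 2 * (c 97 * δ)
        ≃⟨ ℚ.+-congˡ (c 2 * (c 97 * δ)) (ℚ.*-congˡ {c 8} (ℚ.*-congˡ {κ} (ℚ.*-congˡ {x} (two-half s)))) ⟨
      c 8 * (κ * (x * (c 2 * (1ℚᵘ + ½ * s)))) + c 2 * (c 97 * δ)
        ≃⟨ solve 4 (λ κ x z d → k 8 :* (κ :* (x :* (k 2 :* z))) :+ k 2 :* d := k 2 :* (k 8 :* (κ :* (x :* z)) :+ d))
             ≃-refl κ x (1ℚᵘ + ½ * s) (c 97 * δ) ⟩
      c 2 * (c 8 * (κ * (x * (1ℚᵘ + ½ * s))) + c 97 * δ) ∎)
      where
      open ℚ.≤-Reasoning
      x = x₁ v
      y = y₁ v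
      s = ∑ℚ (x₂ v) (us v)
      t = ∑ℚ (y₂ v) (us v)
      κ = 1ℚᵘ + c 97 * δ
      0≤x = ℚ.<⇒≤ (Near.0<x near₁)
      0≤y = ℚ.<⇒≤ (Near.0<y near₁)
      single : ∀ {b b′} → Near δ b b′ → c 8 * (y * (1ℚᵘ + b′)) ≤ c 8 * (κ * (x * (1ℚᵘ + b))) + c 97 * δ
      single {b} {b′} near = Contraction.contraction δ x b 0≤δ 0≤x (ℚ.<⇒≤ (Near.0<x near)) (Near.x≤1 near)
        0≤y (ℚ.<⇒≤ (Near.0<y near)) (Near.x⊲y near₁) (Near.x⊲y near)
      -- A missing nonneighbour is treated as one of value 0, for which both sides of `⊲` vanish.
      none : c 8 * (y * (1ℚᵘ + 0ℚᵘ)) ≤ c 8 * (κ * (x * (1ℚᵘ + 0ℚᵘ))) + c 97 * δ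
      none = Contraction.contraction δ x 0ℚᵘ 0≤δ 0≤x ℚ.≤-refl (0≤c 1) 0≤y ℚ.≤-refl (Near.x⊲y near₁)
        (ℚ.≤-reflexive (solve 1 (λ η → k 0 :* (k 2 :- k 0) := (k 1 :+ η) :* (k 0 :* (k 2 :- k 0))) ≃-refl (c 100 * δ)))
      sum₂ : ∀ {b₁ b₁′ b₂ b₂′} →
        c 8 * (y * (1ℚᵘ + b₁′)) ≤ c 8 * (κ * (x * (1ℚᵘ + b₁))) + c 97 * δ →
        c 8 * (y * (1ℚᵘ + b₂′)) ≤ c 8 * (κ * (x * (1ℚᵘ + b₂))) + c 97 * δ →
        c 8 * (y * (c 2 + (b₁′ + b₂′))) ≤ c 8 * (κ * (x * (c 2 + (b₁ + b₂)))) + c 2 * (c 97 * δ)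
      sum₂ {b₁} {b₁′} {b₂} {b₂′} le₁ le₂ = begin
        c 8 * (y * (c 2 + (b₁′ + b₂′)))
          ≃⟨ solve 3 (λ y a b → k 8 :* (y :* (k 2 :+ (a :+ b))) := k 8 :* (y :* (k 1 :+ a)) :+ k 8 :* (y :* (k 1 :+ b)))
               ≃-refl y b₁′ b₂′ ⟩
        c 8 * (y * (1ℚᵘ + b₁′)) + c 8 * (y * (1ℚᵘ + b₂′))
          ≤⟨ ℚ.+-mono-≤ le₁ le₂ ⟩
        (c 8 * (κ * (x * (1ℚᵘ + b₁))) + c 97 * δ) + (c 8 * (κ * (x * (1ℚᵘ + b₂))) + c 97 * δ)
          ≃⟨ solve 5 (λ κ x a b d → (k 8 :* (κ :* (x :* (k 1 :+ a))) :+ d) :+ (k 8 :* (κ :* (x :* (k 1 :+ b))) :+ d)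
                 := k 8 :* (κ :* (x :* (k 2 :+ (a :+ b)))) :+ k 2 :* d) ≃-refl κ x b₁ b₂ (c 97 * δ) ⟩
        c 8 * (κ * (x * (c 2 + (b₁ + b₂)))) + c 2 * (c 97 * δ) ∎
      doubled : ∀ us → length us ℕ.≤ 2 → (∀ {u} → u ∈ us → Near δ (x₂ v u) (y₂ v u)) →
        c 8 * (y * (c 2 + ∑ℚ (y₂ v) us)) ≤ c 8 * (κ * (x * (c 2 + ∑ℚ (x₂ v) us))) + c 2 * (c 97 * δ)
      doubled []            _ near = ℚ.≤-respˡ-≃ (ℚ.*-congˡ {c 8} (ℚ.*-congˡ {y} (ℚ.+-congʳ (c 2) (ℚ.+-identityˡ 0ℚᵘ))))
        (sum₂ {0ℚᵘ} {0ℚᵘ} {0ℚᵘ} {0ℚᵘ} none none)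
      doubled (u ∷ [])      _ near = sum₂ {x₂ v u} {y₂ v u} {0ℚᵘ} {0ℚᵘ} (single (near (here refl))) none
      doubled (u ∷ u′ ∷ []) _ near = ℚ.≤-respˡ-≃ (pad (y₂ v u) (y₂ v u′) y) (ℚ.≤-respʳ-≃ padʳ
        (sum₂ {x₂ v u} {y₂ v u} {x₂ v u′} {y₂ v u′} (single (near (here refl))) (single (near (there (here refl))))))
        where
        pad : ∀ a b y → c 8 * (y * (c 2 + (a + b))) ≃ c 8 * (y * (c 2 + (a + (b + 0ℚᵘ))))
        pad = solve 3 (λ a b y → k 8 :* (y :* (k 2 :+ (a :+ b))) := k 8 :* (y :* (k 2 :+ (a :+ (b :+ k 0))))) ≃-refl
        padʳ : c 8 * (κ * (x * (c 2 + (x₂ v u + x₂ v u′)))) + c 2 * (c 97 * δ) ≃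
               c 8 * (κ * (x * (c 2 + (x₂ v u + (x₂ v u′ + 0ℚᵘ))))) + c 2 * (c 97 * δ)
        padʳ = solve 5 (λ a b κ x d → k 8 :* (κ :* (x :* (k 2 :+ (a :+ b)))) :+ d :=
                                      k 8 :* (κ :* (x :* (k 2 :+ (a :+ (b :+ k 0))))) :+ d) ≃-refl (x₂ v u) (x₂ v u′) κ x (c 2 * (c 97 * δ))
      doubled (_ ∷ _ ∷ _ ∷ _) (s≤s (s≤s ())) _

    branches-≤ : ∀ K → (∀ {v} → v ∈ K → length (us v) ℕ.≤ 2) → (∀ {v} → v ∈ K → Near δ (x₁ v) (y₁ v)) →
      (∀ {v u} → v ∈ K → u ∈ us v → Near δ (x₂ v u) (y₂ v u)) →
      c 8 * ∑ℚ (branch y₁ y₂ us) K ≤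
      c 8 * ((1ℚᵘ + c 97 * δ) * ∑ℚ (branch x₁ x₂ us) K) + c (length K) * (c 97 * δ)
    branches-≤ []      len near₁ near₂ = ℚ.≤-reflexive
      (solve 2 (λ κ d → k 8 :* k 0 := k 8 :* (κ :* k 0) :+ k 0 :* d) ≃-refl (1ℚᵘ + c 97 * δ) (c 97 * δ))
    branches-≤ (v ∷ K) len near₁ near₂ = begin
      c 8 * (Y + ∑Y)
        ≃⟨ ℚ.*-distribˡ-+ (c 8) Y ∑Y ⟩
      c 8 * Y + c 8 * ∑Y
        ≤⟨ ℚ.+-mono-≤ (branch-≤ (len (here refl)) (near₁ (here refl)) (near₂ (here refl)))
                      (branches-≤ K (len ∘ there) (near₁ ∘ there) (near₂ ∘ there)) ⟩
      (c 8 * (κ * X) + d) + (c 8 * (κ * ∑X) + c (length K) * d)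
        ≃⟨ solve 5 (λ κ X S d l → (k 8 :* (κ :* X) :+ d) :+ (k 8 :* (κ :* S) :+ l :* d)
                                  := k 8 :* (κ :* (X :+ S)) :+ (k 1 :+ l) :* d) ≃-refl κ X ∑X d (c (length K)) ⟩
      c 8 * (κ * (X + ∑X)) + (c 1 + c (length K)) * d
        ≃⟨ ℚ.+-congʳ (c 8 * (κ * (X + ∑X))) (ℚ.*-congʳ {d} (c-+ 1 (length K))) ⟨
      c 8 * (κ * (X + ∑X)) + c (suc (length K)) * d ∎
      where
      open ℚ.≤-Reasoning
      κ  = 1ℚᵘ + c 97 * δ
      d  = c 97 * δ
      X  = branch x₁ x₂ us v
      Y  = branch y₁ y₂ us v
      ∑X = ∑ℚ (branch x₁ x₂ us) K
      ∑Y = ∑ℚ (branch y₁ y₂ us) K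

-- The potential of 1/(1 + S) is 1 + 2S.
⊲-reciprocal : ∀ {δ S T X Y l} → 0ℚᵘ ≤ δ → 0ℚᵘ ≤ X → 0ℚᵘ ≤ Y → X * (1ℚᵘ + S) ≃ 1ℚᵘ → Y * (1ℚᵘ + T) ≃ 1ℚᵘ → l ℕ.≤ 4 →
  c 8 * T ≤ c 8 * ((1ℚᵘ + c 97 * δ) * S) + c l * (c 97 * δ) → Y ⊲[ c 97 * δ ] X
⊲-reciprocal {δ} {S} {T} {X} {Y} {l} 0≤δ 0≤X 0≤Y X[1+S] Y[1+T] l≤4 le = begin
  X * (c 2 - Y)                        ≃⟨ potential Y T X Y[1+T] ⟩
  X * (Y * (1ℚᵘ + c 2 * T))            ≤⟨ *-monoʳ-≤ X 0≤X (*-monoʳ-≤ Y 0≤Y 1+2T≤) ⟩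
  X * (Y * (κ * (1ℚᵘ + c 2 * S)))      ≃⟨ solve 4 (λ X Y κ s → X :* (Y :* (κ :* s)) := κ :* (Y :* (X :* s))) ≃-refl X Y κ (1ℚᵘ + c 2 * S) ⟩
  κ * (Y * (X * (1ℚᵘ + c 2 * S)))      ≃⟨ ℚ.*-congˡ {κ} (potential X S Y X[1+S]) ⟨
  κ * (Y * (c 2 - X))                  ∎
  where
  open ℚ.≤-Reasoning
  κ = 1ℚᵘ + c 97 * δ
  d = c 97 * δ
  potential : ∀ X S W → X * (1ℚᵘ + S) ≃ 1ℚᵘ → W * (c 2 - X) ≃ W * (X * (1ℚᵘ + c 2 * S))
  potential X S W eq = ℚ.*-congˡ {W} (begin-equality
    c 2 - X                        ≃⟨ ℚ.+-congˡ (- X) (ℚ.≃-trans (ℚ.*-congˡ {c 2} (≃-sym eq)) ≃-refl) ⟩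
    c 2 * (X * (1ℚᵘ + S)) - X      ≃⟨ solve 2 (λ X S → k 2 :* (X :* (k 1 :+ S)) :- X := X :* (k 1 :+ k 2 :* S)) ≃-refl X S ⟩
    X * (1ℚᵘ + c 2 * S)            ∎)
  1+2T≤ : 1ℚᵘ + c 2 * T ≤ κ * (1ℚᵘ + c 2 * S)
  -- After multiplication by 4 the constant term of the potential provides four summands `d`, one
  -- for each of the at most four vertices.
  1+2T≤ = *-cancelˡ-≤ (c 4) (0<c 3) (begin
    c 4 * (1ℚᵘ + c 2 * T)     ≃⟨ solve 1 (λ T → k 4 :* (k 1 :+ k 2 :* T) := k 4 :+ k 8 :* T) ≃-refl T ⟩
    c 4 + c 8 * T             ≤⟨ ℚ.+-monoʳ-≤ (c 4) le ⟩
    c 4 + (c 8 * (κ * S) + c l * d)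
      ≤⟨ ℚ.+-monoʳ-≤ (c 4) (ℚ.+-monoʳ-≤ (c 8 * (κ * S)) (*-monoˡ-≤ d (*-≥0 (0≤c 97) 0≤δ) (c-mono l≤4))) ⟩
    c 4 + (c 8 * (κ * S) + c 4 * d)
      ≃⟨ solve 2 (λ d S → k 4 :+ (k 8 :* ((k 1 :+ d) :* S) :+ k 4 :* d) := k 4 :* ((k 1 :+ d) :* (k 1 :+ k 2 :* S))) ≃-refl d S ⟩
    c 4 * (κ * (1ℚᵘ + c 2 * S)) ∎)

*-cancelˡ-≃ : ∀ {p q} r → 0ℚᵘ < r → r * p ≃ r * q → p ≃ q
*-cancelˡ-≃ r 0<r eq = ℚ.≤-antisym (*-cancelˡ-≤ r 0<r (ℚ.≤-reflexive eq)) (*-cancelˡ-≤ r 0<r (ℚ.≤-reflexive (≃-sym eq)))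

c-/ : ∀ a b .{{_ : ℕ.NonZero b}} → c b * (+ a / b) ≃ c a
c-/ a b@(suc b-1) = *≡* (begin
  (+ b ℤ.* + a) ℤ.* + 1   ≡⟨ ℤ.*-identityʳ (+ b ℤ.* + a) ⟩
  + b ℤ.* + a             ≡⟨ ℤ.*-comm (+ b) (+ a) ⟩
  + a ℤ.* + b             ≡⟨ cong (λ z → + a ℤ.* + z) (sym (ℕ.*-identityˡ b)) ⟩
  + a ℤ.* + (1 ℕ.* b)     ∎)
  where open ≡-Reasoning

0<+/ : ∀ a b .{{_ : ℕ.NonZero b}} → 0 ℕ.< a → 0ℚᵘ < + a / b
0<+/ (suc a) (suc b) _ = ℚ.positive⁻¹ (mkℚᵘ (+ suc a) b)

inverse-* : ∀ {p} → 0ℚᵘ < p → inverse p * p ≃ 1ℚᵘ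
inverse-* {mkℚᵘ (+ 0) d}      0<p = contradiction 0<p (ℚ.<-irrefl (≃-sym (*≡* refl)))
inverse-* {p@(mkℚᵘ +[1+ _ ] _)} _ = ℚ.*-inverseˡ p
inverse-* {mkℚᵘ -[1+ _ ] _} (*<* ())

reciprocal-bounds : ∀ {X S} → 0ℚᵘ ≤ S → X * (1ℚᵘ + S) ≃ 1ℚᵘ → 0ℚᵘ < X × X ≤ 1ℚᵘ
reciprocal-bounds {X} {S} 0≤S eq = 0<X , (begin
  X                 ≃⟨ ℚ.*-identityʳ X ⟨
  X * 1ℚᵘ           ≤⟨ *-monoʳ-≤ X (ℚ.<⇒≤ 0<X) (≤-gap S 0≤S ≃-refl) ⟩
  X * (1ℚᵘ + S)     ≃⟨ eq ⟩
  1ℚᵘ               ∎)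
  where
  open ℚ.≤-Reasoning
  0<X : 0ℚᵘ < X
  0<X = ℚ.≰⇒> λ X≤0 → ℚ.<⇒≱ (0<c 0) (ℚ.≤-respˡ-≃ eq
    (ℚ.≤-respʳ-≃ (ℚ.*-zeroˡ (1ℚᵘ + S)) (*-monoˡ-≤ (1ℚᵘ + S) (+-≥0 (0≤c 1) 0≤S) X≤0)))

-- The errors of the potentials are bounded by 100 error t.  They start with
-- 16, since the potential of 1 is 1 and that of Π ≥ 1/9 is at most 17.
error : ℕ → ℚᵘ
error 0             = + 16 / 100
error 1             = + 16 / 100
error (suc (suc t)) = (+ 97 / 100) * error t

error-≥0 : ∀ t → 0ℚᵘ ≤ error t
error-≥0 0             = ℚ.nonNegative⁻¹ (+ 16 / 100)
error-≥0 1             = ℚ.nonNegative⁻¹ (+ 16 / 100)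
error-≥0 (suc (suc t)) = *-≥0 (ℚ.nonNegative⁻¹ (+ 97 / 100)) (error-≥0 t)

error-antitone : ∀ t → error (suc t) ≤ error t
error-antitone 0             = ℚ.≤-refl
error-antitone 1             = ℚ.≤ᵇ⇒≤ tt
error-antitone (suc (suc t)) = *-monoʳ-≤ (+ 97 / 100) (ℚ.nonNegative⁻¹ (+ 97 / 100)) (error-antitone t)

error-step : ∀ t → c 97 * error t ≤ c 100 * error (suc (suc t))
error-step t = begin
  c 97 * error t                      ≃⟨ ℚ.*-congʳ {error t} {c 97} {c 100 * (+ 97 / 100)} (*≡* refl) ⟩
  c 100 * (+ 97 / 100) * error t      ≃⟨ ℚ.*-assoc (c 100) (+ 97 / 100) (error t) ⟩
  c 100 * ((+ 97 / 100) * error t)    ∎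
  where open ℚ.≤-Reasoning

Near-initial : ∀ {x} → 0ℚᵘ < x → x ≤ 1ℚᵘ → 1ℚᵘ ≤ c 9 * x → Near (error 0) 1ℚᵘ x
Near-initial {x} 0<x x≤1 1≤9x = record
  { 0<x = 0<c 0 ; x≤1 = ℚ.≤-refl ; 0<y = 0<x ; y≤1 = x≤1
  ; x⊲y = ⊲-weaken {0ℚᵘ} {c 100 * error 0} {1ℚᵘ} {x} (ℚ.≤ᵇ⇒≤ tt) (0≤c 1) x≤1
      (≤-gap (c 2 * (1ℚᵘ - x)) (*-≥0 (0≤c 2) (gap-≥0 x≤1))
        (solve 1 (λ x → x :* (k 2 :- k 1) :+ k 2 :* (k 1 :- x) := (k 1 :+ k 0) :* (k 1 :* (k 2 :- x))) ≃-refl x))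
  ; y⊲x = ⊲-weaken {c 16} {c 100 * error 0} {x} {1ℚᵘ} (ℚ.≤ᵇ⇒≤ tt) (ℚ.<⇒≤ 0<x) ℚ.≤-refl
      (≤-gap (c 2 * (c 9 * x - 1ℚᵘ)) (*-≥0 (0≤c 2) (gap-≥0 1≤9x))
        (solve 1 (λ x → k 1 :* (k 2 :- x) :+ k 2 :* (k 9 :* x :- k 1) := (k 1 :+ k 16) :* (x :* (k 2 :- k 1))) ≃-refl x)) }

∑ℚ-cong : ∀ {A : Set} {f g : A → ℚᵘ} xs → (∀ x → f x ≡ g x) → ∑ℚ f xs ≡ ∑ℚ g xs
∑ℚ-cong []       f≡g = refl
∑ℚ-cong (x ∷ xs) f≡g = cong₂ _+_ (f≡g x) (∑ℚ-cong xs f≡g)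

module Decay {n : ℕ} {adjacency : AdjacencyMatrix n} (local : Local adjacency) (tieBreak : TieBreak) where

  open Chains local tieBreak public
  open IndependentSets adj public using (Z; Z>0; independent)
  private module I = IndependentSets adj

  Z-⊝-≤ : ∀ G K → Z (G ⊝ K) ℕ.≤ Z G
  Z-⊝-≤ G K rewrite value-filterᵀ (λ x → do b ← x ∈ᵀ K; return (not b)) G =
    subst (ℕ._≤ Z G) (sym (I.Z-filterᵇ q G)) (I.independent-mono G λ _ _ → refl)
    where q = λ x → not (elem x K)

  -- The probability that a uniformly random independent set avoids K.
  Π : List V → List V → ℚᵘ
  Π G K = (+ Z (G ⊝ K) / Z G) {{ℕ.>-nonZero (Z>0 G _)}}

  0<cZ : ∀ G → 0ℚᵘ < c (Z G)
  0<cZ G with Z G | Z>0 G (λ _ → true)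
  ... | suc z | _ = 0<c z

  Π-Z : ∀ G K → c (Z G) * Π G K ≃ c (Z (G ⊝ K))
  Π-Z G K = c-/ (Z (G ⊝ K)) (Z G) {{ℕ.>-nonZero (Z>0 G _)}}

  0<Π : ∀ G K → 0ℚᵘ < Π G K
  0<Π G K = 0<+/ (Z (G ⊝ K)) (Z G) {{ℕ.>-nonZero (Z>0 G _)}} (Z>0 (G ⊝ K) _)

  Π≤1 : ∀ G K → Π G K ≤ 1ℚᵘ
  Π≤1 G K = *-cancelˡ-≤ (c (Z G)) (0<cZ G) (ℚ.≤-respˡ-≃ (≃-sym (Π-Z G K))
    (ℚ.≤-respʳ-≃ (≃-sym (ℚ.*-identityʳ (c (Z G)))) (c-mono (Z-⊝-≤ G K))))

  apart : V → V → Bool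
  apart v u = value (notAdjacentᵀ v u)

  apartFrom : List V → V → List V
  apartFrom K v = value (filterᵀ (notAdjacentᵀ v) K)

  module _ (G K : List V) where

    rest₂ next₁ : V → List V
    next₁ v = nbrs G v ⊝ K
    rest₂ v = (G ⊝ K) ⊝ next₁ v

    next₂ : V → V → List V
    next₂ v u = (nbrs G u ⊝ nbrs G v) ⊝ K

    -- For a valid `K` this is the number of independent sets meeting `K` divided by the number of
    -- those avoiding it.
    odds : ℚᵘ
    odds = ∑ℚ (branch (λ v → Π (G ⊝ K) (next₁ v)) (λ v u → Π (rest₂ v) (next₂ v u)) (apartFrom K)) K

  module _ {G K : List V} (valid : Valid G K) where
    open Valid valid

    private
      R  = G ⊝ K
      !R = ⊝-unique K !G
      c₁ = λ v → independent R (λ w → not (adj v w))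
      c₂ = λ v u → independent R (λ w → not (adj v w) ∧ not (adj u w))

    ∉-next₁ : ∀ {v w} → w ∈ R → w ∉ next₁ G K v → not (adj v w) ≡ true
    ∉-next₁ w∈R w∉ = cong not (≡false λ vw → let (w∈G , w∉K) = ∈-⊝⁻ G K w∈R in w∉ (∈-⊝⁺ K (∈-nbrs⁺ w∈G vw) w∉K))

    next₁-adj : ∀ {v w} → not (adj v w) ≡ true → w ∉ next₁ G K v
    next₁-adj {v} vw w∈ = true≢false (proj₂ (∈-nbrs⁻ G (proj₁ (∈-⊝⁻ (nbrs G v) K w∈)))) (not-true vw)

    Z-rest₂ : ∀ v → Z (rest₂ G K v) ≡ c₁ v
    Z-rest₂ v = trans (I.Z-same adj-sym (⊝-unique (next₁ G K v) !R) (Unique.filter⁺ (Bool.T? ∘ q) !R)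
        (λ w∈ → let (w∈R , w∉) = ∈-⊝⁻ R (next₁ G K v) w∈ in ∈-filterᵇ⁺ q w∈R (∉-next₁ w∈R w∉))
        (λ w∈ → let (w∈R , vw) = ∈-filterᵇ⁻ q {xs = R} w∈ in ∈-⊝⁺ (next₁ G K v) w∈R (next₁-adj vw)))
      (I.Z-filterᵇ q R)
      where q = λ w → not (adj v w)

    Z-rest₃ : ∀ v u → Z (rest₂ G K v ⊝ next₂ G K v u) ≡ c₂ v u
    Z-rest₃ v u = trans (I.Z-same adj-sym (⊝-unique (next₂ G K v u) (⊝-unique (next₁ G K v) !R)) (Unique.filter⁺ (Bool.T? ∘ q) !R) to from)
      (I.Z-filterᵇ q R)
      where
      q = λ w → not (adj v w) ∧ not (adj u w)
      to : ∀ {w} → w ∈ rest₂ G K v ⊝ next₂ G K v u → w ∈ filterᵇ q R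
      to w∈ with ∈-⊝⁻ (rest₂ G K v) (next₂ G K v u) w∈
      ... | w∈₂ , w∉₂ with ∈-⊝⁻ R (next₁ G K v) w∈₂
      ...   | w∈R , w∉₁ with ∈-⊝⁻ G K w∈R
      ...     | w∈G , w∉K = ∈-filterᵇ⁺ q w∈R (cong₂ _∧_ vw (cong not (≡false λ uw → w∉₂
                (∈-⊝⁺ K (∈-⊝⁺ (nbrs G v) (∈-nbrs⁺ w∈G uw) λ w∈Nv → true≢false (proj₂ (∈-nbrs⁻ G w∈Nv)) (not-true vw)) w∉K))))
        where vw = ∉-next₁ w∈R w∉₁
      from : ∀ {w} → w ∈ filterᵇ q R → w ∈ rest₂ G K v ⊝ next₂ G K v u
      from {w} w∈ with ∈-filterᵇ⁻ q {xs = R} w∈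
      ... | w∈R , eq with ∧-true {not (adj v w)} eq
      ...   | vw , uw = ∈-⊝⁺ (next₂ G K v u) (∈-⊝⁺ (next₁ G K v) w∈R (next₁-adj vw)) λ w∈₂ →
        let (w∈₃ , _) = ∈-⊝⁻ (nbrs G u ⊝ nbrs G v) K w∈₂
            (w∈Nu , _) = ∈-⊝⁻ (nbrs G u) (nbrs G v) w∈₃
        in true≢false (proj₂ (∈-nbrs⁻ G w∈Nu)) (not-true uw)

    private
      weight : V → ℕ
      weight v = 2 ℕ.* c₁ v ℕ.+ ∑ (c₂ v) (apartFrom K v)

    apart-irrefl : ∀ v → apart v v ≡ false
    apart-irrefl v rewrite ≟ᵀ-refl v = refl

    apart-adj : ∀ {u v} → u ≢ v → apart v u ≡ not (adj v u)
    apart-adj {u} {v} u≢v rewrite ≟ᵀ-≢ u≢v = refl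

    -- The independent sets of `G` are sorted by their trace on `K`. Counts are doubled so that a
    -- nonadjacent pair can be charged once to each of its two vertices, as in the recursion.
    doubled-Z : 2 ℕ.* Z G ≡ 2 ℕ.* Z R ℕ.+ ∑ weight K
    doubled-Z = begin
      2 ℕ.* Z G
        ≡⟨ cong (2 ℕ.*_) (trans (sym (I.independent-↭ adj-sym _ (++-⊝-↭ !G !K K⊆G))) (I.independent-block K R !K (block-α≤2 block))) ⟩
      2 ℕ.* (Z R ℕ.+ ∑ c₁ K ℕ.+ I.pairs R K)
        ≡⟨ ℕ.*-distribˡ-+ 2 (Z R ℕ.+ ∑ c₁ K) (I.pairs R K) ⟩
      2 ℕ.* (Z R ℕ.+ ∑ c₁ K) ℕ.+ 2 ℕ.* I.pairs R K
        ≡⟨ cong₂ ℕ._+_ (ℕ.*-distribˡ-+ 2 (Z R) (∑ c₁ K)) (sym (I.ordered-pairs adj-sym apart apart-irrefl apart-adj K R !K)) ⟩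
      2 ℕ.* Z R ℕ.+ 2 ℕ.* ∑ c₁ K ℕ.+ ∑ (λ v → ∑ (c₂ v) (filterᵇ (apart v) K)) K
        ≡⟨ ℕ.+-assoc (2 ℕ.* Z R) (2 ℕ.* ∑ c₁ K) _ ⟩
      2 ℕ.* Z R ℕ.+ (2 ℕ.* ∑ c₁ K ℕ.+ ∑ (λ v → ∑ (c₂ v) (filterᵇ (apart v) K)) K)
        ≡⟨ cong (2 ℕ.* Z R ℕ.+_) (cong₂ ℕ._+_ (double-∑ K)
             (∑-cong K λ {v} _ → cong (∑ (c₂ v)) (sym (value-filterᵀ (notAdjacentᵀ v) K)))) ⟩
      2 ℕ.* Z R ℕ.+ (∑ (λ v → 2 ℕ.* c₁ v) K ℕ.+ ∑ (λ v → ∑ (c₂ v) (apartFrom K v)) K)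
        ≡⟨ cong (2 ℕ.* Z R ℕ.+_) (∑-+ (λ v → 2 ℕ.* c₁ v) (λ v → ∑ (c₂ v) (apartFrom K v)) K) ⟨
      2 ℕ.* Z R ℕ.+ ∑ weight K ∎
      where
      open ≡-Reasoning
      double-∑ : ∀ K → 2 ℕ.* ∑ c₁ K ≡ ∑ (λ v → 2 ℕ.* c₁ v) K
      double-∑ []      = refl
      double-∑ (v ∷ K) = trans (ℕ.*-distribˡ-+ 2 (c₁ v) (∑ c₁ K)) (cong (2 ℕ.* c₁ v ℕ.+_) (double-∑ K))

    -- Each `Π` is a quotient of two counts: multiplied by the count for its graph it gives the
    -- count for the graph without the block. The product along a branch therefore telescopes from
    -- `R` to `rest₂` and on to the graph without the neighbours of both vertices.
    branch-weight : ∀ v → c 2 * c (Z R) *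
      branch (λ v → Π (G ⊝ K) (next₁ G K v)) (λ v u → Π (rest₂ G K v) (next₂ G K v u)) (apartFrom K) v ≃ c (weight v)
    branch-weight v = begin-equality
      c 2 * r * (a * (1ℚᵘ + ½ * t))
        ≃⟨ solve 3 (λ r a z → k 2 :* r :* (a :* z) := (r :* a) :* (k 2 :* z)) ≃-refl r a (1ℚᵘ + ½ * t) ⟩
      (r * a) * (c 2 * (1ℚᵘ + ½ * t))
        ≃⟨ ℚ.*-cong (Π-Z R (next₁ G K v)) (two-half t) ⟩
      z₂ * (c 2 + t)
        ≃⟨ solve 2 (λ z t → z :* (k 2 :+ t) := k 2 :* z :+ z :* t) ≃-refl z₂ t ⟩
      c 2 * z₂ + z₂ * t
        ≃⟨ ℚ.+-cong (ℚ.≃-trans (≃-sym (c-* 2 (Z (rest₂ G K v)))) (ℚ.≃-reflexive (cong (λ z → c (2 ℕ.* z)) (Z-rest₂ v))))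
             (∑ℚ-scale z₂ (apartFrom K v) λ {u} _ → ℚ.≃-trans (Π-Z (rest₂ G K v) (next₂ G K v u)) (ℚ.≃-reflexive (cong c (Z-rest₃ v u)))) ⟩
      c (2 ℕ.* c₁ v) + c (∑ (c₂ v) (apartFrom K v))
        ≃⟨ c-+ (2 ℕ.* c₁ v) (∑ (c₂ v) (apartFrom K v)) ⟨
      c (weight v) ∎
      where
      open ℚ.≤-Reasoning
      r  = c (Z R)
      a  = Π (G ⊝ K) (next₁ G K v)
      t  = ∑ℚ (λ u → Π (rest₂ G K v) (next₂ G K v u)) (apartFrom K v)
      z₂ = c (Z (rest₂ G K v))

    Π-recurrence : Π G K * (1ℚᵘ + odds G K) ≃ 1ℚᵘ
    Π-recurrence = *-cancelˡ-≃ (c 2 * r) (*->0 (0<c 1) (0<cZ R)) (begin-equality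
      c 2 * r * (p * (1ℚᵘ + s))
        ≃⟨ solve 3 (λ r p s → k 2 :* r :* (p :* (k 1 :+ s)) := p :* (k 2 :* r :+ k 2 :* r :* s)) ≃-refl r p s ⟩
      p * (c 2 * r + c 2 * r * s)
        ≃⟨ ℚ.*-congˡ {p} (ℚ.+-cong (≃-sym (c-* 2 (Z R))) (∑ℚ-scale (c 2 * r) K (λ {v} _ → branch-weight v))) ⟩
      p * (c (2 ℕ.* Z R) + c (∑ weight K))
        ≃⟨ ℚ.*-congˡ {p} (c-+ (2 ℕ.* Z R) (∑ weight K)) ⟨
      p * c (2 ℕ.* Z R ℕ.+ ∑ weight K)
        ≃⟨ ℚ.*-congˡ {p} (ℚ.≃-reflexive (cong c doubled-Z)) ⟨
      p * c (2 ℕ.* Z G)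
        ≃⟨ ℚ.*-congˡ {p} (c-* 2 (Z G)) ⟩
      p * (c 2 * c (Z G))
        ≃⟨ solve 2 (λ p z → p :* (k 2 :* z) := k 2 :* (z :* p)) ≃-refl p (c (Z G)) ⟩
      c 2 * (c (Z G) * p)
        ≃⟨ ℚ.*-congˡ {c 2} (Π-Z G K) ⟩
      c 2 * r
        ≃⟨ ℚ.*-identityʳ (c 2 * r) ⟨
      c 2 * r * 1ℚᵘ ∎)
      where
      open ℚ.≤-Reasoning
      r = c (Z R)
      p = Π G K
      s = odds G K

    -- At most four vertices contribute, with a branch of at most 1 + 1 each. The resulting bound Π
    -- ≥ 1/9 limits the error made where the recursion is cut off.
    odds-≤8 : odds G K ≤ c 8
    odds-≤8 = begin
      odds G K             ≤⟨ ∑ℚ-≤ K branch-≤2 ⟩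
      c (length K) * c 2   ≤⟨ *-monoˡ-≤ (c 2) (0≤c 2) (c-mono (block-length block !K)) ⟩
      c 4 * c 2            ≃⟨ *≡* refl ⟩
      c 8                  ∎
      where
      open ℚ.≤-Reasoning
      branch-≤2 : ∀ {v} → v ∈ K → branch (λ v → Π (G ⊝ K) (next₁ G K v)) (λ v u → Π (rest₂ G K v) (next₂ G K v u)) (apartFrom K) v ≤ c 2
      branch-≤2 {v} v∈K = begin
        a * (1ℚᵘ + ½ * t)  ≤⟨ *-mono-≤ (ℚ.<⇒≤ (0<Π (G ⊝ K) (next₁ G K v))) (+-≥0 (0≤c 1) (*-≥0 0≤½ 0≤t)) (Π≤1 (G ⊝ K) (next₁ G K v))
                                (ℚ.+-monoʳ-≤ 1ℚᵘ (*-monoʳ-≤ ½ 0≤½ t≤2)) ⟩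
        1ℚᵘ * (1ℚᵘ + ½ * c 2) ≃⟨ *≡* refl ⟩
        c 2                ∎
        where
        a = Π (G ⊝ K) (next₁ G K v)
        t = ∑ℚ (λ u → Π (rest₂ G K v) (next₂ G K v u)) (apartFrom K v)
        0≤½ = ℚ.nonNegative⁻¹ ½
        0≤t = ∑ℚ-≥0 (apartFrom K v) λ {u} _ → ℚ.<⇒≤ (0<Π (rest₂ G K v) (next₂ G K v u))
        t≤2 : t ≤ c 2
        t≤2 = ℚ.≤-trans (∑ℚ-≤ (apartFrom K v) λ {u} _ → Π≤1 (rest₂ G K v) (next₂ G K v u))
          (ℚ.≤-respʳ-≃ (ℚ.*-identityʳ (c 2)) (*-monoˡ-≤ 1ℚᵘ (0≤c 1) (c-mono (block-apart block !K v∈K))))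

    1≤9Π : 1ℚᵘ ≤ c 9 * Π G K
    1≤9Π = begin
      1ℚᵘ                      ≃⟨ Π-recurrence ⟨
      Π G K * (1ℚᵘ + odds G K) ≤⟨ *-monoʳ-≤ (Π G K) (ℚ.<⇒≤ (0<Π G K)) (ℚ.+-monoʳ-≤ 1ℚᵘ odds-≤8) ⟩
      Π G K * (1ℚᵘ + c 8)      ≃⟨ solve 1 (λ p → p :* (k 1 :+ k 8) := k 9 :* p) ≃-refl (Π G K) ⟩
      c 9 * Π G K              ∎
      where open ℚ.≤-Reasoning

  approximateOdds : ℕ → List V → List V → ℚᵘ
  approximateOdds t G K = ∑ℚ (branch (λ v → value (Φ (G ⊝ K) (next₁ G K v) (suc t)))
                                     (λ v u → value (Φ (rest₂ G K v) (next₂ G K v u) t)) (apartFrom K)) K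

  Φ-recurrence : ∀ t G K → 0ℚᵘ ≤ approximateOdds t G K →
                 value (Φ G K (suc (suc t))) * (1ℚᵘ + approximateOdds t G K) ≃ 1ℚᵘ
  Φ-recurrence t G []        _   = *≡* refl
  Φ-recurrence t G K@(_ ∷ _) 0≤s = subst (λ s → inverse (1ℚᵘ + s) * (1ℚᵘ + approximateOdds t G K) ≃ 1ℚᵘ)
    (sym (trans (value-sumᵀ (term (G ⊝ K)) K) (∑ℚ-cong K term-branch)))
    (inverse-* (+->0 (0<c 0) 0≤s))
    where
    open Step (λ G′ K′ → Φ G′ K′ (suc t)) (λ G′ K′ → Φ G′ K′ t) G K
    term-branch : ∀ v → value (term (G ⊝ K) v) ≡ _
    term-branch v = cong (λ s → value (Φ (G ⊝ K) (next₁ G K v) (suc t)) * (1ℚᵘ + ½ * s))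
      (value-sumᵀ (innerTerm (rest₂ G K v) (nbrs G v)) (apartFrom K v))

  Φ-Near : ℕ → Set
  Φ-Near t = ∀ {G K} → Valid G K → Near (error t) (value (Φ G K t)) (Π G K)

  -- The recursive calls have depths `suc t` and `t`, and both errors are estimated by the larger
  -- one, `error t`; hence one factor 97/100 for two levels. The two directions follow from the same
  -- estimate with the exact and the approximate values exchanged.
  Φ-step : ∀ t → Φ-Near (suc t) → Φ-Near t → Φ-Near (suc (suc t))
  Φ-step t ih₁ ih₂ {G} {K} valid = record
    { 0<x = proj₁ φ-bounds ; x≤1 = proj₂ φ-bounds ; 0<y = 0<Π G K ; y≤1 = Π≤1 G K
    ; x⊲y = ⊲-weaken (error-step t) (ℚ.<⇒≤ (proj₁ φ-bounds)) (Π≤1 G K)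
        (⊲-reciprocal {S = odds G K} {T = approximateOdds t G K} δ≥0 (ℚ.<⇒≤ (0<Π G K)) (ℚ.<⇒≤ (proj₁ φ-bounds)) (Π-recurrence valid) φ-rec len
          (branches-≤ (error t) δ≥0 _ _ _ _ (apartFrom K) K two (λ v∈ → Near-sym (near₁ v∈)) (λ v∈ u∈ → Near-sym (near₂ v∈ u∈))))
    ; y⊲x = ⊲-weaken (error-step t) (ℚ.<⇒≤ (0<Π G K)) (proj₂ φ-bounds)
        (⊲-reciprocal {S = approximateOdds t G K} {T = odds G K} δ≥0 (ℚ.<⇒≤ (proj₁ φ-bounds)) (ℚ.<⇒≤ (0<Π G K)) φ-rec (Π-recurrence valid) len
          (branches-≤ (error t) δ≥0 _ _ _ _ (apartFrom K) K two near₁ near₂)) }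
    where
    open Valid valid
    δ≥0 = error-≥0 t
    len = block-length block !K
    two : ∀ {v} → v ∈ K → length (apartFrom K v) ℕ.≤ 2
    two = block-apart block !K
    near₁ : ∀ {v} → v ∈ K → Near (error t) (value (Φ (G ⊝ K) (next₁ G K v) (suc t))) (Π (G ⊝ K) (next₁ G K v))
    near₁ v∈ = Near-weaken (error-antitone t) (ih₁ (valid-next valid v∈))
    near₂ : ∀ {v u} → v ∈ K → u ∈ apartFrom K v →
            Near (error t) (value (Φ (rest₂ G K v) (next₂ G K v u) t)) (Π (rest₂ G K v) (next₂ G K v u))
    near₂ {v} v∈ u∈ = ih₂ (valid-next₂ valid v∈ (proj₁ (∈-filterᵀ⁻ (notAdjacentᵀ v) {xs = K} u∈)))
    s≥0 : 0ℚᵘ ≤ approximateOdds t G K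
    s≥0 = ∑ℚ-≥0 K λ {v} v∈ → *-≥0 (ℚ.<⇒≤ (Near.0<x (near₁ v∈)))
      (+-≥0 (0≤c 1) (*-≥0 (ℚ.nonNegative⁻¹ ½) (∑ℚ-≥0 (apartFrom K v) λ u∈ → ℚ.<⇒≤ (Near.0<x (near₂ v∈ u∈)))))
    φ-rec = Φ-recurrence t G K s≥0
    φ-bounds = reciprocal-bounds s≥0 φ-rec

  Φ-near : ∀ t → Φ-Near t
  Φ-near 0             {G} {K} valid = Near-initial (0<Π G K) (Π≤1 G K) (1≤9Π valid)
  Φ-near 1             {G} {K} valid = Near-initial (0<Π G K) (Π≤1 G K) (1≤9Π valid)
  Φ-near (suc (suc t)) = Φ-step t (Φ-near (suc t)) (Φ-near t)

-- Multiplicative errors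

^-≥0 : ∀ {p} k → 0ℚᵘ ≤ p → 0ℚᵘ ≤ p ^ k
^-≥0 zero    0≤p = 0≤c 1
^-≥0 (suc k) 0≤p = *-≥0 0≤p (^-≥0 k 0≤p)

^->0 : ∀ {p} k → 0ℚᵘ < p → 0ℚᵘ < p ^ k
^->0 zero    0<p = 0<c 0
^->0 (suc k) 0<p = *->0 0<p (^->0 k 0<p)

^-+ : ∀ p j k → p ^ (j ℕ.+ k) ≃ p ^ j * p ^ k
^-+ p zero    k = ≃-sym (ℚ.*-identityˡ (p ^ k))
^-+ p (suc j) k = ℚ.≃-trans (ℚ.*-congˡ {p} (^-+ p j k)) (≃-sym (ℚ.*-assoc p (p ^ j) (p ^ k)))

^-monoʳ : ∀ {p j k} → 1ℚᵘ ≤ p → j ℕ.≤ k → p ^ j ≤ p ^ k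
^-monoʳ {k = zero}      1≤p z≤n       = ℚ.≤-refl
^-monoʳ {p} {k = suc k} 1≤p z≤n       = ℚ.≤-trans (^-monoʳ {p} {0} {k} 1≤p z≤n)
  (ℚ.≤-respˡ-≃ (ℚ.*-identityˡ (p ^ k)) (*-monoˡ-≤ (p ^ k) (^-≥0 k (ℚ.≤-trans (0≤c 1) 1≤p)) 1≤p))
^-monoʳ {p}             1≤p (s≤s j≤k) = *-monoʳ-≤ p (ℚ.≤-trans (0≤c 1) 1≤p) (^-monoʳ 1≤p j≤k)

module Relative (ρ : ℚᵘ) (1≤ρ : 1ℚᵘ ≤ ρ) where

  -- A symmetric form of relative error, so that it passes to reciprocals. The exponent counts
  -- factors: it adds up in products and does not grow in sums.
  record Within (k : ℕ) (x y : ℚᵘ) : Set where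
    field
      0≤x : 0ℚᵘ ≤ x
      0≤y : 0ℚᵘ ≤ y
      x≤y : x ≤ ρ ^ k * y
      y≤x : y ≤ ρ ^ k * x

  Within-* : ∀ {j k x y z w} → Within j x y → Within k z w → Within (j ℕ.+ k) (x * z) (y * w)
  Within-* {j} {k} {x} {y} {z} {w} p q = record
    { 0≤x = *-≥0 P.0≤x Q.0≤x ; 0≤y = *-≥0 P.0≤y Q.0≤y
    ; x≤y = ℚ.≤-respʳ-≃ (regroup y w) (*-mono-≤ P.0≤x Q.0≤x P.x≤y Q.x≤y)
    ; y≤x = ℚ.≤-respʳ-≃ (regroup x z) (*-mono-≤ P.0≤y Q.0≤y P.y≤x Q.y≤x) }
    where
    module P = Within p
    module Q = Within q
    regroup : ∀ y w → (ρ ^ j * y) * (ρ ^ k * w) ≃ ρ ^ (j ℕ.+ k) * (y * w)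
    regroup y w = ℚ.≃-trans (solve 4 (λ a b y w → (a :* y) :* (b :* w) := (a :* b) :* (y :* w)) ≃-refl (ρ ^ j) (ρ ^ k) y w)
      (ℚ.*-congʳ {y * w} (≃-sym (^-+ ρ j k)))

  Within-+ : ∀ {k x y z w} → Within k x y → Within k z w → Within k (x + z) (y + w)
  Within-+ {k} {x} {y} {z} {w} p q = record
    { 0≤x = +-≥0 P.0≤x Q.0≤x ; 0≤y = +-≥0 P.0≤y Q.0≤y
    ; x≤y = ℚ.≤-respʳ-≃ (≃-sym (ℚ.*-distribˡ-+ (ρ ^ k) y w)) (ℚ.+-mono-≤ P.x≤y Q.x≤y)
    ; y≤x = ℚ.≤-respʳ-≃ (≃-sym (ℚ.*-distribˡ-+ (ρ ^ k) x z)) (ℚ.+-mono-≤ P.y≤x Q.y≤x) }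
    where
    module P = Within p
    module Q = Within q

  Within-mono : ∀ {j k x y} → j ℕ.≤ k → Within j x y → Within k x y
  Within-mono {x = x} {y} j≤k p = record
    { 0≤x = 0≤x ; 0≤y = 0≤y
    ; x≤y = ℚ.≤-trans x≤y (*-monoˡ-≤ y 0≤y (^-monoʳ 1≤ρ j≤k))
    ; y≤x = ℚ.≤-trans y≤x (*-monoˡ-≤ x 0≤x (^-monoʳ 1≤ρ j≤k)) }
    where open Within p

  Within-≃ : ∀ {k x y z} → y ≃ z → Within k x y → Within k x z
  Within-≃ {k} y≃z p = record
    { 0≤x = 0≤x ; 0≤y = ℚ.≤-respʳ-≃ y≃z 0≤y
    ; x≤y = ℚ.≤-respʳ-≃ (ℚ.*-congˡ {ρ ^ k} y≃z) x≤y
    ; y≤x = ℚ.≤-respˡ-≃ y≃z y≤x }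
    where open Within p

  Within-refl : ∀ {x} → 0ℚᵘ ≤ x → Within 0 x x
  Within-refl {x} 0≤x = record { 0≤x = 0≤x ; 0≤y = 0≤x ; x≤y = x≤x ; y≤x = x≤x }
    where x≤x = ℚ.≤-reflexive (≃-sym (ℚ.*-identityˡ x))

-- Only x ≤ y needs an argument: then 2 - y ≤ 2 - x, and the positive factor 2 - x cancels. A
-- relative error of the potentials is thus also one of the values, with the same η.
⊲⇒≤ : ∀ {η x y} → 0ℚᵘ ≤ η → 0ℚᵘ < x → x ≤ 1ℚᵘ → x ⊲[ η ] y → y ≤ (1ℚᵘ + η) * x
⊲⇒≤ {η} {x} {y} 0≤η 0<x x≤1 x⊲y with ℚ.≤-total y x
... | inj₁ y≤x = ℚ.≤-trans y≤x (ℚ.≤-respˡ-≃ (ℚ.*-identityˡ x) (*-monoˡ-≤ {1ℚᵘ} {1ℚᵘ + η} x (ℚ.<⇒≤ 0<x) (≤-gap η 0≤η ≃-refl)))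
... | inj₂ x≤y = *-cancelˡ-≤ (c 2 - x) 0<2-x (begin
  (c 2 - x) * y                ≃⟨ ℚ.*-comm (c 2 - x) y ⟩
  y * (c 2 - x)                ≤⟨ x⊲y ⟩
  (1ℚᵘ + η) * (x * (c 2 - y))  ≤⟨ *-monoʳ-≤ (1ℚᵘ + η) (+-≥0 (0≤c 1) 0≤η) (*-monoʳ-≤ x (ℚ.<⇒≤ 0<x) (ℚ.+-monoʳ-≤ (c 2) (ℚ.neg-mono-≤ x≤y))) ⟩
  (1ℚᵘ + η) * (x * (c 2 - x))  ≃⟨ solve 3 (λ e x z → e :* (x :* z) := z :* (e :* x)) ≃-refl (1ℚᵘ + η) x (c 2 - x) ⟩
  (c 2 - x) * ((1ℚᵘ + η) * x)  ∎)
  where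
  open ℚ.≤-Reasoning
  0<2-x : 0ℚᵘ < c 2 - x
  0<2-x = ℚ.<-respʳ-≃ (solve 1 (λ x → k 1 :+ (k 1 :- x) := k 2 :- x) ≃-refl x) (+->0 (0<c 0) (gap-≥0 x≤1))

inverse-antitone : ∀ {r x y} → 0ℚᵘ < x → 0ℚᵘ < y → x ≤ r * y → inverse y ≤ r * inverse x
inverse-antitone {r} {x} {y} 0<x 0<y x≤ry = *-cancelˡ-≤ (x * y) (*->0 0<x 0<y) (begin
  x * y * inverse y          ≃⟨ solve 3 (λ x y i → x :* y :* i := x :* (i :* y)) ≃-refl x y (inverse y) ⟩
  x * (inverse y * y)        ≃⟨ ℚ.*-congˡ {x} (inverse-* 0<y) ⟩
  x * 1ℚᵘ                    ≃⟨ ℚ.*-identityʳ x ⟩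
  x                          ≤⟨ x≤ry ⟩
  r * y                      ≃⟨ ℚ.*-identityʳ (r * y) ⟨
  r * y * 1ℚᵘ                ≃⟨ ℚ.*-congˡ {r * y} (inverse-* 0<x) ⟨
  r * y * (inverse x * x)    ≃⟨ solve 4 (λ r y i x → r :* y :* (i :* x) := x :* y :* (r :* i)) ≃-refl r y (inverse x) x ⟩
  x * y * (r * inverse x)    ∎)
  where open ℚ.≤-Reasoning

inverse-≥0 : ∀ {x} → 0ℚᵘ < x → 0ℚᵘ ≤ inverse x
inverse-≥0 {mkℚᵘ (+ 0) d}        _ = ℚ.≤-refl
inverse-≥0 {mkℚᵘ +[1+ m ] d}     _ = ℚ.nonNegative⁻¹ (mkℚᵘ +[1+ d ] m)
inverse-≥0 {mkℚᵘ -[1+ _ ] _} (*<* ())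

-- Accuracy of the algorithm

module Accuracy {n : ℕ} {adjacency : AdjacencyMatrix n} (local : Local adjacency) (tieBreak : TieBreak) (t : ℕ) where

  open Decay local tieBreak public
  private module I = IndependentSets adj

  ρ : ℚᵘ
  ρ = 1ℚᵘ + c 100 * error t

  0≤η : 0ℚᵘ ≤ c 100 * error t
  0≤η = *-≥0 (0≤c 100) (error-≥0 t)

  open Relative ρ (≤-gap (c 100 * error t) 0≤η ≃-refl) public

  inverse-within : ∀ {x y} → Near (error t) x y → Within 1 (inverse x) (inverse y)
  inverse-within {x} {y} near = record
    { 0≤x = inverse-≥0 0<x ; 0≤y = inverse-≥0 0<y
    ; x≤y = inverse-antitone {ρ ^ 1} 0<y 0<x (first (⊲⇒≤ 0≤η 0<x x≤1 x⊲y))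
    ; y≤x = inverse-antitone {ρ ^ 1} 0<x 0<y (first (⊲⇒≤ 0≤η 0<y y≤1 y⊲x)) }
    where
    open Near near
    first : ∀ {x y} → y ≤ ρ * x → y ≤ ρ ^ 1 * x
    first {x} = ℚ.≤-respʳ-≃ (ℚ.*-congʳ {x} (≃-sym (ℚ.*-identityʳ ρ)))

  -- The running value is arbitrary because this is the invariant of the loop. One factor `ρ` is
  -- lost per block; as blocks are nonempty, that amounts to at most one per vertex.
  divideByΦs-within : ∀ {F Ks j z z′} → Chain F Ks → Within j z z′ →
    Within (j ℕ.+ length Ks) (value (divideByΦs tieBreak t z F Ks)) (z′ * c (Z F))
  divideByΦs-within {j = j} {z} {z′} [] p = subst (λ j → Within j z (z′ * c 1)) (sym (ℕ.+-identityʳ j))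
    (Within-≃ (≃-sym (ℚ.*-identityʳ z′)) p)
  divideByΦs-within {F} {K ∷ Ks} {j} {z} {z′} (add valid x∈K chain) p =
    subst (λ k → Within k (value (divideByΦs tieBreak t z F (K ∷ Ks))) (z′ * c (Z F))) (trans (cong (ℕ._+ length Ks) (ℕ.+-comm j 1)) (sym (ℕ.+-suc j _)))
      (Within-≃ telescope (divideByΦs-within chain (Within-* p (inverse-within (Φ-near t valid)))))
    where
    telescope : z′ * inverse (Π F K) * c (Z (F ⊝ K)) ≃ z′ * c (Z F)
    telescope = begin-equality
      z′ * inverse (Π F K) * c (Z (F ⊝ K))           ≃⟨ ℚ.*-congˡ {z′ * inverse (Π F K)} (Π-Z F K) ⟨
      z′ * inverse (Π F K) * (c (Z F) * Π F K)       ≃⟨ solve 4 (λ a b c d → a :* b :* (c :* d) := a :* c :* (b :* d)) ≃-refl z′ (inverse (Π F K)) (c (Z F)) (Π F K) ⟩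
      z′ * c (Z F) * (inverse (Π F K) * Π F K)       ≃⟨ ℚ.*-congˡ {z′ * c (Z F)} (inverse-* (0<Π F K)) ⟩
      z′ * c (Z F) * 1ℚᵘ                             ≃⟨ ℚ.*-identityʳ (z′ * c (Z F)) ⟩
      z′ * c (Z F)                                   ∎
      where open ℚ.≤-Reasoning

  countIS-within : ∀ {G K x} → Valid G K → x ∈ K → Connected G →
                   Within (length G) (value (countIS tieBreak G K t)) (c (Z G))
  countIS-within {G} {K} valid x∈K conn = Within-mono (chain-length chain)
    (Within-≃ (ℚ.*-identityˡ (c (Z G))) (divideByΦs-within chain (Within-refl (0≤c 1))))
    where chain = blocks-chain valid x∈K conn

  module _ (f : List V → Timed ℚᵘ) where

    product-within : ∀ {G Cs} → Components G Cs → All (λ C → Within (length C) (value (f C)) (c (Z C))) Cs →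
                     Within (length G) (value (productᵀ f Cs)) (c (Z G))
    product-within [] [] = Within-refl (0≤c 1)
    product-within {G} (add {C = C} {R} {Cs} _ _ σ apart comps) (p ∷ ps) =
      subst (λ l → Within l (value (productᵀ f (C ∷ Cs))) (c (Z G))) (sym (trans (↭.↭-length σ) (List.length-++ C)))
        (Within-≃ (ℚ.≃-trans (≃-sym (c-* (Z C) (Z R))) (ℚ.≃-reflexive (cong c (sym Z-product))))
          (Within-* p (product-within comps ps)))
      where
      Z-product : Z G ≡ Z C ℕ.* Z R
      Z-product = trans (I.independent-↭ adj-sym _ σ) (I.independent-++ C R _ apart)

  countComponent-within : ∀ {F v C} → Unique F → Connected F → v ∈ F → Component (remote F v) C →
    Within (length C) (value (countComponent tieBreak (nbrs F v) t C)) (c (Z C))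
  countComponent-within {F} {v} {C} !F conn v∈F comp =
    let (u , x , picked , valid , x∈K) = attachment !F conn v∈F comp
    in subst (λ z → Within (length C) z (c (Z C))) (sym (proj₁ (countComponent-picked t (nbrs F v) C picked)))
         (countIS-within valid x∈K (Component.connected comp))

  increment-within : ∀ {F v} → Unique F → Connected F → v ∈ F →
    Within (length F) (value (increment tieBreak F v t)) (c (Z (remote F v)))
  increment-within {F} {v} !F conn v∈F = subst (λ z → Within (length F) z (c (Z (remote F v)))) (sym (proj₁ (increment-components t F v)))
    (Within-mono (length-⊝ F (v ∷ nbrs F v))
      (product-within (countComponent tieBreak (nbrs F v) t) comps (All.map (countComponent-within !F conn v∈F) (components-all !remote comps))))
    where
    !remote = ⊝-unique (v ∷ nbrs F v) !F
    comps = components-spec !remote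

  Z-remove : ∀ {F v} → Unique F → v ∈ F → Z F ≡ Z (F ⊝ (v ∷ [])) ℕ.+ Z (remote F v)
  Z-remove {F} {v} !F v∈F = trans (I.independent-↭ adj-sym _ (↭.↭-sym (++-⊝-↭ !F ([] ∷ []) λ { (here refl) → v∈F })))
    (cong (Z (F ⊝ (v ∷ [])) ℕ.+_) (trans (sym (I.Z-filterᵇ q (F ⊝ (v ∷ []))))
      (I.Z-same adj-sym (Unique.filter⁺ (Bool.T? ∘ q) (⊝-unique (v ∷ []) !F)) (⊝-unique (v ∷ nbrs F v) !F) to from)))
    where
    q = λ w → not (adj v w)
    to : ∀ {w} → w ∈ filterᵇ q (F ⊝ (v ∷ [])) → w ∈ remote F v
    to {w} w∈ with ∈-filterᵇ⁻ q {xs = F ⊝ (v ∷ [])} w∈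
    ... | w∈₁ , vw with ∈-⊝⁻ F (v ∷ []) w∈₁
    ...   | w∈F , w≢v = ∈-⊝⁺ (v ∷ nbrs F v) w∈F
      λ { (here w≡v) → w≢v (here w≡v) ; (there w∈N) → true≢false (proj₂ (∈-nbrs⁻ F w∈N)) (not-true vw) }
    from : ∀ {w} → w ∈ remote F v → w ∈ filterᵇ q (F ⊝ (v ∷ []))
    from w∈ with ∈-remote⁻ F v w∈
    ... | w∈F , w≢v , vw = ∈-filterᵇ⁺ q (∈-⊝⁺ (v ∷ []) w∈F λ { (here w≡v) → w≢v w≡v }) (cong not vw)

  -- The running total starts with 1 for the empty set, so that Z F - 1 is what the loop still has
  -- to add when `F` is left. The `pred` of a positive count expresses this.
  pred-Z : ∀ {F v} → Unique F → v ∈ F → ∀ m →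
           (m ℕ.+ Z (remote F v)) ℕ.+ ℕ.pred (Z (F ⊝ (v ∷ []))) ≡ m ℕ.+ ℕ.pred (Z F)
  pred-Z {F} {v} !F v∈F m rewrite Z-remove !F v∈F with Z (F ⊝ (v ∷ [])) | Z>0 (F ⊝ (v ∷ [])) (λ _ → true)
  ... | suc z | _ = trans (ℕ.+-assoc m _ z) (cong (m ℕ.+_) (ℕ.+-comm _ z))

  -- The exponent `N` is the same in every round: the loop only adds, and a sum of quantities known
  -- up to a common factor is known up to that factor.
  countLoop-within : ∀ fuel N {F z m} → Unique F → Connected F → length F ℕ.≤ fuel → length F ℕ.≤ N → Within N z (c m) →
    Within N (value (countLoop tieBreak fuel z F t)) (c (m ℕ.+ ℕ.pred (Z F)))
  countLoop-within zero       N {[]} {z} {m} !F conn _ _ p = subst (λ m → Within N z (c m)) (sym (ℕ.+-identityʳ m)) p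
  countLoop-within (suc fuel) N {[]} {z} {m} !F conn _ _ p = subst (λ m → Within N z (c m)) (sym (ℕ.+-identityʳ m)) p
  countLoop-within (suc fuel) N {F@(x ∷ xs)} {z} {m} !F conn le le′ p =
    let (v , v∈F , conn-v , picked) = removal !F conn (here refl)
    in subst₂ (λ y k → Within N y (c k)) (sym (proj₁ (countLoop-picked t fuel z x xs picked))) (pred-Z !F v∈F m)
         (countLoop-within fuel N (⊝-unique (v ∷ []) !F) conn-v (ℕ.s≤s⁻¹ (ℕ.≤-trans (smaller v∈F) le))
           (ℕ.≤-trans (length-⊝ F (v ∷ [])) le′)
           (Within-≃ (≃-sym (c-+ m (Z (remote F v)))) (Within-+ p (Within-mono le′ (increment-within !F conn v∈F)))))
    where
    smaller : ∀ {v} → v ∈ F → suc (length (F ⊝ (v ∷ []))) ℕ.≤ length F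
    smaller {v} v∈F = ⊆⇒length-≤ {xs = v ∷ F ⊝ (v ∷ [])}
      (All.¬Any⇒All¬ _ (λ v∈ → proj₂ (∈-⊝⁻ F (v ∷ []) v∈) (here refl)) ∷ ⊝-unique (v ∷ []) !F)
      λ { (here refl) → v∈F ; (there x∈) → proj₁ (∈-⊝⁻ F (v ∷ []) x∈) }

  countConnected-within : ∀ {G} → Unique G → Connected G → Within (length G) (value (countConnected tieBreak G t)) (c (Z G))
  countConnected-within {G} !G conn = subst (λ k → Within (length G) (value (countConnected tieBreak G t)) (c k)) suc-pred
    (countLoop-within n (length G) {m = 1} !G conn (unique-length !G) ℕ.≤-refl (Within-mono z≤n (Within-refl (0≤c 1))))
    where
    suc-pred : suc (ℕ.pred (Z G)) ≡ Z G
    suc-pred = ℕ.suc-pred (Z G) {{ℕ.>-nonZero (Z>0 G _)}}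

  countComponents-within : Within n (value (productᵀ (λ G → countConnected tieBreak G t) (value (components (List.allFin n)))))
                                    (c (Z (List.allFin n)))
  countComponents-within = subst (λ l → Within l (value (productᵀ (λ G → countConnected tieBreak G t) (value (components (List.allFin n))))) (c (Z (List.allFin n))))
    (List.length-tabulate {n = n} id)
    (product-within (λ G → countConnected tieBreak G t) comps
      (All.map (λ comp → countConnected-within (Component.unique comp) (Component.connected comp)) (components-all !all comps)))
    where
    !all = Unique.allFin⁺ n
    comps = components-spec !all

-- Intersection graphs

bool-ext : ∀ {a b : Bool} → (a ≡ true → b ≡ true) → (b ≡ true → a ≡ true) → a ≡ b
bool-ext {true}          to from = sym (to refl)
bool-ext {false} {true}  to from = from refl
bool-ext {false} {false} to from = refl

-- Only lists of three elements matter.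
firstHit : {A : Set} → List A → (A → Bool) → Fin 3
firstHit []          p = Fin.zero
firstHit (x ∷ [])    p = Fin.zero
firstHit (x ∷ y ∷ _) p = if p x then Fin.zero else if p y then Fin.suc Fin.zero else Fin.suc (Fin.suc Fin.zero)

-- `firstHit` returns the last index without a test, which the hit at `w` justifies when the first
-- two entries fail.
firstHit-hits : ∀ {A : Set} {x y z w : A} (p : A → Bool) → w ∈ x ∷ y ∷ z ∷ [] → p w ≡ true →
                p (Vec.lookup (x ∷ y ∷ z ∷ []) (firstHit (x ∷ y ∷ z ∷ []) p)) ≡ true
firstHit-hits {x = x} {y} {z} p w∈ pw with p x in px | p y in py | w∈
... | true  | _     | _                         = px
... | false | true  | _                         = py
... | false | false | here refl                 = contradiction (trans (sym px) pw) λ ()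
... | false | false | there (here refl)         = contradiction (trans (sym py) pw) λ ()
... | false | false | there (there (here refl)) = pw

length-members : ∀ {m} (p : Subset m) → length (members p) ≡ ∣ p ∣
length-members []      = refl
length-members {suc m} (s ∷ p) with tail
  where
  shift : ∀ L → length (filter (Subset._∈? (s ∷ p)) (map Fin.suc L)) ≡ length (filter (Subset._∈? p) L)
  shift []      = refl
  shift (i ∷ L) with does (i Subset.∈? p)
  ... | true  = cong suc (shift L)
  ... | false = shift L
  tail : length (filter (Subset._∈? (s ∷ p)) (List.tabulate Fin.suc)) ≡ ∣ p ∣
  tail = trans (cong (λ L → length (filter (Subset._∈? (s ∷ p)) L)) (sym (List.map-tabulate id Fin.suc)))
    (trans (shift (List.allFin m)) (length-members p))
length-members (inside  ∷ p) | eq = cong suc eq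
length-members (outside ∷ p) | eq = eq

-- Counting the independent sets as subsets

-- An independence test that follows the recursion of `independent`, excluding later neighbours
-- through the predicate, so that the subsets passing it are counted by the same recursion.
compatible : ∀ {m} → (Fin m → Fin m → Bool) → (Fin m → Bool) → Subset m → Bool
compatible adj p []            = true
compatible adj p (outside ∷ S) = compatible (λ i j → adj (Fin.suc i) (Fin.suc j)) (p ∘ Fin.suc) S
compatible adj p (inside ∷ S)  = p Fin.zero ∧
  compatible (λ i j → adj (Fin.suc i) (Fin.suc j)) (λ i → p (Fin.suc i) ∧ not (adj Fin.zero (Fin.suc i))) S

independent-map : ∀ {A B : Set} (adj : B → B → Bool) (f : A → B) L p →
  IndependentSets.independent adj (map f L) p ≡ IndependentSets.independent (λ a b → adj (f a) (f b)) L (p ∘ f)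
independent-map adj f []      p = refl
independent-map adj f (x ∷ L) p with p (f x)
... | true  = cong₂ ℕ._+_ (independent-map adj f L p) (independent-map adj f L _)
... | false = cong (ℕ._+ 0) (independent-map adj f L p)

filterᵇ-none : ∀ {A : Set} (xs : List A) → length (filterᵇ (λ _ → false) xs) ≡ 0
filterᵇ-none []       = refl
filterᵇ-none (x ∷ xs) = filterᵇ-none xs

count-compatible : ∀ {m} (adj : Fin m → Fin m → Bool) p →
  length (filterᵇ (compatible adj p) (allSubsets m)) ≡ IndependentSets.independent adj (List.allFin m) p
count-compatible {zero}  adj p = refl
count-compatible {suc m} adj p = begin
  length (filterᵇ q (map (inside ∷_) Ss ++ map (outside ∷_) Ss))
    ≡⟨ cong length (List.filter-++ (Bool.T? ∘ q) (map (inside ∷_) Ss) (map (outside ∷_) Ss)) ⟩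
  length (filterᵇ q (map (inside ∷_) Ss) ++ filterᵇ q (map (outside ∷_) Ss))
    ≡⟨ List.length-++ (filterᵇ q (map (inside ∷_) Ss)) ⟩
  length (filterᵇ q (map (inside ∷_) Ss)) ℕ.+ length (filterᵇ q (map (outside ∷_) Ss))
    ≡⟨ cong₂ ℕ._+_ (length-filterᵇ-map q (inside ∷_) Ss) (length-filterᵇ-map q (outside ∷_) Ss) ⟩
  length (filterᵇ (λ S → p Fin.zero ∧ compatible adj′ p′ S) Ss) ℕ.+ length (filterᵇ (compatible adj′ (p ∘ Fin.suc)) Ss)
    ≡⟨ cong₂ ℕ._+_ with-zero (tail (p ∘ Fin.suc) (λ i → p i) (λ _ → refl)) ⟩
  (if p Fin.zero then independent L (λ i → p i ∧ not (adj Fin.zero i)) else 0) ℕ.+ independent L p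
    ≡⟨ ℕ.+-comm _ (independent L p) ⟩
  independent (Fin.zero ∷ L) p ∎
  where
  open ≡-Reasoning
  open IndependentSets adj
  Ss = allSubsets m
  L  = List.tabulate Fin.suc
  q  = compatible adj p
  adj′ = λ (i j : Fin m) → adj (Fin.suc i) (Fin.suc j)
  p′ = λ i → p (Fin.suc i) ∧ not (adj Fin.zero (Fin.suc i))
  tail : ∀ p′ p → (∀ i → p′ i ≡ p (Fin.suc i)) → length (filterᵇ (compatible adj′ p′) Ss) ≡ independent L p
  tail p′ p p≡ = begin
    length (filterᵇ (compatible adj′ p′) Ss)                     ≡⟨ count-compatible adj′ p′ ⟩
    IndependentSets.independent adj′ (List.allFin m) p′          ≡⟨ IndependentSets.independent-cong adj′ (List.allFin m) (λ {i} _ → p≡ i) ⟩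
    IndependentSets.independent adj′ (List.allFin m) (p ∘ Fin.suc) ≡⟨ independent-map adj Fin.suc (List.allFin m) p ⟨
    independent (map Fin.suc (List.allFin m)) p                  ≡⟨ cong (λ L → independent L p) (List.map-tabulate id Fin.suc) ⟩
    independent L p                                              ∎
  with-zero : length (filterᵇ (λ S → p Fin.zero ∧ compatible adj′ p′ S) Ss) ≡
              (if p Fin.zero then independent L (λ i → p i ∧ not (adj Fin.zero i)) else 0)
  with-zero with p Fin.zero
  ... | true  = tail p′ (λ i → p i ∧ not (adj Fin.zero i)) (λ _ → refl)
  ... | false = filterᵇ-none Ss

compatible⁺ : ∀ {m} (adj : Fin m → Fin m → Bool) p S → (∀ i → i ∈ₛ S → p i ≡ true) →
  (∀ i j → i ∈ₛ S → j ∈ₛ S → i ≢ j → adj i j ≡ false) → compatible adj p S ≡ true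
compatible⁺ adj p []            all indep = refl
compatible⁺ adj p (outside ∷ S) all indep = compatible⁺ _ _ S (λ i i∈ → all (Fin.suc i) (Vec.there i∈))
  (λ i j i∈ j∈ i≢j → indep (Fin.suc i) (Fin.suc j) (Vec.there i∈) (Vec.there j∈) (i≢j ∘ Fin.suc-injective))
compatible⁺ adj p (inside ∷ S)  all indep = cong₂ _∧_ (all Fin.zero Vec.here)
  (compatible⁺ _ _ S (λ i i∈ → cong₂ _∧_ (all (Fin.suc i) (Vec.there i∈)) (cong not (indep Fin.zero (Fin.suc i) Vec.here (Vec.there i∈) λ ())))
    (λ i j i∈ j∈ i≢j → indep (Fin.suc i) (Fin.suc j) (Vec.there i∈) (Vec.there j∈) (i≢j ∘ Fin.suc-injective)))

compatible⁻ : ∀ {m} (adj : Fin m → Fin m → Bool) → (∀ i j → adj i j ≡ adj j i) → ∀ p S → compatible adj p S ≡ true →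
  (∀ i → i ∈ₛ S → p i ≡ true) × (∀ i j → i ∈ₛ S → j ∈ₛ S → i ≢ j → adj i j ≡ false)
compatible⁻ adj adj-sym p []            _  = (λ i ()) , (λ i j ())
compatible⁻ adj adj-sym p (outside ∷ S) eq with compatible⁻ _ (λ i j → adj-sym (Fin.suc i) (Fin.suc j)) _ S eq
... | all , indep = (λ { (Fin.suc i) (Vec.there i∈) → all i i∈ })
  , (λ { (Fin.suc i) (Fin.suc j) (Vec.there i∈) (Vec.there j∈) i≢j → indep i j i∈ j∈ (i≢j ∘ cong Fin.suc) })
compatible⁻ adj adj-sym p (inside ∷ S)  eq with ∧-true {p Fin.zero} eq
... | p0 , eq′ with compatible⁻ _ (λ i j → adj-sym (Fin.suc i) (Fin.suc j)) _ S eq′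
...   | all , indep =
  (λ { Fin.zero Vec.here → p0 ; (Fin.suc i) (Vec.there i∈) → proj₁ (∧-true {p (Fin.suc i)} (all i i∈)) })
  , λ { Fin.zero    Fin.zero    _              _              i≢j → contradiction refl i≢j
      ; Fin.zero    (Fin.suc j) _              (Vec.there j∈) _   → first j j∈
      ; (Fin.suc i) Fin.zero    (Vec.there i∈) _              _   → trans (adj-sym (Fin.suc i) Fin.zero) (first i i∈)
      ; (Fin.suc i) (Fin.suc j) (Vec.there i∈) (Vec.there j∈) i≢j → indep i j i∈ j∈ (i≢j ∘ cong Fin.suc) }
  where
  first : ∀ j → j ∈ₛ S → adj Fin.zero (Fin.suc j) ≡ false
  first j j∈ = not-true (proj₂ (∧-true {p (Fin.suc j)} (all j j∈)))

length-filter-⇔ : ∀ {A : Set} {P : A → Set} (P? : ∀ x → Dec (P x)) (q : A → Bool) →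
  (∀ x → P x → q x ≡ true) → (∀ x → q x ≡ true → P x) → ∀ xs → length (filter P? xs) ≡ length (filterᵇ q xs)
length-filter-⇔ P? q to from []       = refl
length-filter-⇔ P? q to from (x ∷ xs) with P? x | q x in qx
... | yes _  | true  = cong suc (length-filter-⇔ P? q to from xs)
... | yes px | false = contradiction (trans (sym qx) (to x px)) λ ()
... | no ¬px | true  = contradiction (from x qx) ¬px
... | no _   | false = length-filter-⇔ P? q to from xs

-- The entries of the intersection graph are computed by an unnamed `do` block. Taking the matrix
-- together with an equation lets unification supply it as `f`.
matrix-entry : ∀ {A : Set} {n} (f : Fin n → Fin n → Timed A) M → M ≡ value (tabulateᵀ (λ i → tabulateᵀ (f i))) →
               ∀ i j → Vec.lookup (Vec.lookup M i) j ≡ value (f i j)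
matrix-entry f M refl i j = trans (cong (λ row → Vec.lookup row j) (value-tabulateᵀ (λ i → tabulateᵀ (f i)) i))
  (value-tabulateᵀ (f i) j)

module Intersections (H : Hypergraph) where

  open Hypergraph H

  adjacency : AdjacencyMatrix #E
  adjacency = value (intersectionGraph H)

  open Graph adjacency using (adj)

  ∈-members⁺ : ∀ {x i} → x ∈ₛ edge i → x ∈ members (edge i)
  ∈-members⁺ {x} {i} x∈ = ∈.∈-filter⁺ (Subset._∈? edge i) (∈.∈-allFin x) x∈

  ∈-members⁻ : ∀ {x i} → x ∈ members (edge i) → x ∈ₛ edge i
  ∈-members⁻ {x} {i} x∈ = proj₂ (∈.∈-filter⁻ (Subset._∈? edge i) {xs = List.allFin #V} x∈)

  intersectᵀ⁺ : ∀ {i j x} → x ∈ₛ edge i → x ∈ₛ edge j → value (intersectᵀ H i j) ≡ true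
  intersectᵀ⁺ {i} {j} x∈i x∈j = anyᵀ⁺ (_∈ᵀ members (edge j)) (∈-members⁺ x∈i) (elem⁺ (members (edge j)) (∈-members⁺ x∈j))

  intersectᵀ⁻ : ∀ {i j} → value (intersectᵀ H i j) ≡ true → ∃[ x ] x ∈ₛ edge i × x ∈ₛ edge j
  intersectᵀ⁻ {i} {j} eq with anyᵀ⁻ (_∈ᵀ members (edge j)) (members (edge i)) eq
  ... | x , x∈i , x∈j = x , ∈-members⁻ x∈i , ∈-members⁻ (elem⁻ (members (edge j)) x∈j)

  adj⁺ : ∀ {i j x} → i ≢ j → x ∈ₛ edge i → x ∈ₛ edge j → adj i j ≡ true
  adj⁺ {i} {j} i≢j x∈i x∈j with i Fin.≟ j | matrix-entry _ adjacency refl i j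
  ... | yes i≡j | _     = contradiction i≡j i≢j
  ... | no _    | entry = trans entry (intersectᵀ⁺ x∈i x∈j)

  adj⁻ : ∀ {i j} → adj i j ≡ true → i ≢ j × ∃[ x ] x ∈ₛ edge i × x ∈ₛ edge j
  adj⁻ {i} {j} eq with i Fin.≟ j | matrix-entry _ adjacency refl i j
  ... | yes _  | entry = contradiction (trans (sym entry) eq) λ ()
  ... | no i≢j | entry = i≢j , intersectᵀ⁻ (trans (sym entry) eq)

  adj-sym : ∀ i j → adj i j ≡ adj j i
  adj-sym i j = bool-ext flip flip
    where
    flip : ∀ {i j} → adj i j ≡ true → adj j i ≡ true
    flip eq with adj⁻ eq
    ... | i≢j , x , x∈i , x∈j = adj⁺ (i≢j ∘ sym) x∈j x∈i

  matching⇔independent : Z-M H ≡ IndependentSets.Z adj (List.allFin #E)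
  matching⇔independent = trans (length-filter-⇔ (isMatching? H) (compatible adj (λ _ → true)) to from (allSubsets #E))
    (count-compatible adj (λ _ → true))
    where
    to : ∀ M → IsMatching H M → compatible adj (λ _ → true) M ≡ true
    to M matching = compatible⁺ adj _ M (λ _ _ → refl) λ i j i∈ j∈ i≢j → ≡false λ ij →
      let (_ , x , x∈i , x∈j) = adj⁻ ij in matching i j i∈ j∈ i≢j (x , Subset.x∈p∩q⁺ (x∈i , x∈j))
    from : ∀ M → compatible adj (λ _ → true) M ≡ true → IsMatching H M
    from M eq i j i∈ j∈ i≢j (x , x∈) = true≢false (adj⁺ i≢j (proj₁ x∈both) (proj₂ x∈both))
      (proj₂ (compatible⁻ adj adj-sym _ M eq) i j i∈ j∈ i≢j)
      where x∈both = Subset.x∈p∩q⁻ (edge i) (edge j) x∈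

  module _ (isKR : IsKR 3 3 H) where

    private
      contains : Fin #E → Fin #V → Bool
      contains i x = does (x Subset.∈? edge i)

      contains⁺ : ∀ {i x} → x ∈ₛ edge i → contains i x ≡ true
      contains⁺ {i} {x} x∈ with x Subset.∈? edge i
      ... | yes _ = refl
      ... | no x∉ = contradiction x∈ x∉

      contains⁻ : ∀ {i x} → contains i x ≡ true → x ∈ₛ edge i
      contains⁻ {i} {x} eq with x Subset.∈? edge i
      ... | yes x∈ = x∈

    members-length : ∀ i → length (members (edge i)) ≡ 3
    members-length i = trans (length-members (edge i)) (proj₁ isKR i)

    degree-≤3 : ∀ x → degree H x ℕ.≤ 3
    degree-≤3 x = ℕ.≤-trans (All.lookup (Extrema.xs≤max 0 (map (degree H) (List.allFin #V)))
      (∈.∈-map⁺ (degree H) (∈.∈-allFin x))) (proj₂ isKR)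

    label : Fin #E → Fin #E → Fin 3
    label v w = firstHit (members (edge v)) (contains w)

    -- Adjacent edges with the same label share the vertex in question.
    corner : ∀ v → ∃[ e ] (∀ w → adj v w ≡ true → Vec.lookup {n = 3} e (label v w) ∈ₛ edge v × Vec.lookup e (label v w) ∈ₛ edge w)
    corner v with members (edge v) in eq | members-length v
    ... | x ∷ y ∷ z ∷ [] | _ = x ∷ y ∷ z ∷ [] , λ w vw → let (_ , u , u∈v , u∈w) = adj⁻ vw in
      ∈-members⁻ (subst (Vec.lookup (x ∷ y ∷ z ∷ []) (firstHit (x ∷ y ∷ z ∷ []) (contains w)) ∈_) (sym eq) (lookup-∈ (firstHit (x ∷ y ∷ z ∷ []) (contains w)))) ,
      contains⁻ {w} (firstHit-hits (contains w) (subst (u ∈_) eq (∈-members⁺ u∈v)) (contains⁺ u∈w))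
      where
      lookup-∈ : ∀ i → Vec.lookup (x ∷ y ∷ z ∷ []) i ∈ x ∷ y ∷ z ∷ []
      lookup-∈ Fin.zero                     = here refl
      lookup-∈ (Fin.suc Fin.zero)           = there (here refl)
      lookup-∈ (Fin.suc (Fin.suc Fin.zero)) = there (there (here refl))

    -- Otherwise `v`, `a`, `b` and `c` would be four distinct edges through `x`.
    few-edges : ∀ {x v a b c} → x ∈ₛ edge v → x ∈ₛ edge a → x ∈ₛ edge b → x ∈ₛ edge c →
                v ≢ a → v ≢ b → v ≢ c → a ≡ b ⊎ a ≡ c ⊎ b ≡ c
    few-edges {x} {v} {a} {b} {c} v∋x a∋x b∋x c∋x v≢a v≢b v≢c with a Fin.≟ b | a Fin.≟ c | b Fin.≟ c
    ... | yes a≡b | _       | _       = inj₁ a≡b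
    ... | no _    | yes a≡c | _       = inj₂ (inj₁ a≡c)
    ... | no _    | no _    | yes b≡c = inj₂ (inj₂ b≡c)
    ... | no a≢b  | no a≢c  | no b≢c  = contradiction (ℕ.≤-trans four (degree-≤3 x)) λ { (s≤s (s≤s (s≤s ()))) }
      where
      incident : ∀ {i} → x ∈ₛ edge i → i ∈ filter (λ i → x Subset.∈? edge i) (List.allFin #E)
      incident {i} i∋x = ∈.∈-filter⁺ (λ i → x Subset.∈? edge i) (∈.∈-allFin i) i∋x
      four : 4 ℕ.≤ degree H x
      four = ⊆⇒length-≤ {xs = v ∷ a ∷ b ∷ c ∷ []}
        ((v≢a ∷ v≢b ∷ v≢c ∷ []) ∷ (a≢b ∷ a≢c ∷ []) ∷ (b≢c ∷ []) ∷ [] ∷ [])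
        λ { (here refl) → incident v∋x ; (there (here refl)) → incident a∋x
          ; (there (there (here refl))) → incident b∋x ; (there (there (there (here refl)))) → incident c∋x }

    intersection-local : Local adjacency
    intersection-local = record
      { adj-sym    = adj-sym
      ; adj-irrefl = λ v → ≡false λ vv → proj₁ (adj⁻ vv) refl
      ; label      = label
      ; clique     = λ {v} {a} {b} va vb eq a≢b → let (e , hits) = corner v in
          adj⁺ a≢b (subst (λ l → Vec.lookup e l ∈ₛ edge a) eq (proj₂ (hits a va))) (proj₂ (hits b vb))
      ; small      = λ {v} {a} {b} {c} va vb vc ab ac → let (e , hits) = corner v in
          few-edges (proj₁ (hits a va)) (proj₂ (hits a va))
            (subst (λ l → Vec.lookup e l ∈ₛ edge b) (sym ab) (proj₂ (hits b vb)))
            (subst (λ l → Vec.lookup e l ∈ₛ edge c) (sym ac) (proj₂ (hits c vc)))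
            (proj₁ (adj⁻ va)) (proj₁ (adj⁻ vb)) (proj₁ (adj⁻ vc)) }

-- Running time of the basic operations

≤-slack : ∀ {a b} s → a ℕ.+ s ≡ b → a ℕ.≤ b
≤-slack {a} s refl = ℕ.m≤m+n a s

-- Fractions are never reduced, so lengths add up in every operation and have to be followed through
-- the recursion along with the times. Powers of two make this additivity exact for products.
record Size (m : ℕ) (p : ℚᵘ) : Set where
  constructor sized
  field
    numerator   : ℤ.∣ ↥ p ∣ ℕ.< 2 ℕ.^ m
    denominator : ↧ₙ p ℕ.< 2 ℕ.^ m

Size-mono : ∀ {m k p} → m ℕ.≤ k → Size m p → Size k p
Size-mono m≤k (sized num den) = sized (ℕ.≤-trans num 2^m≤2^k) (ℕ.≤-trans den 2^m≤2^k)
  where 2^m≤2^k = ℕ.^-monoʳ-≤ 2 m≤k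

bits-≤ : ∀ {m} p → Size m p → bits p ℕ.≤ 2 ℕ.* m
bits-≤ {m} p (sized num den) = ℕ.≤-trans (ℕ.+-mono-≤ (log num) (log den)) (ℕ.≤-reflexive (cong (m ℕ.+_) (sym (ℕ.+-identityʳ m))))
  where
  log : ∀ {a} → a ℕ.< 2 ℕ.^ m → ⌈log₂ suc a ⌉ ℕ.≤ m
  log a<2^m = ℕ.≤-trans (⌈log₂⌉-mono-≤ a<2^m) (ℕ.≤-reflexive (⌈log₂2^n⌉≡n m))

Size-* : ∀ {m k} p q → Size m p → Size k q → Size (m ℕ.+ k) (p * q)
Size-* {m} {k} p@(mkℚᵘ a x) q@(mkℚᵘ b y) (sized num-p den-p) (sized num-q den-q) =
  sized (subst₂ ℕ._<_ (sym (ℤ.abs-* a b)) (sym (ℕ.^-distribˡ-+-* 2 m k)) (ℕ.*-mono-< num-p num-q))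
    (subst (suc x ℕ.* suc y ℕ.<_) (sym (ℕ.^-distribˡ-+-* 2 m k)) (ℕ.*-mono-< den-p den-q))

Size-+ : ∀ {m k} p q → Size m p → Size k q → Size (suc (m ℕ.+ k)) (p + q)
Size-+ {m} {k} p@(mkℚᵘ a x) q@(mkℚᵘ b y) (sized num-p den-p) (sized num-q den-q) =
  sized (begin-strict
    ℤ.∣ a ℤ.* + suc y ℤ.+ b ℤ.* + suc x ∣             ≤⟨ ℤ.∣i+j∣≤∣i∣+∣j∣ (a ℤ.* + suc y) (b ℤ.* + suc x) ⟩
    ℤ.∣ a ℤ.* + suc y ∣ ℕ.+ ℤ.∣ b ℤ.* + suc x ∣       ≡⟨ cong₂ ℕ._+_ (ℤ.abs-* a (+ suc y)) (ℤ.abs-* b (+ suc x)) ⟩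
    ℤ.∣ a ∣ ℕ.* suc y ℕ.+ ℤ.∣ b ∣ ℕ.* suc x           <⟨ ℕ.+-mono-< (ℕ.*-mono-< num-p den-q) (ℕ.<-≤-trans (ℕ.*-mono-< num-q den-p) (ℕ.≤-reflexive (ℕ.*-comm (2 ℕ.^ k) _))) ⟩
    2 ℕ.^ m ℕ.* 2 ℕ.^ k ℕ.+ 2 ℕ.^ m ℕ.* 2 ℕ.^ k       ≡⟨ cong₂ ℕ._+_ (ℕ.^-distribˡ-+-* 2 m k) (trans (ℕ.+-identityʳ _) (ℕ.^-distribˡ-+-* 2 m k)) ⟨
    2 ℕ.* 2 ℕ.^ (m ℕ.+ k)                             ∎)
    (ℕ.<-≤-trans (subst (suc x ℕ.* suc y ℕ.<_) (sym (ℕ.^-distribˡ-+-* 2 m k)) (ℕ.*-mono-< den-p den-q)) (ℕ.^-monoʳ-≤ 2 (ℕ.n≤1+n (m ℕ.+ k))))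
  where open ℕ.≤-Reasoning

Size-inverse : ∀ {m} p → Size m p → Size m (inverse p)
Size-inverse (mkℚᵘ (+ 0) d)    (sized num den) = sized num (ℕ.≤-<-trans (s≤s z≤n) den)
Size-inverse (mkℚᵘ +[1+ a ] d) (sized num den) = sized den num
Size-inverse (mkℚᵘ -[1+ a ] d) (sized num den) = sized den num

Size-0 : Size 1 0ℚᵘ
Size-0 = sized (s≤s z≤n) (s≤s (s≤s z≤n))

Size-1 : Size 1 1ℚᵘ
Size-1 = sized (s≤s (s≤s z≤n)) (s≤s (s≤s z≤n))

Size-½ : Size 2 ½
Size-½ = sized (s≤s (s≤s z≤n)) (s≤s (s≤s (s≤s z≤n)))

arithmetic-time : ∀ {m k} p q → Size m p → Size k q → suc (bits p ℕ.+ bits q) ℕ.≤ suc (2 ℕ.* m ℕ.+ 2 ℕ.* k)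
arithmetic-time p q size-p size-q = s≤s (ℕ.+-mono-≤ (bits-≤ p size-p) (bits-≤ q size-q))

record Cost (σ τ : ℕ) (x : Timed ℚᵘ) : Set where
  constructor cost
  field
    size-≤ : Size σ (value x)
    time-≤ : time x ℕ.≤ τ

Cost-mono : ∀ {σ σ′ τ τ′ x} → σ ℕ.≤ σ′ → τ ℕ.≤ τ′ → Cost σ τ x → Cost σ′ τ′ x
Cost-mono {x = x} σ≤ τ≤ (cost size le) = cost (Size-mono σ≤ size) (ℕ.≤-trans le τ≤)

-- The `suc` is the extra bit of an addition, the final 1 the size of the initial value 0 or 1.
foldSize : ℕ → ℕ → ℕ
foldSize l σ = l ℕ.* suc σ ℕ.+ 1

foldTime : ℕ → ℕ → ℕ → ℕ
foldTime l σ τ = l ℕ.* (τ ℕ.+ suc (2 ℕ.* σ ℕ.+ 2 ℕ.* foldSize l σ)) ℕ.+ 1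

foldSize-mono : ∀ {l l′ σ} → l ℕ.≤ l′ → foldSize l σ ℕ.≤ foldSize l′ σ
foldSize-mono {σ = σ} l≤ = ℕ.+-monoˡ-≤ 1 (ℕ.*-monoˡ-≤ (suc σ) l≤)

foldTime-mono : ∀ {l l′ σ τ} → l ℕ.≤ l′ → foldTime l σ τ ℕ.≤ foldTime l′ σ τ
foldTime-mono {l} {l′} {σ} {τ} l≤ = ℕ.+-monoˡ-≤ 1 (ℕ.*-mono-≤ l≤
  (ℕ.+-monoʳ-≤ τ (s≤s (ℕ.+-monoʳ-≤ (2 ℕ.* σ) (ℕ.*-monoʳ-≤ 2 (foldSize-mono {l} {l′} {σ} l≤))))))

module _ {A : Set} {σ τ : ℕ} (f : A → Timed ℚᵘ) where

  fold-time-step : ∀ l {a b c} → a ℕ.≤ τ → b ℕ.≤ foldTime l σ τ → c ℕ.≤ suc (2 ℕ.* σ ℕ.+ 2 ℕ.* foldSize l σ) →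
                   a ℕ.+ (b ℕ.+ c) ℕ.≤ foldTime (suc l) σ τ
  fold-time-step l {a} {b} {c} a≤ b≤ c≤ = begin
    a ℕ.+ (b ℕ.+ c)                            ≤⟨ ℕ.+-mono-≤ a≤ (ℕ.+-mono-≤ b≤ c≤) ⟩
    τ ℕ.+ (l ℕ.* (τ ℕ.+ s) ℕ.+ 1 ℕ.+ s)        ≡⟨ regroup τ s (l ℕ.* (τ ℕ.+ s)) ⟩
    (τ ℕ.+ s) ℕ.+ l ℕ.* (τ ℕ.+ s) ℕ.+ 1        ≤⟨ ℕ.+-monoˡ-≤ 1 (ℕ.*-monoʳ-≤ (suc l) (ℕ.+-monoʳ-≤ τ (s≤s (ℕ.+-monoʳ-≤ (2 ℕ.* σ) (ℕ.*-monoʳ-≤ 2 (foldSize-mono {l} {suc l} {σ} (ℕ.n≤1+n l))))))) ⟩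
    foldTime (suc l) σ τ                       ∎
    where
    open ℕ.≤-Reasoning
    s = suc (2 ℕ.* σ ℕ.+ 2 ℕ.* foldSize l σ)
    regroup : ∀ τ s x → τ ℕ.+ (x ℕ.+ 1 ℕ.+ s) ≡ (τ ℕ.+ s) ℕ.+ x ℕ.+ 1
    regroup = solve-∀

  sum-cost : ∀ xs → (∀ {x} → x ∈ xs → Cost σ τ (f x)) → Cost (foldSize (length xs) σ) (foldTime (length xs) σ τ) (sumᵀ f xs)
  sum-cost []       _ = cost Size-0 ℕ.≤-refl
  sum-cost (x ∷ xs) costs with costs (here refl) | sum-cost xs (costs ∘ there)
  ... | cost size-x time-x | cost size-xs time-xs = cost
    (Size-mono (ℕ.≤-reflexive (regroup σ (length xs ℕ.* suc σ))) (Size-+ (value (f x)) (value (sumᵀ f xs)) size-x size-xs))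
    (fold-time-step (length xs) time-x time-xs (arithmetic-time (value (f x)) (value (sumᵀ f xs)) size-x size-xs))
    where
    regroup : ∀ σ y → suc (σ ℕ.+ (y ℕ.+ 1)) ≡ suc σ ℕ.+ y ℕ.+ 1
    regroup = solve-∀

  product-cost : ∀ xs → (∀ {x} → x ∈ xs → Cost σ τ (f x)) → Cost (foldSize (length xs) σ) (foldTime (length xs) σ τ) (productᵀ f xs)
  product-cost []       _ = cost Size-1 ℕ.≤-refl
  product-cost (x ∷ xs) costs with costs (here refl) | product-cost xs (costs ∘ there)
  ... | cost size-x time-x | cost size-xs time-xs = cost
    (Size-mono (≤-slack 1 (regroup σ (length xs ℕ.* suc σ)))
      (Size-* (value (f x)) (value (productᵀ f xs)) size-x size-xs))
    (fold-time-step (length xs) time-x time-xs (arithmetic-time (value (f x)) (value (productᵀ f xs)) size-x size-xs))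
    where
    regroup : ∀ σ y → (σ ℕ.+ (y ℕ.+ 1)) ℕ.+ 1 ≡ suc σ ℕ.+ y ℕ.+ 1
    regroup = solve-∀

module _ {A : Set} where

  filterᵀ-time : ∀ (p : A → Timed Bool) {τ} xs → (∀ x → time (p x) ℕ.≤ τ) → time (filterᵀ p xs) ℕ.≤ length xs ℕ.* suc τ ℕ.+ 1
  filterᵀ-time p {τ} []       _  = ℕ.≤-refl
  filterᵀ-time p {τ} (x ∷ xs) le = ℕ.≤-trans (ℕ.+-mono-≤ (le x) (ℕ.+-monoˡ-≤ 1 (filterᵀ-time p xs le)))
    (ℕ.≤-reflexive (regroup τ (length xs ℕ.* suc τ)))
    where
    regroup : ∀ τ y → τ ℕ.+ (y ℕ.+ 1 ℕ.+ 1) ≡ suc τ ℕ.+ y ℕ.+ 1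
    regroup = solve-∀

  anyᵀ-time : ∀ (p : A → Timed Bool) {τ} xs → (∀ x → time (p x) ℕ.≤ τ) → time (anyᵀ p xs) ℕ.≤ length xs ℕ.* τ ℕ.+ 1
  anyᵀ-time p {τ} []       _  = ℕ.≤-refl
  anyᵀ-time p {τ} (x ∷ xs) le with value (p x)
  ... | true  = ℕ.≤-trans (ℕ.+-monoˡ-≤ 1 (le x)) (ℕ.+-monoˡ-≤ 1 (ℕ.m≤m+n τ _))
  ... | false = ℕ.≤-trans (ℕ.+-mono-≤ (le x) (anyᵀ-time p xs le)) (ℕ.≤-reflexive (sym (ℕ.+-assoc τ _ 1)))

  appendᵀ-time : ∀ (xs ys : List A) → time (appendᵀ xs ys) ≡ suc (length xs)
  appendᵀ-time []       ys = refl
  appendᵀ-time (x ∷ xs) ys = trans (ℕ.+-comm _ 1) (cong suc (appendᵀ-time xs ys))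

  isNonemptyᵀ-time : ∀ (xs : List A) → time (isNonemptyᵀ xs) ≡ 1
  isNonemptyᵀ-time []      = refl
  isNonemptyᵀ-time (_ ∷ _) = refl

  tabulateᵀ-time : ∀ {n} (f : Fin n → Timed A) {τ} → (∀ i → time (f i) ℕ.≤ τ) → time (tabulateᵀ f) ℕ.≤ n ℕ.* suc τ ℕ.+ 1
  tabulateᵀ-time {n = zero}  f     le = ℕ.≤-refl
  tabulateᵀ-time {n = suc n} f {τ} le = ℕ.≤-trans (ℕ.+-mono-≤ (le Fin.zero) (ℕ.+-monoˡ-≤ 1 (tabulateᵀ-time (f ∘ Fin.suc) (le ∘ Fin.suc))))
    (ℕ.≤-reflexive (regroup τ (n ℕ.* suc τ)))
    where
    regroup : ∀ τ y → τ ℕ.+ (y ℕ.+ 1 ℕ.+ 1) ≡ suc τ ℕ.+ y ℕ.+ 1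
    regroup = solve-∀

∈ᵀ-time : ∀ {n} (v : Fin n) xs → time (v ∈ᵀ xs) ℕ.≤ length xs ℕ.+ 1
∈ᵀ-time v xs = subst (λ l → time (v ∈ᵀ xs) ℕ.≤ l ℕ.+ 1) (ℕ.*-identityʳ (length xs)) (anyᵀ-time (v ≟ᵀ_) xs (λ _ → ℕ.≤-refl))

∖-time : ∀ {n} (xs ys : List (Fin n)) → time (xs ∖ ys) ℕ.≤ length xs ℕ.* (length ys ℕ.+ 3) ℕ.+ 1
∖-time xs ys = ℕ.≤-trans (filterᵀ-time _ {length ys ℕ.+ 1 ℕ.+ 1} xs (λ x → ℕ.+-monoˡ-≤ 1 (∈ᵀ-time x ys)))
  (ℕ.≤-reflexive (cong (λ l → length xs ℕ.* l ℕ.+ 1) (regroup (length ys))))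
  where
  regroup : ∀ l → suc (l ℕ.+ 1 ℕ.+ 1) ≡ l ℕ.+ 3
  regroup = solve-∀

-- Absorbing polynomial factors into powers of one base

module Growth (n : ℕ) (E : ℕ) (1≤E : 1 ℕ.≤ E) where

  -- The factor 100 serves to absorb coefficients, the factor `suc n` to absorb loops over vertices.
  base : ℕ
  base = 100 ℕ.* suc n

  W : ℕ → ℕ
  W i = base ℕ.^ i ℕ.* E

  W-suc : ∀ i → base ℕ.* W i ≡ W (suc i)
  W-suc i = sym (ℕ.*-assoc base (base ℕ.^ i) E)

  1≤W : ∀ i → 1 ℕ.≤ W i
  1≤W i = ℕ.*-mono-≤ (ℕ.m^n>0 base i) 1≤E

  -- The factor k is kept below 100, so that it can be absorbed by
  -- increasing the exponent.
  record Bound (k i x : ℕ) : Set where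
    constructor bound
    field
      holds : x ℕ.≤ k ℕ.* W i

  bound-≤ : ∀ {k i x y} → x ℕ.≤ y → Bound k i y → Bound k i x
  bound-≤ x≤y (bound y≤) = bound (ℕ.≤-trans x≤y y≤)

  bound-const : ∀ k i → Bound k i k
  bound-const k i = bound (ℕ.≤-trans (ℕ.≤-reflexive (sym (ℕ.*-identityʳ k))) (ℕ.*-monoʳ-≤ k (1≤W i)))

  bound-+ : ∀ {k l i x y} → Bound k i x → Bound l i y → Bound (k ℕ.+ l) i (x ℕ.+ y)
  bound-+ {k} {l} {i} (bound x≤) (bound y≤) = bound (ℕ.≤-trans (ℕ.+-mono-≤ x≤ y≤) (ℕ.≤-reflexive (sym (ℕ.*-distribʳ-+ (W i) k l))))

  bound-2* : ∀ {k i x} → Bound k i x → Bound (2 ℕ.* k) i (2 ℕ.* x)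
  bound-2* {k} {i} {x} (bound x≤) = bound (ℕ.≤-trans (ℕ.*-monoʳ-≤ 2 x≤) (ℕ.≤-reflexive (sym (ℕ.*-assoc 2 k (W i)))))

  W≤W : ∀ i → W i ℕ.≤ W (suc i)
  W≤W i = ℕ.≤-trans (ℕ.m≤m+n (W i) _) (ℕ.≤-reflexive (W-suc i))

  bound-lift : ∀ {k i j x} → i ℕ.≤ j → Bound k i x → Bound k j x
  bound-lift {k} {i} i≤j (bound x≤) = bound (ℕ.≤-trans x≤ (ℕ.*-monoʳ-≤ k (W-mono i≤j)))
    where
    go : ∀ d → W i ℕ.≤ W (d ℕ.+ i)
    go zero    = ℕ.≤-refl
    go (suc d) = ℕ.≤-trans (go d) (W≤W (d ℕ.+ i))
    W-mono : ∀ {j} → i ℕ.≤ j → W i ℕ.≤ W j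
    W-mono {j} i≤j = subst (λ m → W i ℕ.≤ W m) (ℕ.m∸n+n≡m i≤j) (go (j ℕ.∸ i))

  bound-raise : ∀ {k i x} → k ℕ.≤ 100 → Bound k i x → Bound 1 (suc i) x
  bound-raise {k} {i} {x} k≤100 (bound x≤) = bound (begin
    x                          ≤⟨ x≤ ⟩
    k ℕ.* W i                  ≤⟨ ℕ.*-monoˡ-≤ (W i) (ℕ.≤-trans k≤100 (ℕ.m≤m*n 100 (suc n))) ⟩
    base ℕ.* W i               ≡⟨ trans (W-suc i) (sym (ℕ.+-identityʳ _)) ⟩
    1 ℕ.* W (suc i)            ∎)
    where open ℕ.≤-Reasoning

  -- The `suc n` in the base pays for at most `n` rounds and for the concluding 1, so a loop costs
  -- one exponent and keeps its coefficient. The coefficient is a successor in order to cover that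
  -- 1.
  bound-loop : ∀ {k i l x} → l ℕ.≤ n → Bound (suc k) i x → Bound (suc k) (suc i) (l ℕ.* x ℕ.+ 1)
  bound-loop {k} {i} {l} {x} l≤n (bound x≤) = bound (begin
    l ℕ.* x ℕ.+ 1                                ≤⟨ ℕ.+-mono-≤ (ℕ.*-mono-≤ l≤n x≤) (ℕ.*-mono-≤ (s≤s (z≤n {k})) (1≤W i)) ⟩
    n ℕ.* (suc k ℕ.* W i) ℕ.+ suc k ℕ.* W i      ≤⟨ ≤-slack (99 ℕ.* (suc n ℕ.* (suc k ℕ.* W i))) (regroup n (suc k) (W i)) ⟩
    suc k ℕ.* (base ℕ.* W i)                     ≡⟨ cong (suc k ℕ.*_) (W-suc i) ⟩
    suc k ℕ.* W (suc i)                          ∎)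
    where
    open ℕ.≤-Reasoning
    regroup : ∀ n k w → (n ℕ.* (k ℕ.* w) ℕ.+ k ℕ.* w) ℕ.+ 99 ℕ.* (suc n ℕ.* (k ℕ.* w)) ≡ k ℕ.* (100 ℕ.* suc n ℕ.* w)
    regroup = solve-∀

  bound-n : ∀ i → Bound 1 (suc i) (suc n)
  bound-n i = bound-≤ (ℕ.≤-reflexive (trans (cong suc (sym (ℕ.*-identityʳ n))) (sym (ℕ.+-comm (n ℕ.* 1) 1))))
    (bound-loop {0} {i} {n} ℕ.≤-refl (bound-const 1 i))

  -- Time is allowed one exponent more than size. This gap is preserved by a product over a list,
  -- which raises both exponents by two.
  record Polynomial-cost (i : ℕ) (x : Timed ℚᵘ) : Set where
    constructor polynomial-cost
    field
      {σ τ}   : ℕ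
      is-cost : Cost σ τ x
      size-≤  : Bound 1 i σ
      time-≤  : Bound 1 (suc i) τ

  module _ {i σ τ l : ℕ} (l≤n : l ℕ.≤ n) (size-≤ : Bound 1 i σ) (time-≤ : Bound 1 (suc i) τ) where

    foldSize-bound : Bound 2 (suc i) (foldSize l σ)
    foldSize-bound = bound-loop l≤n (bound-+ (bound-const 1 i) size-≤)

    foldTime-bound : Bound 8 (suc (suc i)) (foldTime l σ τ)
    foldTime-bound = bound-loop l≤n (bound-+ time-≤ (bound-+ (bound-const 1 (suc i))
      (bound-+ (bound-2* (bound-lift (ℕ.n≤1+n i) size-≤)) (bound-2* foldSize-bound))))

  module _ {A : Set} {i : ℕ} (f : A → Timed ℚᵘ) where

    private
      σ-max τ-max : ℕ
      σ-max = 1 ℕ.* W i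
      τ-max = 1 ℕ.* W (suc i)

    product-polynomial : ∀ xs → length xs ℕ.≤ n → (∀ {x} → x ∈ xs → Polynomial-cost i (f x)) → Polynomial-cost (suc (suc i)) (productᵀ f xs)
    product-polynomial xs l≤n costs = polynomial-cost
      (product-cost {σ = σ-max} {τ-max} f xs λ x∈ → let open Polynomial-cost (costs x∈) in Cost-mono (Bound.holds size-≤) (Bound.holds time-≤) is-cost)
      (bound-raise (ℕ.≤ᵇ⇒≤ 2 100 tt) (foldSize-bound l≤n (bound ℕ.≤-refl) (bound {i = suc i} ℕ.≤-refl)))
      (bound-raise (ℕ.≤ᵇ⇒≤ 8 100 tt) (foldTime-bound l≤n (bound {i = i} ℕ.≤-refl) (bound ℕ.≤-refl)))

loop-step : ∀ {f X r} a → r ℕ.≤ f ℕ.* X ℕ.+ 1 → a ℕ.≤ X → a ℕ.+ r ℕ.≤ suc f ℕ.* X ℕ.+ 1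
loop-step {f} {X} {r} a r≤ a≤ = ℕ.≤-trans (ℕ.+-mono-≤ a≤ r≤) (ℕ.≤-reflexive (sym (ℕ.+-assoc X (f ℕ.* X) 1)))

-- Size and time of the evaluation of Φ

module Timing {n : ℕ} {adjacency : AdjacencyMatrix n} (local : Local adjacency) (tieBreak : TieBreak) where

  open Chains local tieBreak public

  -- One bound for every elementary list operation. The most expensive is a set difference, with at
  -- most n (n + 4) + 1 steps.
  Q : ℕ
  Q = (n ℕ.+ 3) ℕ.* (n ℕ.+ 3)

  N-time : ∀ G v → length G ℕ.≤ n → time (N G v) ℕ.≤ Q
  N-time G v le = begin
    time (N G v)            ≤⟨ filterᵀ-time (adjacentᵀ v) G (λ _ → ℕ.≤-refl) ⟩
    length G ℕ.* 2 ℕ.+ 1    ≤⟨ ℕ.+-monoˡ-≤ 1 (ℕ.*-monoˡ-≤ 2 le) ⟩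
    n ℕ.* 2 ℕ.+ 1           ≤⟨ ≤-slack (n ℕ.* n ℕ.+ 4 ℕ.* n ℕ.+ 8) (regroup n) ⟩
    Q                       ∎
    where
    open ℕ.≤-Reasoning
    regroup : ∀ n → (n ℕ.* 2 ℕ.+ 1) ℕ.+ (n ℕ.* n ℕ.+ 4 ℕ.* n ℕ.+ 8) ≡ (n ℕ.+ 3) ℕ.* (n ℕ.+ 3)
    regroup = solve-∀

  apart-time : ∀ K v → length K ℕ.≤ n → time (filterᵀ (notAdjacentᵀ v) K) ℕ.≤ Q
  apart-time K v le = begin
    time (filterᵀ (notAdjacentᵀ v) K)  ≤⟨ filterᵀ-time (notAdjacentᵀ v) K (λ _ → ℕ.≤-refl) ⟩
    length K ℕ.* 4 ℕ.+ 1               ≤⟨ ℕ.+-monoˡ-≤ 1 (ℕ.*-monoˡ-≤ 4 le) ⟩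
    n ℕ.* 4 ℕ.+ 1                      ≤⟨ ≤-slack (n ℕ.* n ℕ.+ 2 ℕ.* n ℕ.+ 8) (regroup n) ⟩
    Q                                  ∎
    where
    open ℕ.≤-Reasoning
    regroup : ∀ n → (n ℕ.* 4 ℕ.+ 1) ℕ.+ (n ℕ.* n ℕ.+ 2 ℕ.* n ℕ.+ 8) ≡ (n ℕ.+ 3) ℕ.* (n ℕ.+ 3)
    regroup = solve-∀

  difference-time : ∀ (xs ys : List V) → length xs ℕ.≤ n → length ys ℕ.≤ suc n → time (xs ∖ ys) ℕ.≤ Q
  difference-time xs ys le le′ = begin
    time (xs ∖ ys)                              ≤⟨ ∖-time xs ys ⟩
    length xs ℕ.* (length ys ℕ.+ 3) ℕ.+ 1       ≤⟨ ℕ.+-monoˡ-≤ 1 (ℕ.*-mono-≤ le (ℕ.+-monoˡ-≤ 3 le′)) ⟩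
    n ℕ.* (suc n ℕ.+ 3) ℕ.+ 1                   ≤⟨ ≤-slack (2 ℕ.* n ℕ.+ 8) (regroup n) ⟩
    Q                                           ∎
    where
    open ℕ.≤-Reasoning
    regroup : ∀ n → (n ℕ.* (suc n ℕ.+ 3) ℕ.+ 1) ℕ.+ (2 ℕ.* n ℕ.+ 8) ≡ (n ℕ.+ 3) ℕ.* (n ℕ.+ 3)
    regroup = solve-∀

  module _ (σ₁ σ₂ τ₁ τ₂ : ℕ) where

    innerSum-size branch-size node-size innerTerm-time branch-time node-time : ℕ
    innerSum-size  = foldSize 2 σ₂
    branch-size    = σ₁ ℕ.+ suc (1 ℕ.+ (2 ℕ.+ innerSum-size))
    node-size      = suc (1 ℕ.+ foldSize 4 branch-size)
    innerTerm-time = Q ℕ.+ (Q ℕ.+ (Q ℕ.+ τ₂))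
    branch-time    = Q ℕ.+ (Q ℕ.+ (τ₁ ℕ.+ (Q ℕ.+ (Q ℕ.+ (foldTime 2 σ₂ innerTerm-time ℕ.+
      (suc (2 ℕ.* 2 ℕ.+ 2 ℕ.* innerSum-size) ℕ.+
      (suc (2 ℕ.* 1 ℕ.+ 2 ℕ.* (2 ℕ.+ innerSum-size)) ℕ.+
       suc (2 ℕ.* σ₁ ℕ.+ 2 ℕ.* (suc (1 ℕ.+ (2 ℕ.+ innerSum-size)))))))))))
    node-time      = Q ℕ.+ (foldTime 4 branch-size branch-time ℕ.+
      (suc (2 ℕ.* 1 ℕ.+ 2 ℕ.* foldSize 4 branch-size) ℕ.+ suc (2 ℕ.* suc (1 ℕ.+ foldSize 4 branch-size))))

    module _ {Φ₁ Φ₂ : List V → List V → Timed ℚᵘ} {G K : List V} (valid : Valid G K)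
      (cost₁ : ∀ {v} → v ∈ K → Cost σ₁ τ₁ (Φ₁ (G ⊝ K) (nbrs G v ⊝ K)))
      (cost₂ : ∀ {v u} → v ∈ K → u ∈ K → Cost σ₂ τ₂ (Φ₂ ((G ⊝ K) ⊝ (nbrs G v ⊝ K)) ((nbrs G u ⊝ nbrs G v) ⊝ K)))
      where

      open Step Φ₁ Φ₂ G K
      open Valid valid

      private
        G≤n = unique-length !G
        K≤n = unique-length !K
        K≤1+n = ℕ.m≤n⇒m≤1+n K≤n
        nbrs≤n : ∀ v → length (nbrs G v) ℕ.≤ n
        nbrs≤n v = unique-length (nbrs-unique v !G)

      innerTerm-cost : ∀ {v u} → v ∈ K → u ∈ K → Cost σ₂ innerTerm-time (innerTerm ((G ⊝ K) ⊝ (nbrs G v ⊝ K)) (nbrs G v) u)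
      innerTerm-cost {v} {u} v∈K u∈K with cost₂ v∈K u∈K
      ... | cost size le = cost size (ℕ.+-mono-≤ (N-time G u G≤n) (ℕ.+-mono-≤ (difference-time (nbrs G u) (nbrs G v) (nbrs≤n u) (ℕ.m≤n⇒m≤1+n (nbrs≤n v)))
        (ℕ.+-mono-≤ (difference-time (nbrs G u ⊝ nbrs G v) K (ℕ.≤-trans (length-⊝ (nbrs G u) (nbrs G v)) (nbrs≤n u)) K≤1+n) le)))

      branch-cost : ∀ {v} → v ∈ K → Cost branch-size branch-time (term (G ⊝ K) v)
      branch-cost {v} v∈K = cost
        (Size-* φ (1ℚᵘ + ½ * s) size-φ size-r)
        (ℕ.+-mono-≤ (N-time G v G≤n)
        (ℕ.+-mono-≤ (difference-time (nbrs G v) K (nbrs≤n v) K≤1+n)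
        (ℕ.+-mono-≤ (Cost.time-≤ (cost₁ v∈K))
        (ℕ.+-mono-≤ (difference-time (G ⊝ K) (nbrs G v ⊝ K) (ℕ.≤-trans (length-⊝ G K) G≤n) (ℕ.≤-trans (length-⊝ (nbrs G v) K) (ℕ.m≤n⇒m≤1+n (nbrs≤n v))))
        (ℕ.+-mono-≤ (apart-time K v K≤n)
        (ℕ.+-mono-≤ (Cost.time-≤ total)
        (ℕ.+-mono-≤ (arithmetic-time ½ s Size-½ size-s)
        (ℕ.+-mono-≤ (arithmetic-time 1ℚᵘ (½ * s) Size-1 size-h)
                    (arithmetic-time φ (1ℚᵘ + ½ * s) size-φ size-r)))))))))
        where
        us  = value (filterᵀ (notAdjacentᵀ v) K)
        φ   = value (Φ₁ (G ⊝ K) (nbrs G v ⊝ K))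
        sumᵗ = sumᵀ (innerTerm ((G ⊝ K) ⊝ (nbrs G v ⊝ K)) (nbrs G v)) us
        s   = value sumᵗ
        us≤2 = block-apart block !K v∈K
        total : Cost innerSum-size (foldTime 2 σ₂ innerTerm-time) sumᵗ
        total = Cost-mono (foldSize-mono {σ = σ₂} us≤2) (foldTime-mono {σ = σ₂} {innerTerm-time} us≤2)
          (sum-cost (innerTerm ((G ⊝ K) ⊝ (nbrs G v ⊝ K)) (nbrs G v)) us
            (λ u∈ → innerTerm-cost v∈K (proj₁ (∈-filterᵀ⁻ (notAdjacentᵀ v) {xs = K} u∈))))
        size-φ = Cost.size-≤ (cost₁ v∈K)
        size-s = Cost.size-≤ total
        size-h = Size-* ½ s Size-½ size-s
        size-r = Size-+ 1ℚᵘ (½ * s) Size-1 size-h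

      node-cost : Cost node-size node-time step
      node-cost = cost
        (Size-inverse (1ℚᵘ + s) size-r)
        (ℕ.+-mono-≤ (difference-time G K G≤n K≤1+n)
        (ℕ.+-mono-≤ (Cost.time-≤ total)
        (ℕ.+-mono-≤ (arithmetic-time 1ℚᵘ s Size-1 size-s)
                    (s≤s (bits-≤ (1ℚᵘ + s) size-r)))))
        where
        s = value (sumᵀ (term (G ⊝ K)) K)
        K≤4 = block-length block !K
        total : Cost (foldSize 4 branch-size) (foldTime 4 branch-size branch-time) (sumᵀ (term (G ⊝ K)) K)
        total = Cost-mono (foldSize-mono {σ = branch-size} K≤4) (foldTime-mono {σ = branch-size} {branch-time} K≤4)
          (sum-cost (term (G ⊝ K)) K branch-cost)
        size-s = Cost.size-≤ total
        size-r = Size-+ 1ℚᵘ s Size-1 size-s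

  -- The call recurrence x² = 4x + 8 has the root 2 + 2√3, which is less than 6. For sizes, 36 - 24
  -- - 8 = 4 times the prefactor 9 exceeds the additive constant 35. For times, 49 - 28 - 8 = 13
  -- times `4 * Q + 500` exceeds the 41 `Q` for list operations together with the arithmetic on
  -- numbers of size 9 times a power of 6.
  Φ-size Φ-time : ℕ → ℕ
  Φ-size t = 9 ℕ.* 6 ℕ.^ t
  Φ-time t = (4 ℕ.* Q ℕ.+ 500) ℕ.* 7 ℕ.^ t

  6^≤7^ : ∀ t → 6 ℕ.^ t ℕ.≤ 7 ℕ.^ t
  6^≤7^ t = ℕ.^-monoˡ-≤ t (ℕ.≤ᵇ⇒≤ 6 7 tt)

  node-size-linear : ∀ σ₁ σ₂ τ₁ τ₂ → node-size σ₁ σ₂ τ₁ τ₂ ≡ 4 ℕ.* σ₁ ℕ.+ 8 ℕ.* σ₂ ℕ.+ 35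
  node-size-linear σ₁ σ₂ _ _ = regroup σ₁ σ₂
    where
    regroup : ∀ σ₁ σ₂ → suc (1 ℕ.+ (4 ℕ.* suc (σ₁ ℕ.+ suc (1 ℕ.+ (2 ℕ.+ (2 ℕ.* suc σ₂ ℕ.+ 1)))) ℕ.+ 1)) ≡ 4 ℕ.* σ₁ ℕ.+ 8 ℕ.* σ₂ ℕ.+ 35
    regroup = solve-∀

  *-1≤ : ∀ k {x} → 1 ℕ.≤ x → k ℕ.≤ k ℕ.* x
  *-1≤ k 1≤x = ℕ.≤-trans (ℕ.≤-reflexive (sym (ℕ.*-identityʳ k))) (ℕ.*-monoʳ-≤ k 1≤x)

  size-recurrence : ∀ x → 1 ℕ.≤ x → 4 ℕ.* (9 ℕ.* (6 ℕ.* x)) ℕ.+ 8 ℕ.* (9 ℕ.* x) ℕ.+ 35 ℕ.≤ 9 ℕ.* (6 ℕ.* (6 ℕ.* x))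
  size-recurrence x 1≤x = ℕ.≤-trans (ℕ.+-monoʳ-≤ (4 ℕ.* (9 ℕ.* (6 ℕ.* x)) ℕ.+ 8 ℕ.* (9 ℕ.* x)) (*-1≤ 35 1≤x)) (≤-slack x (regroup x))
    where
    regroup : ∀ x → (4 ℕ.* (9 ℕ.* (6 ℕ.* x)) ℕ.+ 8 ℕ.* (9 ℕ.* x) ℕ.+ 35 ℕ.* x) ℕ.+ x ≡ 9 ℕ.* (6 ℕ.* (6 ℕ.* x))
    regroup = solve-∀

  node-size-≤ : ∀ t → node-size (Φ-size (suc t)) (Φ-size t) (Φ-time (suc t)) (Φ-time t) ℕ.≤ Φ-size (suc (suc t))
  node-size-≤ t = ℕ.≤-trans (ℕ.≤-reflexive (node-size-linear (Φ-size (suc t)) (Φ-size t) (Φ-time (suc t)) (Φ-time t)))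
    (size-recurrence (6 ℕ.^ t) (ℕ.m^n>0 6 t))

  node-time-linear : ∀ σ₁ σ₂ τ₁ τ₂ → node-time σ₁ σ₂ τ₁ τ₂ ≡
                     4 ℕ.* τ₁ ℕ.+ 8 ℕ.* τ₂ ℕ.+ 41 ℕ.* Q ℕ.+ 64 ℕ.* σ₁ ℕ.+ 208 ℕ.* σ₂ ℕ.+ 681
  node-time-linear σ₁ σ₂ τ₁ τ₂ = begin
    node-time σ₁ σ₂ τ₁ τ₂
      ≡⟨ outer Q (branch-size σ₁ σ₂ τ₁ τ₂) (branch-time σ₁ σ₂ τ₁ τ₂) ⟩
    Q ℕ.+ 56 ℕ.* branch-size σ₁ σ₂ τ₁ τ₂ ℕ.+ 4 ℕ.* branch-time σ₁ σ₂ τ₁ τ₂ ℕ.+ 73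
      ≡⟨ cong (λ b → Q ℕ.+ 56 ℕ.* branch-size σ₁ σ₂ τ₁ τ₂ ℕ.+ 4 ℕ.* b ℕ.+ 73)
           (trans (middle Q σ₁ s τ₁ (foldTime 2 σ₂ (innerTerm-time σ₁ σ₂ τ₁ τ₂)))
                  (cong (λ f → 4 ℕ.* Q ℕ.+ 2 ℕ.* σ₁ ℕ.+ 6 ℕ.* s ℕ.+ τ₁ ℕ.+ f ℕ.+ 21) (inner Q σ₂ τ₂))) ⟩
    Q ℕ.+ 56 ℕ.* (σ₁ ℕ.+ suc (1 ℕ.+ (2 ℕ.+ s)))
      ℕ.+ 4 ℕ.* (4 ℕ.* Q ℕ.+ 2 ℕ.* σ₁ ℕ.+ 6 ℕ.* s ℕ.+ τ₁ ℕ.+ (6 ℕ.* Q ℕ.+ 12 ℕ.* σ₂ ℕ.+ 2 ℕ.* τ₂ ℕ.+ 15) ℕ.+ 21) ℕ.+ 73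
      ≡⟨ collect Q σ₁ σ₂ τ₁ τ₂ ⟩
    4 ℕ.* τ₁ ℕ.+ 8 ℕ.* τ₂ ℕ.+ 41 ℕ.* Q ℕ.+ 64 ℕ.* σ₁ ℕ.+ 208 ℕ.* σ₂ ℕ.+ 681 ∎
    where
    open ≡-Reasoning
    s = 2 ℕ.* suc σ₂ ℕ.+ 1
    outer : ∀ Q b t →
      Q ℕ.+ ((4 ℕ.* (t ℕ.+ suc (2 ℕ.* b ℕ.+ 2 ℕ.* (4 ℕ.* suc b ℕ.+ 1))) ℕ.+ 1) ℕ.+
        (suc (2 ℕ.* 1 ℕ.+ 2 ℕ.* (4 ℕ.* suc b ℕ.+ 1)) ℕ.+ suc (2 ℕ.* suc (1 ℕ.+ (4 ℕ.* suc b ℕ.+ 1)))))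
      ≡ Q ℕ.+ 56 ℕ.* b ℕ.+ 4 ℕ.* t ℕ.+ 73
    outer = solve-∀
    middle : ∀ Q σ₁ s τ₁ f →
      Q ℕ.+ (Q ℕ.+ (τ₁ ℕ.+ (Q ℕ.+ (Q ℕ.+ (f ℕ.+ (suc (2 ℕ.* 2 ℕ.+ 2 ℕ.* s) ℕ.+
        (suc (2 ℕ.* 1 ℕ.+ 2 ℕ.* (2 ℕ.+ s)) ℕ.+ suc (2 ℕ.* σ₁ ℕ.+ 2 ℕ.* suc (1 ℕ.+ (2 ℕ.+ s))))))))))
      ≡ 4 ℕ.* Q ℕ.+ 2 ℕ.* σ₁ ℕ.+ 6 ℕ.* s ℕ.+ τ₁ ℕ.+ f ℕ.+ 21
    middle = solve-∀
    inner : ∀ Q σ₂ τ₂ →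
      2 ℕ.* ((Q ℕ.+ (Q ℕ.+ (Q ℕ.+ τ₂))) ℕ.+ suc (2 ℕ.* σ₂ ℕ.+ 2 ℕ.* (2 ℕ.* suc σ₂ ℕ.+ 1))) ℕ.+ 1
      ≡ 6 ℕ.* Q ℕ.+ 12 ℕ.* σ₂ ℕ.+ 2 ℕ.* τ₂ ℕ.+ 15
    inner = solve-∀
    collect : ∀ Q σ₁ σ₂ τ₁ τ₂ →
      Q ℕ.+ 56 ℕ.* (σ₁ ℕ.+ suc (1 ℕ.+ (2 ℕ.+ (2 ℕ.* suc σ₂ ℕ.+ 1))))
        ℕ.+ 4 ℕ.* (4 ℕ.* Q ℕ.+ 2 ℕ.* σ₁ ℕ.+ 6 ℕ.* (2 ℕ.* suc σ₂ ℕ.+ 1) ℕ.+ τ₁ ℕ.+ (6 ℕ.* Q ℕ.+ 12 ℕ.* σ₂ ℕ.+ 2 ℕ.* τ₂ ℕ.+ 15) ℕ.+ 21) ℕ.+ 73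
      ≡ 4 ℕ.* τ₁ ℕ.+ 8 ℕ.* τ₂ ℕ.+ 41 ℕ.* Q ℕ.+ 64 ℕ.* σ₁ ℕ.+ 208 ℕ.* σ₂ ℕ.+ 681
    collect = solve-∀

  time-recurrence : ∀ x z → 1 ℕ.≤ z → z ℕ.≤ x →
    4 ℕ.* ((4 ℕ.* Q ℕ.+ 500) ℕ.* (7 ℕ.* x)) ℕ.+ 8 ℕ.* ((4 ℕ.* Q ℕ.+ 500) ℕ.* x) ℕ.+ 41 ℕ.* Q
      ℕ.+ 64 ℕ.* (9 ℕ.* (6 ℕ.* z)) ℕ.+ 208 ℕ.* (9 ℕ.* z) ℕ.+ 681
    ℕ.≤ (4 ℕ.* Q ℕ.+ 500) ℕ.* (7 ℕ.* (7 ℕ.* x))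
  -- Writing `x` as `z + w` turns the inequality into a polynomial identity with an explicit slack.
  time-recurrence x z 1≤z z≤x with ℕ.m≤n⇒∃[o]m+o≡n z≤x
  ... | w , refl = ℕ.≤-trans
    (ℕ.+-mono-≤ (ℕ.+-monoˡ-≤ (208 ℕ.* (9 ℕ.* z)) (ℕ.+-monoˡ-≤ (64 ℕ.* (9 ℕ.* (6 ℕ.* z)))
      (ℕ.+-monoʳ-≤ (4 ℕ.* (D ℕ.* (7 ℕ.* (z ℕ.+ w))) ℕ.+ 8 ℕ.* (D ℕ.* (z ℕ.+ w))) (*-1≤ (41 ℕ.* Q) 1≤z)))) (*-1≤ 681 1≤z))
    (≤-slack (13 ℕ.* D ℕ.* w ℕ.+ 11 ℕ.* Q ℕ.* z ℕ.+ 491 ℕ.* z) (regroup Q z w))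
    where
    D = 4 ℕ.* Q ℕ.+ 500
    regroup : ∀ Q z w →
      (4 ℕ.* ((4 ℕ.* Q ℕ.+ 500) ℕ.* (7 ℕ.* (z ℕ.+ w))) ℕ.+ 8 ℕ.* ((4 ℕ.* Q ℕ.+ 500) ℕ.* (z ℕ.+ w)) ℕ.+ 41 ℕ.* Q ℕ.* z
        ℕ.+ 64 ℕ.* (9 ℕ.* (6 ℕ.* z)) ℕ.+ 208 ℕ.* (9 ℕ.* z) ℕ.+ 681 ℕ.* z)
      ℕ.+ (13 ℕ.* (4 ℕ.* Q ℕ.+ 500) ℕ.* w ℕ.+ 11 ℕ.* Q ℕ.* z ℕ.+ 491 ℕ.* z)
      ≡ (4 ℕ.* Q ℕ.+ 500) ℕ.* (7 ℕ.* (7 ℕ.* (z ℕ.+ w)))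
    regroup = solve-∀

  node-time-≤ : ∀ t → node-time (Φ-size (suc t)) (Φ-size t) (Φ-time (suc t)) (Φ-time t) ℕ.≤ Φ-time (suc (suc t))
  node-time-≤ t = ℕ.≤-trans (ℕ.≤-reflexive (node-time-linear (Φ-size (suc t)) (Φ-size t) (Φ-time (suc t)) (Φ-time t)))
    (time-recurrence (7 ℕ.^ t) (6 ℕ.^ t) (ℕ.m^n>0 6 t) (6^≤7^ t))

  Φ-Cost : ℕ → Set
  Φ-Cost t = ∀ {G K} → Valid G K → Cost (Φ-size t) (Φ-time t) (Φ G K t)

  unit-cost : ∀ t → Cost (Φ-size t) (Φ-time t) (return 1ℚᵘ)
  unit-cost t = cost (Size-mono (ℕ.*-mono-≤ (s≤s (z≤n {8})) (ℕ.m^n>0 6 t)) Size-1)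
    (ℕ.*-mono-≤ (ℕ.≤-trans (ℕ.≤ᵇ⇒≤ 1 500 tt) (ℕ.m≤n+m 500 (4 ℕ.* Q))) (ℕ.m^n>0 7 t))

  Φ-step-cost : ∀ t → Φ-Cost (suc t) → Φ-Cost t → Φ-Cost (suc (suc t))
  Φ-step-cost t ih₁ ih₂ {G} {[]}    valid = unit-cost (suc (suc t))
  Φ-step-cost t ih₁ ih₂ {G} {_ ∷ _} valid = Cost-mono (node-size-≤ t) (node-time-≤ t)
    (node-cost (Φ-size (suc t)) (Φ-size t) (Φ-time (suc t)) (Φ-time t) {λ G′ K′ → Φ G′ K′ (suc t)} {λ G′ K′ → Φ G′ K′ t} valid
      (λ v∈ → ih₁ (valid-next valid v∈)) (λ v∈ u∈ → ih₂ (valid-next₂ valid v∈ u∈)))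

  Φ-cost : ∀ t → Φ-Cost t
  Φ-cost 0             valid = unit-cost 0
  Φ-cost 1             valid = unit-cost 1
  Φ-cost (suc (suc t))       = Φ-step-cost t (Φ-cost (suc t)) (Φ-cost t)

-- Running time of the algorithm

module TotalTime {n : ℕ} {adjacency : AdjacencyMatrix n} (local : Local adjacency) (tieBreak : TieBreak) (t : ℕ) where

  open Timing local tieBreak public
  open Growth n (7 ℕ.^ t) (ℕ.m^n>0 7 t) public

  private
    instance
      E≢0 : ℕ.NonZero (7 ℕ.^ t)
      E≢0 = ℕ.m^n≢0 7 t

    D = 4 ℕ.* Q ℕ.+ 500
    σ = Φ-size t
    τ = Φ-time t

  D≤base² : D ℕ.≤ base ℕ.* base
  D≤base² = begin
    4 ℕ.* Q ℕ.+ 500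
      ≤⟨ ℕ.+-mono-≤ (ℕ.*-monoʳ-≤ 4 (ℕ.*-mono-≤ n+3≤ n+3≤)) (*-1≤ 500 (s≤s (z≤n {n ℕ.+ n ℕ.* suc n}))) ⟩
    4 ℕ.* (3 ℕ.* suc n ℕ.* (3 ℕ.* suc n)) ℕ.+ 500 ℕ.* (suc n ℕ.* suc n)
      ≤⟨ ≤-slack (9464 ℕ.* (suc n ℕ.* suc n)) (regroup (suc n)) ⟩
    base ℕ.* base ∎
    where
    open ℕ.≤-Reasoning
    n+3≤ : n ℕ.+ 3 ℕ.≤ 3 ℕ.* suc n
    n+3≤ = ≤-slack (2 ℕ.* n) (eq n)
      where
      eq : ∀ n → n ℕ.+ 3 ℕ.+ 2 ℕ.* n ≡ 3 ℕ.* suc n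
      eq = solve-∀
    regroup : ∀ N → (4 ℕ.* (3 ℕ.* N ℕ.* (3 ℕ.* N)) ℕ.+ 500 ℕ.* (N ℕ.* N)) ℕ.+ 9464 ℕ.* (N ℕ.* N) ≡ 100 ℕ.* N ℕ.* (100 ℕ.* N)
    regroup = solve-∀

  τ-bound : Bound 1 2 τ
  τ-bound = bound (ℕ.≤-trans (ℕ.*-monoˡ-≤ (7 ℕ.^ t) D≤base²)
    (ℕ.≤-reflexive (trans (cong (λ b → base ℕ.* b ℕ.* 7 ℕ.^ t) (sym (ℕ.*-identityʳ base))) (sym (ℕ.*-identityˡ (W 2))))))

  Q-bound : Bound 1 2 Q
  Q-bound = bound-≤ (ℕ.≤-trans (ℕ.≤-trans (ℕ.m≤n*m Q 4) (ℕ.m≤m+n (4 ℕ.* Q) 500)) (ℕ.m≤m*n D (7 ℕ.^ t))) τ-bound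

  σ-bound : Bound 9 0 σ
  σ-bound = bound (ℕ.*-monoʳ-≤ 9 (ℕ.≤-trans (6^≤7^ t) (ℕ.≤-reflexive (sym (ℕ.*-identityˡ (7 ℕ.^ t))))))

  grow-step : ℕ
  grow-step = Q ℕ.+ (Q ℕ.+ (suc n ℕ.+ 1))

  grow-time : ∀ fuel S R → length R ℕ.≤ n → time (grow fuel S R) ℕ.≤ fuel ℕ.* grow-step ℕ.+ 1
  grow-time zero       S       R R≤n = ℕ.≤-refl
  grow-time (suc fuel) []      R R≤n = ℕ.m≤n+m 1 (suc fuel ℕ.* grow-step)
  grow-time (suc fuel) (v ∷ S) R R≤n = ℕ.≤-trans (ℕ.≤-reflexive (regroup (time (N R v)) (time (R ∖ new)) (time (appendᵀ new S)) (time (grow fuel (value (appendᵀ new S)) (R ⊝ new)))))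
    (loop-step {fuel} {grow-step} _ (grow-time fuel (value (appendᵀ new S)) (R ⊝ new) (ℕ.≤-trans (length-⊝ R new) R≤n))
      (ℕ.+-mono-≤ (N-time R v R≤n) (ℕ.+-mono-≤ (difference-time R new R≤n (ℕ.m≤n⇒m≤1+n new≤n))
        (ℕ.+-monoˡ-≤ 1 (ℕ.≤-trans (ℕ.≤-reflexive (appendᵀ-time new S)) (s≤s new≤n))))))
    where
    new = nbrs R v
    new≤n = ℕ.≤-trans (length-nbrs R v) R≤n
    regroup : ∀ a b c r → a ℕ.+ (b ℕ.+ (c ℕ.+ (r ℕ.+ 1))) ≡ (a ℕ.+ (b ℕ.+ (c ℕ.+ 1))) ℕ.+ r
    regroup = solve-∀

  grow-rest-length : ∀ fuel S R → length (proj₂ (value (grow fuel S R))) ℕ.≤ length R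
  grow-rest-length zero       S       R = ℕ.≤-refl
  grow-rest-length (suc fuel) []      R = ℕ.≤-refl
  grow-rest-length (suc fuel) (v ∷ S) R =
    ℕ.≤-trans (grow-rest-length fuel (value (appendᵀ (nbrs R v) S)) (R ⊝ nbrs R v)) (length-⊝ R (nbrs R v))

  component-time components-max : ℕ
  component-time = (n ℕ.* grow-step ℕ.+ 1) ℕ.+ 1
  components-max = n ℕ.* component-time ℕ.+ 1

  componentsFrom-time : ∀ fuel G → length G ℕ.≤ n → time (componentsFrom fuel G) ℕ.≤ fuel ℕ.* component-time ℕ.+ 1
  componentsFrom-time zero       G       le = ℕ.≤-refl
  componentsFrom-time (suc fuel) []      le = ℕ.m≤n+m 1 (suc fuel ℕ.* component-time)
  componentsFrom-time (suc fuel) (v ∷ G) le = ℕ.≤-trans (ℕ.≤-reflexive (regroup (time (grow n (v ∷ []) G)) (time (componentsFrom fuel (proj₂ (value (grow n (v ∷ []) G)))))))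
    (loop-step {fuel} {component-time} _
      (componentsFrom-time fuel (proj₂ (value (grow n (v ∷ []) G))) (ℕ.≤-trans (grow-rest-length n (v ∷ []) G) G≤n))
      (ℕ.+-monoˡ-≤ 1 (grow-time n (v ∷ []) G G≤n)))
    where
    G≤n = ℕ.≤-trans (ℕ.n≤1+n _) le
    regroup : ∀ a r → a ℕ.+ (r ℕ.+ 1) ≡ (a ℕ.+ 1) ℕ.+ r
    regroup = solve-∀

  components-time : ∀ {G} → length G ℕ.≤ n → time (components G) ℕ.≤ components-max
  components-time {G} = componentsFrom-time n G

  componentsFrom-length : ∀ fuel G → length (value (componentsFrom fuel G)) ℕ.≤ fuel
  componentsFrom-length zero       G       = z≤n
  componentsFrom-length (suc fuel) []      = z≤n
  componentsFrom-length (suc fuel) (v ∷ G) = s≤s (componentsFrom-length fuel (proj₂ (value (grow n (v ∷ []) G))))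

  isConnected-time : ∀ G → time (isConnected G) ℕ.≤ time (components G) ℕ.+ 1
  isConnected-time G with value (components G)
  ... | []          = ℕ.≤-refl
  ... | _ ∷ []      = ℕ.≤-refl
  ... | _ ∷ _ ∷ _   = ℕ.≤-refl

  pick-time : ∀ xs → time (pick tieBreak xs) ≡ 1
  pick-time []      = refl
  pick-time (_ ∷ _) = refl

  frontier-time partition-step : ℕ
  frontier-time  = n ℕ.* suc (Q ℕ.+ 1) ℕ.+ 1
  partition-step = frontier-time ℕ.+ (1 ℕ.+ (Q ℕ.+ (Q ℕ.+ (suc n ℕ.+ 1))))

  hasNeighbour-time : ∀ R L → length R ℕ.≤ n → length L ℕ.≤ n → time (filterᵀ (hasNeighbourᵀ R) L) ℕ.≤ frontier-time
  hasNeighbour-time R L R≤n L≤n = ℕ.≤-trans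
    (filterᵀ-time (hasNeighbourᵀ R) {Q ℕ.+ 1} L λ v → ℕ.+-mono-≤ (N-time R v R≤n) (ℕ.≤-reflexive (isNonemptyᵀ-time (nbrs R v))))
    (ℕ.+-monoˡ-≤ 1 (ℕ.*-monoˡ-≤ (suc (Q ℕ.+ 1)) L≤n))

  partition-time : ∀ fuel S R → Unique R → length S ℕ.+ length R ℕ.≤ n →
                   time (partitionFrom tieBreak fuel S R) ℕ.≤ fuel ℕ.* partition-step ℕ.+ 1
  partition-time zero       S R         !R le = ℕ.≤-refl
  partition-time (suc fuel) S []        !R le = ℕ.m≤n+m 1 (suc fuel ℕ.* partition-step)
  partition-time (suc fuel) S R@(_ ∷ _) !R le
    with value (filterᵀ (hasNeighbourᵀ R) S) | hasNeighbour-time R S R≤n S≤n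
    where
    S≤n = ℕ.≤-trans (ℕ.m≤m+n (length S) (length R)) le
    R≤n = ℕ.≤-trans (ℕ.m≤n+m (length R) (length S)) le
  -- Connectivity is not assumed here, so the search ending without a candidate has to be covered by
  -- the bound as well.
  ... | []     | filter≤ = ℕ.≤-trans (ℕ.≤-trans (ℕ.+-mono-≤ filter≤ (ℕ.m≤m+n 2 (Q ℕ.+ (Q ℕ.+ (n ℕ.+ 1))))) (ℕ.≤-reflexive regroup))
      (ℕ.≤-trans (ℕ.m≤m+n partition-step (fuel ℕ.* partition-step)) (ℕ.m≤m+n _ 1))
    where
    regroup : frontier-time ℕ.+ (2 ℕ.+ (Q ℕ.+ (Q ℕ.+ (n ℕ.+ 1)))) ≡ partition-step
    regroup = eq frontier-time Q n
      where
      eq : ∀ f Q n → f ℕ.+ (2 ℕ.+ (Q ℕ.+ (Q ℕ.+ (n ℕ.+ 1)))) ≡ f ℕ.+ (1 ℕ.+ (Q ℕ.+ (Q ℕ.+ (suc n ℕ.+ 1))))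
      eq = solve-∀
  ... | v′ ∷ vs | filter≤ = ℕ.≤-trans (ℕ.≤-reflexive (regroup (time (filterᵀ (hasNeighbourᵀ R) S)) (time (N R v)) (time (R ∖ K)) (time (appendᵀ S K))
      (time (partitionFrom tieBreak fuel (value (appendᵀ S K)) (R ⊝ K)))))
    (loop-step {fuel} {partition-step} _ recursive
      (ℕ.+-mono-≤ filter≤ (s≤s (ℕ.+-mono-≤ (N-time R v R≤n) (ℕ.+-mono-≤ (difference-time R K R≤n (ℕ.m≤n⇒m≤1+n (ℕ.≤-trans (length-nbrs R v) R≤n)))
        (ℕ.+-monoˡ-≤ 1 (ℕ.≤-trans (ℕ.≤-reflexive (appendᵀ-time S K)) (s≤s S≤n))))))))
    where
    S≤n = ℕ.≤-trans (ℕ.m≤m+n (length S) (length R)) le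
    R≤n = ℕ.≤-trans (ℕ.m≤n+m (length R) (length S)) le
    v = TieBreak.select tieBreak (v′ ∷ vs)
    K = nbrs R v
    recursive : time (partitionFrom tieBreak fuel (value (appendᵀ S K)) (R ⊝ K)) ℕ.≤ fuel ℕ.* partition-step ℕ.+ 1
    recursive = partition-time fuel (value (appendᵀ S K)) (R ⊝ K) (⊝-unique K !R) (ℕ.≤-trans (ℕ.≤-reflexive lengths) le)
      where
      lengths : length (value (appendᵀ S K)) ℕ.+ length (R ⊝ K) ≡ length S ℕ.+ length R
      lengths = trans (cong (λ L → length L ℕ.+ length (R ⊝ K)) (value-appendᵀ S K))
        (trans (cong (ℕ._+ length (R ⊝ K)) (List.length-++ S)) (trans (ℕ.+-assoc (length S) _ _)
        (cong (length S ℕ.+_) (trans (sym (List.length-++ K)) (↭.↭-length (nbrs-⊝-↭ v !R))))))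
    regroup : ∀ f a b c r → f ℕ.+ (1 ℕ.+ (a ℕ.+ (b ℕ.+ (c ℕ.+ (r ℕ.+ 1))))) ≡ (f ℕ.+ (1 ℕ.+ (a ℕ.+ (b ℕ.+ (c ℕ.+ 1))))) ℕ.+ r
    regroup = solve-∀

  divide-step : ℕ → ℕ
  divide-step S = τ ℕ.+ (suc (2 ℕ.* σ) ℕ.+ (suc (2 ℕ.* S ℕ.+ 2 ℕ.* σ) ℕ.+ Q))

  -- `S` bounds the size of the running value over all rounds, so that each round is charged the
  -- same amount although the value grows.
  divide-cost : ∀ {F Ks s z} S → Chain F Ks → Size s z → s ℕ.+ length Ks ℕ.* σ ℕ.≤ S →
    Cost (s ℕ.+ length Ks ℕ.* σ) (length Ks ℕ.* divide-step S ℕ.+ 1) (divideByΦs tieBreak t z F Ks)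
  divide-cost {s = s} S [] size-z _ = cost (Size-mono (ℕ.m≤m+n s 0) size-z) ℕ.≤-refl
  divide-cost {F} {K ∷ Ks} {s} {z} S (add valid x∈K chain) size-z le = cost
    (Size-mono (ℕ.≤-reflexive (ℕ.+-assoc s σ _)) (Cost.size-≤ rest))
    (ℕ.≤-trans (ℕ.≤-reflexive (regroup (time (Φ F K t)) (suc (bits φ)) (suc (bits z ℕ.+ bits (inverse φ))) (time (F ∖ K))
        (time (divideByΦs tieBreak t (z * inverse φ) (F ⊝ K) Ks))))
      (loop-step {length Ks} {divide-step S} _ (Cost.time-≤ rest)
        (ℕ.+-mono-≤ (Cost.time-≤ φ-cost) (ℕ.+-mono-≤ (s≤s (bits-≤ φ (Cost.size-≤ φ-cost)))
          (ℕ.+-mono-≤ (ℕ.≤-trans (arithmetic-time z (inverse φ) size-z (Size-inverse φ (Cost.size-≤ φ-cost)))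
            (s≤s (ℕ.+-monoˡ-≤ (2 ℕ.* σ) (ℕ.*-monoʳ-≤ 2 (ℕ.≤-trans (ℕ.m≤m+n s _) le)))))
            (difference-time F K (unique-length !G) (ℕ.m≤n⇒m≤1+n (unique-length !K))))))))
    where
    open Valid valid
    φ = value (Φ F K t)
    φ-cost = Φ-cost t valid
    rest : Cost (s ℕ.+ σ ℕ.+ length Ks ℕ.* σ) (length Ks ℕ.* divide-step S ℕ.+ 1) (divideByΦs tieBreak t (z * inverse φ) (F ⊝ K) Ks)
    rest = divide-cost S chain (Size-* z (inverse φ) size-z (Size-inverse φ (Cost.size-≤ φ-cost)))
      (ℕ.≤-trans (ℕ.≤-reflexive (ℕ.+-assoc s σ _)) le)
    regroup : ∀ a b c d r → a ℕ.+ (b ℕ.+ (c ℕ.+ (d ℕ.+ r))) ≡ (a ℕ.+ (b ℕ.+ (c ℕ.+ d))) ℕ.+ r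
    regroup = solve-∀

  lift : ∀ {k i x} j → Bound k i x → Bound k (j ℕ.+ i) x
  lift {i = i} j = bound-lift (ℕ.m≤n+m i j)

  one : ∀ i → Bound 1 i 1
  one = bound-const 1

  frontier-bound : Bound 3 3 frontier-time
  frontier-bound = bound-loop ℕ.≤-refl (bound-+ (one 2) (bound-+ Q-bound (one 2)))

  partition-bound : Bound 8 4 (n ℕ.* partition-step ℕ.+ 1)
  partition-bound = bound-loop ℕ.≤-refl (bound-+ frontier-bound (bound-+ (one 3) (bound-+ (lift 1 Q-bound) (bound-+ (lift 1 Q-bound)
    (bound-+ (bound-n 2) (one 3))))))

  countIS-polynomial : ∀ {G K x} → Valid G K → x ∈ K → Connected G → Polynomial-cost 4 (countIS tieBreak G K t)
  countIS-polynomial {G} {K} valid x∈K conn = polynomial-cost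
    (cost (Cost.size-≤ division)
      (ℕ.+-mono-≤ (difference-time G K (unique-length !G) (ℕ.m≤n⇒m≤1+n (unique-length !K)))
      (ℕ.+-mono-≤ (partition-time n K (G ⊝ K) (⊝-unique K !G) K+rest≤n) (Cost.time-≤ division))))
    (lift 2 S-bound)
    (bound-raise (ℕ.≤ᵇ⇒≤ _ _ tt) (bound-+ (lift 2 Q-bound) (bound-+ partition-bound (lift 1 (bound-loop l≤n step-bound)))))
    where
    open Valid valid
    Ks    = blocks-of G K
    chain = blocks-chain valid x∈K conn
    l≤n   = ℕ.≤-trans (chain-length chain) (unique-length !G)
    S     = 1 ℕ.+ length Ks ℕ.* σ
    division : Cost S (length Ks ℕ.* divide-step S ℕ.+ 1) (divideByΦs tieBreak t 1ℚᵘ G Ks)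
    division = divide-cost S chain Size-1 ℕ.≤-refl
    S-bound : Bound 1 2 S
    S-bound = bound-≤ (ℕ.≤-reflexive (ℕ.+-comm 1 _)) (bound-raise (ℕ.≤ᵇ⇒≤ _ _ tt) (bound-loop l≤n σ-bound))
    step-bound : Bound 42 2 (divide-step S)
    step-bound = bound-+ τ-bound (bound-+ (bound-+ (one 2) (bound-2* (lift 2 σ-bound)))
      (bound-+ (bound-+ (one 2) (bound-+ (bound-2* S-bound) (bound-2* (lift 2 σ-bound)))) Q-bound))
    K+rest≤n : length K ℕ.+ length (G ⊝ K) ℕ.≤ n
    K+rest≤n = ℕ.≤-trans (ℕ.≤-reflexive (trans (sym (List.length-++ K)) (↭.↭-length (++-⊝-↭ !G !K K⊆G)))) (unique-length !G)

  countComponent-polynomial : ∀ {F v C} → Unique F → Connected F → v ∈ F → Component (remote F v) C →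
                              Polynomial-cost 5 (countComponent tieBreak (nbrs F v) t C)
  countComponent-polynomial {F} {v} {C} !F conn v∈F comp =
    let (u , x , picked , valid , x∈K) = attachment !F conn v∈F comp
        (value≡ , time≡) = countComponent-picked t (nbrs F v) C picked
        open Polynomial-cost (countIS-polynomial valid x∈K (Component.connected comp)) hiding (σ; τ)
    in polynomial-cost
      (cost (subst (Size _) (sym value≡) (Cost.size-≤ is-cost))
        (ℕ.≤-trans (ℕ.≤-reflexive time≡) (ℕ.+-mono-≤ (hasNeighbour-time C (nbrs F v) C≤n N≤n)
          (ℕ.+-mono-≤ (ℕ.≤-reflexive (pick-time (value (filterᵀ (hasNeighbourᵀ C) (nbrs F v))))) (ℕ.+-mono-≤ (N-time C u C≤n) (Cost.time-≤ is-cost))))))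
      (lift 1 size-≤)
      (bound-raise (ℕ.≤ᵇ⇒≤ _ _ tt) (bound-+ (lift 2 frontier-bound) (bound-+ (one 5) (bound-+ (lift 3 Q-bound) time-≤))))
    where
    C≤n = unique-length (Component.unique comp)
    N≤n = unique-length (nbrs-unique v !F)

  components-bound : Bound 5 4 components-max
  components-bound = bound-loop ℕ.≤-refl (bound-+ (bound-loop ℕ.≤-refl (bound-+ Q-bound (bound-+ Q-bound (bound-+ (bound-n 1) (one 2))))) (one 3))

  increment-polynomial : ∀ {F v} → Unique F → Connected F → v ∈ F → Polynomial-cost 8 (increment tieBreak F v t)
  increment-polynomial {F} {v} !F conn v∈F =
    let (value≡ , time≤) = increment-components t F v
        open Polynomial-cost product hiding (σ; τ)
    in polynomial-cost
      (cost (subst (Size _) (sym value≡) (Cost.size-≤ is-cost))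
        (ℕ.≤-trans time≤ (ℕ.+-mono-≤ (N-time F v (unique-length !F)) (ℕ.+-mono-≤ (difference-time F (v ∷ nbrs F v) (unique-length !F) (s≤s (unique-length (nbrs-unique v !F))))
          (s≤s (ℕ.+-mono-≤ (components-time (unique-length !remote)) (Cost.time-≤ is-cost)))))))
      (lift 1 size-≤)
      (bound-raise (ℕ.≤ᵇ⇒≤ _ _ tt) (bound-+ (lift 6 Q-bound) (bound-+ (lift 6 Q-bound) (bound-+ (one 8) (bound-+ (lift 4 components-bound) time-≤)))))
    where
    !remote = ⊝-unique (v ∷ nbrs F v) !F
    product = product-polynomial (countComponent tieBreak (nbrs F v) t) (value (components (remote F v)))
      (componentsFrom-length n (remote F v))
      (λ C∈ → countComponent-polynomial !F conn v∈F (All.lookup (components-all !remote (components-spec !remote)) C∈))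

  -- Bounds that hold for all `F` and `v` alike, so that every round of the main loop can be charged
  -- the same amount.
  σᵢ τᵢ removable-time : ℕ
  σᵢ = 1 ℕ.* W 8
  τᵢ = 1 ℕ.* W 9
  removable-time = n ℕ.* suc (Q ℕ.+ (components-max ℕ.+ 1)) ℕ.+ 1

  increment-cost : ∀ {F v} → Unique F → Connected F → v ∈ F → Cost σᵢ τᵢ (increment tieBreak F v t)
  increment-cost !F conn v∈F = Cost-mono (Bound.holds size-≤) (Bound.holds time-≤) is-cost
    where open Polynomial-cost (increment-polynomial !F conn v∈F) hiding (σ; τ)

  loop-iteration : ℕ → ℕ
  loop-iteration S = removable-time ℕ.+ (1 ℕ.+ (τᵢ ℕ.+ (suc (2 ℕ.* S ℕ.+ 2 ℕ.* σᵢ) ℕ.+ Q)))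

  countLoop-cost : ∀ fuel {F z s} S → Unique F → Connected F → Size s z → s ℕ.+ fuel ℕ.* suc σᵢ ℕ.≤ S →
    Cost (s ℕ.+ fuel ℕ.* suc σᵢ) (fuel ℕ.* loop-iteration S ℕ.+ 1) (countLoop tieBreak fuel z F t)
  countLoop-cost zero       {s = s} S !F conn size-z _ = cost (Size-mono (ℕ.m≤m+n s 0) size-z) ℕ.≤-refl
  countLoop-cost (suc fuel) {[]} {s = s} S !F conn size-z _ =
    cost (Size-mono (ℕ.m≤m+n s _) size-z) (ℕ.m≤n+m 1 (suc fuel ℕ.* loop-iteration S))
  countLoop-cost (suc fuel) {F@(x ∷ xs)} {z} {s} S !F conn size-z le =
    let (v , v∈F , conn-v , picked) = removal !F conn (here refl)
        (value≡ , time≡) = countLoop-picked t fuel z x xs picked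
        inc  = increment-cost !F conn v∈F
        rest = countLoop-cost fuel S (⊝-unique (v ∷ []) !F) conn-v (Size-+ z (value (increment tieBreak F v t)) size-z (Cost.size-≤ inc))
                 (ℕ.≤-trans (ℕ.≤-reflexive (sizes s σᵢ (fuel ℕ.* suc σᵢ))) le)
    in cost (Size-mono (ℕ.≤-reflexive (sizes s σᵢ (fuel ℕ.* suc σᵢ))) (subst (Size _) (sym value≡) (Cost.size-≤ rest)))
      (ℕ.≤-trans (ℕ.≤-reflexive (trans time≡ (regroup (time (filterᵀ (removableᵀ F) F)) (time (pick tieBreak (removable F))) (time (increment tieBreak F v t))
        (suc (bits z ℕ.+ bits (value (increment tieBreak F v t)))) (time (F ∖ (v ∷ [])))
        (time (countLoop tieBreak fuel (z + value (increment tieBreak F v t)) (F ⊝ (v ∷ [])) t)))))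
        (loop-step {fuel} {loop-iteration S} _ (Cost.time-≤ rest)
          (ℕ.+-mono-≤ (filter-time F (unique-length !F)) (ℕ.+-mono-≤ (ℕ.≤-reflexive (pick-time (removable F))) (ℕ.+-mono-≤ (Cost.time-≤ inc)
            (ℕ.+-mono-≤ (ℕ.≤-trans (arithmetic-time z (value (increment tieBreak F v t)) size-z (Cost.size-≤ inc))
              (s≤s (ℕ.+-monoˡ-≤ (2 ℕ.* σᵢ) (ℕ.*-monoʳ-≤ 2 (ℕ.≤-trans (ℕ.m≤m+n s _) le)))))
              (difference-time F (v ∷ []) (unique-length !F) (s≤s z≤n))))))))
    where
    filter-time : ∀ F → length F ℕ.≤ n → time (filterᵀ (removableᵀ F) F) ℕ.≤ removable-time
    filter-time F F≤n = ℕ.≤-trans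
      (filterᵀ-time (removableᵀ F) {Q ℕ.+ (components-max ℕ.+ 1)} F λ v → ℕ.+-mono-≤ (difference-time F (v ∷ []) F≤n (s≤s z≤n))
        (ℕ.≤-trans (isConnected-time (F ⊝ (v ∷ []))) (ℕ.+-monoˡ-≤ 1 (components-time (ℕ.≤-trans (length-⊝ F (v ∷ [])) F≤n)))))
      (ℕ.+-monoˡ-≤ 1 (ℕ.*-monoˡ-≤ _ F≤n))
    sizes : ∀ s σ y → suc (s ℕ.+ σ) ℕ.+ y ≡ s ℕ.+ (suc σ ℕ.+ y)
    sizes = solve-∀
    regroup : ∀ f p i a d r → f ℕ.+ (p ℕ.+ (i ℕ.+ (a ℕ.+ (d ℕ.+ r)))) ≡ (f ℕ.+ (p ℕ.+ (i ℕ.+ (a ℕ.+ d)))) ℕ.+ r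
    regroup = solve-∀

  countConnected-polynomial : ∀ {G} → Unique G → Connected G → Polynomial-cost 10 (countConnected tieBreak G t)
  countConnected-polynomial {G} !G conn = polynomial-cost
    (countLoop-cost n S !G conn Size-1 ℕ.≤-refl)
    (bound-raise (ℕ.≤ᵇ⇒≤ _ _ tt) S-bound)
    (bound-raise (ℕ.≤ᵇ⇒≤ _ _ tt) (bound-loop ℕ.≤-refl iteration-bound))
    where
    S = 1 ℕ.+ n ℕ.* suc σᵢ
    σᵢ-bound : Bound 1 8 σᵢ
    σᵢ-bound = bound ℕ.≤-refl
    S-bound : Bound 2 9 S
    S-bound = bound-≤ (ℕ.≤-reflexive (ℕ.+-comm 1 _)) (bound-loop ℕ.≤-refl (bound-+ (one 8) σᵢ-bound))
    removable-bound : Bound 8 5 removable-time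
    removable-bound = bound-loop ℕ.≤-refl (bound-+ (one 4) (bound-+ (lift 2 Q-bound) (bound-+ components-bound (one 4))))
    iteration-bound : Bound 18 9 (loop-iteration S)
    iteration-bound = bound-+ (lift 4 removable-bound) (bound-+ (one 9) (bound-+ (bound {1} {9} ℕ.≤-refl)
      (bound-+ (bound-+ (one 9) (bound-+ (bound-2* S-bound) (bound-2* (lift 1 σᵢ-bound)))) (lift 7 Q-bound))))

  countComponents-polynomial : Polynomial-cost 12 (productᵀ (λ G → countConnected tieBreak G t) (value (components (List.allFin n))))
  countComponents-polynomial = product-polynomial (λ G → countConnected tieBreak G t) (value (components (List.allFin n)))
    (componentsFrom-length n (List.allFin n))
    (λ C∈ → let comp = All.lookup (components-all !all (components-spec !all)) C∈ in
      countConnected-polynomial (Component.unique comp) (Component.connected comp))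
    where !all = Unique.allFin⁺ n

-- Powers and the number of levels

^-cong : ∀ {p q} k → p ≃ q → p ^ k ≃ q ^ k
^-cong zero    p≃q = ≃-refl
^-cong (suc k) p≃q = ℚ.*-cong p≃q (^-cong k p≃q)

^-monoˡ : ∀ {p q} k → 0ℚᵘ ≤ p → p ≤ q → p ^ k ≤ q ^ k
^-monoˡ zero    0≤p p≤q = ℚ.≤-refl
^-monoˡ (suc k) 0≤p p≤q = *-mono-≤ 0≤p (^-≥0 k 0≤p) p≤q (^-monoˡ k 0≤p p≤q)

^-* : ∀ p q k → (p * q) ^ k ≃ p ^ k * q ^ k
^-* p q zero    = *≡* refl
^-* p q (suc k) = ℚ.≃-trans (ℚ.*-congˡ {p * q} (^-* p q k))
  (solve 4 (λ p q x y → p :* q :* (x :* y) := p :* x :* (q :* y)) ≃-refl p q (p ^ k) (q ^ k))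

^-^ : ∀ p j k → (p ^ j) ^ k ≃ p ^ (j ℕ.* k)
^-^ p j zero    = ℚ.≃-reflexive (cong (p ^_) (sym (ℕ.*-zeroʳ j)))
^-^ p j (suc k) = ℚ.≃-trans (ℚ.*-congˡ {p ^ j} (^-^ p j k))
  (ℚ.≃-trans (≃-sym (^-+ p j (j ℕ.* k))) (ℚ.≃-reflexive (cong (p ^_) (sym (ℕ.*-suc j k)))))

c-^ : ∀ a k → c (a ℕ.^ k) ≃ c a ^ k
c-^ a zero    = ≃-refl
c-^ a (suc k) = ℚ.≃-trans (c-* a (a ℕ.^ k)) (ℚ.*-congˡ {c a} (c-^ a k))

c-cancel-≤ : ∀ {m n} → c m ≤ c n → m ℕ.≤ n
c-cancel-≤ {m} {n} (*≤* le) = ℤ.drop‿+≤+ (subst₂ ℤ._≤_ (ℤ.*-identityʳ (+ m)) (ℤ.*-identityʳ (+ n)) le)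

fraction-^ : ∀ a b k .{{_ : ℕ.NonZero b}} → c (b ℕ.^ k) * (+ a / b) ^ k ≃ c (a ℕ.^ k)
fraction-^ a b zero    = *≡* refl
fraction-^ a b (suc k) = begin-equality
  c (b ℕ.* b ℕ.^ k) * ((+ a / b) * (+ a / b) ^ k)       ≃⟨ ℚ.*-congʳ {(+ a / b) * (+ a / b) ^ k} (c-* b (b ℕ.^ k)) ⟩
  c b * c (b ℕ.^ k) * ((+ a / b) * (+ a / b) ^ k)       ≃⟨ solve 4 (λ b x f y → b :* x :* (f :* y) := (b :* f) :* (x :* y)) ≃-refl (c b) (c (b ℕ.^ k)) (+ a / b) ((+ a / b) ^ k) ⟩
  (c b * (+ a / b)) * (c (b ℕ.^ k) * (+ a / b) ^ k)     ≃⟨ ℚ.*-cong (c-/ a b) (fraction-^ a b k) ⟩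
  c a * c (a ℕ.^ k)                                     ≃⟨ c-* a (a ℕ.^ k) ⟨
  c (a ℕ.* a ℕ.^ k)                                     ∎
  where open ℚ.≤-Reasoning

0<c^ : ∀ b k .{{_ : ℕ.NonZero b}} → 0ℚᵘ < c (b ℕ.^ k)
0<c^ b k with b ℕ.^ k | ℕ.m^n>0 b k
... | suc m | _ = 0<c m

≤fraction-^ : ∀ a b k x y .{{_ : ℕ.NonZero b}} → b ℕ.^ k ℕ.* x ℕ.≤ y ℕ.* a ℕ.^ k → c x ≤ c y * (+ a / b) ^ k
≤fraction-^ a b k x y le = *-cancelˡ-≤ (c (b ℕ.^ k)) (0<c^ b k) (begin
  c (b ℕ.^ k) * c x                      ≃⟨ c-* (b ℕ.^ k) x ⟨
  c (b ℕ.^ k ℕ.* x)                      ≤⟨ c-mono le ⟩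
  c (y ℕ.* a ℕ.^ k)                      ≃⟨ c-* y (a ℕ.^ k) ⟩
  c y * c (a ℕ.^ k)                      ≃⟨ ℚ.*-congˡ {c y} (fraction-^ a b k) ⟨
  c y * (c (b ℕ.^ k) * (+ a / b) ^ k)    ≃⟨ solve 3 (λ y b f → y :* (b :* f) := b :* (y :* f)) ≃-refl (c y) (c (b ℕ.^ k)) ((+ a / b) ^ k) ⟩
  c (b ℕ.^ k) * (c y * (+ a / b) ^ k)    ∎)
  where open ℚ.≤-Reasoning

fraction-^≤ : ∀ a b k x y .{{_ : ℕ.NonZero b}} → y ℕ.* a ℕ.^ k ℕ.≤ b ℕ.^ k ℕ.* x → c y * (+ a / b) ^ k ≤ c x
fraction-^≤ a b k x y le = *-cancelˡ-≤ (c (b ℕ.^ k)) (0<c^ b k) (begin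
  c (b ℕ.^ k) * (c y * (+ a / b) ^ k)    ≃⟨ solve 3 (λ y b f → b :* (y :* f) := y :* (b :* f)) ≃-refl (c y) (c (b ℕ.^ k)) ((+ a / b) ^ k) ⟩
  c y * (c (b ℕ.^ k) * (+ a / b) ^ k)    ≃⟨ ℚ.*-congˡ {c y} (fraction-^ a b k) ⟩
  c y * c (a ℕ.^ k)                      ≃⟨ c-* y (a ℕ.^ k) ⟨
  c (y ℕ.* a ℕ.^ k)                      ≤⟨ c-mono le ⟩
  c (b ℕ.^ k ℕ.* x)                      ≃⟨ c-* (b ℕ.^ k) x ⟩
  c (b ℕ.^ k) * c x                      ∎)
  where open ℚ.≤-Reasoning

r R : ℚᵘ
r = + 49 / 50
R = + 50 / 49

0<r : 0ℚᵘ < r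
0<r = ℚ.positive⁻¹ r

0<R : 0ℚᵘ < R
0<R = ℚ.positive⁻¹ R

1≤R : 1ℚᵘ ≤ R
1≤R = ℚ.≤ᵇ⇒≤ tt

r^R^ : ∀ k → r ^ k * R ^ k ≃ 1ℚᵘ
r^R^ k = ℚ.≃-trans (≃-sym (^-* r R k)) (ℚ.≃-trans (^-cong k (*≡* refl)) (one^ k))
  where
  one^ : ∀ k → 1ℚᵘ ^ k ≃ 1ℚᵘ
  one^ zero    = ≃-refl
  one^ (suc k) = ℚ.≃-trans (ℚ.*-identityˡ (1ℚᵘ ^ k)) (one^ k)

-- Bernoulli's inequality for `R` = 1 + 1/49, multiplied by 49. It limits the length of the search.
bernoulli : ∀ k → c 49 + c k ≤ c 49 * R ^ k
bernoulli zero    = ℚ.≤-reflexive (*≡* refl)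
bernoulli (suc m) = begin
  c 49 + c (suc m)               ≃⟨ ℚ.+-congʳ (c 49) (c-+ 1 m) ⟩
  c 49 + (c 1 + c m)             ≤⟨ *-cancelˡ-≤ (c 49) (0<c 48) (≤-gap (c m) (0≤c m) (begin-equality
    _                              ≃⟨ scaled-down (c m) ⟩
    c 50 * (c 49 + c m)            ≃⟨ ℚ.*-congʳ {c 49 + c m} {c 50} {c 49 * R} (*≡* refl) ⟩
    c 49 * R * (c 49 + c m)        ≃⟨ ℚ.*-assoc (c 49) R (c 49 + c m) ⟩
    c 49 * (R * (c 49 + c m))      ∎)) ⟩
  R * (c 49 + c m)               ≤⟨ *-monoʳ-≤ R (ℚ.<⇒≤ 0<R) (bernoulli m) ⟩
  R * (c 49 * R ^ m)             ≃⟨ solve 3 (λ R n p → R :* (n :* p) := n :* (R :* p)) ≃-refl R (c 49) (R ^ m) ⟩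
  c 49 * (R * R ^ m)             ∎
  where
  open ℚ.≤-Reasoning
  scaled-down : ∀ x → c 49 * (c 49 + (c 1 + x)) + x ≃ c 50 * (c 49 + x)
  scaled-down = solve 1 (λ x → k 49 :* (k 49 :+ (k 1 :+ x)) :+ x := k 50 :* (k 49 :+ x)) ≃-refl

record Searched (ε q : ℚᵘ) (fuel s size : ℕ) (result : Timed ℕ) : Set where
  field
    steps   : ℕ
    value≡  : value result ≡ s ℕ.+ steps
    stops   : q * r ^ steps ≤ ε ⊓ 1ℚᵘ ⊎ steps ≡ fuel
    minimal : ∀ i → i ℕ.< steps → ¬ (q * r ^ i ≤ ε ⊓ 1ℚᵘ)
    -- For an operand of size k, a comparison and a multiplication take at most 2k + 1 and 2k + 13
    -- steps, and each multiplication by 49/50 increases the size by 6.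
    time≤   : time result ℕ.≤ suc steps ℕ.* (4 ℕ.* (size ℕ.+ 6 ℕ.* steps) ℕ.+ 15)

search-spec : ∀ ε fuel s q {size} → Size size q → Searched ε q fuel s size (searchLogSteps ε fuel s q)
search-spec ε zero s q {size} _ = record
  { steps = 0 ; value≡ = sym (ℕ.+-identityʳ s) ; stops = inj₂ refl ; minimal = λ i () ; time≤ = ℕ.≤-trans (ℕ.m≤n+m 1 _) (ℕ.≤-reflexive (regroup size)) }
  where
  regroup : ∀ k → 4 ℕ.* k ℕ.+ 14 ℕ.+ 1 ≡ 1 ℕ.* (4 ℕ.* (k ℕ.+ 6 ℕ.* 0) ℕ.+ 15)
  regroup = solve-∀
search-spec ε (suc fuel) s q {size} size-q with q ≤ᵇ (ε ⊓ 1ℚᵘ) in eq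
... | true = record
  { steps = 0 ; value≡ = sym (ℕ.+-identityʳ s)
  ; stops = inj₁ (ℚ.≤-respˡ-≃ (≃-sym (ℚ.*-identityʳ q)) (ℚ.≤ᵇ⇒≤ (≡true⇒T eq)))
  ; minimal = λ i ()
  ; time≤ = ℕ.≤-trans (ℕ.+-monoˡ-≤ 1 (s≤s (bits-≤ q size-q))) (≤-slack (2 ℕ.* size ℕ.+ 13) (regroup size)) }
  where
  regroup : ∀ k → (suc (2 ℕ.* k) ℕ.+ 1) ℕ.+ (2 ℕ.* k ℕ.+ 13) ≡ 1 ℕ.* (4 ℕ.* (k ℕ.+ 6 ℕ.* 0) ℕ.+ 15)
  regroup = solve-∀
... | false = record
  { steps = suc steps ; value≡ = trans value≡ (sym (ℕ.+-suc s steps))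
  ; stops = stopped stops ; minimal = min ; time≤ = total }
  where
  size-r : Size 6 r
  size-r = sized (ℕ.≤ᵇ⇒≤ 50 64 tt) (ℕ.≤ᵇ⇒≤ 51 64 tt)
  open Searched (search-spec ε fuel (suc s) (q * r) (Size-* q r size-q size-r))
  shift : ∀ i → q * r * r ^ i ≃ q * r ^ suc i
  shift i = ℚ.*-assoc q r (r ^ i)
  stopped : q * r * r ^ steps ≤ ε ⊓ 1ℚᵘ ⊎ steps ≡ fuel → q * r ^ suc steps ≤ ε ⊓ 1ℚᵘ ⊎ suc steps ≡ suc fuel
  stopped (inj₁ le)  = inj₁ (ℚ.≤-respˡ-≃ (shift steps) le)
  stopped (inj₂ all) = inj₂ (cong suc all)
  min : ∀ i → i ℕ.< suc steps → ¬ (q * r ^ i ≤ ε ⊓ 1ℚᵘ)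
  min zero    _         le = contradiction (trans (sym eq) (T⇒≡true (ℚ.≤⇒≤ᵇ (ℚ.≤-respˡ-≃ (ℚ.*-identityʳ q) le)))) λ ()
  min (suc i) (s≤s i<) le = minimal i i< (ℚ.≤-respˡ-≃ (≃-sym (shift i)) le)
  total : suc (bits q) ℕ.+ (suc (bits q ℕ.+ bits r) ℕ.+ time (searchLogSteps ε fuel (suc s) (q * r))) ℕ.≤
          suc (suc steps) ℕ.* (4 ℕ.* (size ℕ.+ 6 ℕ.* suc steps) ℕ.+ 15)
  total = ℕ.≤-trans (ℕ.+-mono-≤ (s≤s (bits-≤ q size-q)) (ℕ.+-mono-≤ (arithmetic-time q r size-q size-r) time≤))
    (≤-slack (24 ℕ.* suc steps ℕ.+ 1) (regroup size steps))
    where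
    regroup : ∀ k j → (suc (2 ℕ.* k) ℕ.+ (suc (2 ℕ.* k ℕ.+ 2 ℕ.* 6) ℕ.+ suc j ℕ.* (4 ℕ.* (k ℕ.+ 6 ℕ.+ 6 ℕ.* j) ℕ.+ 15))) ℕ.+ (24 ℕ.* suc j ℕ.+ 1)
      ≡ suc (suc j) ℕ.* (4 ℕ.* (k ℕ.+ 6 ℕ.* suc j) ℕ.+ 15)
    regroup = solve-∀

-- Accuracy and running time in terms of n and ε

-- The induction step produces the second-order term 2 l η², which is at most η as long as 2 l η ≤
-- 1. Hence the factor 2 and the hypothesis.
ρ^n≤ : ∀ {η} k → 0ℚᵘ ≤ η → c 2 * c k * η ≤ 1ℚᵘ → (1ℚᵘ + η) ^ k ≤ 1ℚᵘ + c 2 * c k * η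
ρ^n≤ {η} zero    0≤η _  = ℚ.≤-reflexive (solve 1 (λ η → con 1ℚᵘ := con 1ℚᵘ :+ con (c 2) :* con (c 0) :* η) ≃-refl η)
ρ^n≤ {η} (suc l) 0≤η le = begin
  (1ℚᵘ + η) * (1ℚᵘ + η) ^ l               ≤⟨ *-monoʳ-≤ (1ℚᵘ + η) (+-≥0 (0≤c 1) 0≤η) (ρ^n≤ l 0≤η (ℚ.≤-trans fewer le)) ⟩
  (1ℚᵘ + η) * (1ℚᵘ + c 2 * c l * η)       ≤⟨ ≤-gap (η * (1ℚᵘ - c 2 * c l * η)) (*-≥0 0≤η (gap-≥0 (ℚ.≤-trans fewer le)))
    (solve 2 (λ η l → (k 1 :+ η) :* (k 1 :+ k 2 :* l :* η) :+ η :* (k 1 :- k 2 :* l :* η) := k 1 :+ k 2 :* (k 1 :+ l) :* η) ≃-refl η (c l)) ⟩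
  1ℚᵘ + c 2 * (c 1 + c l) * η             ≃⟨ ℚ.+-congʳ 1ℚᵘ (ℚ.*-congʳ {η} (ℚ.*-congˡ {c 2} (c-+ 1 l))) ⟨
  1ℚᵘ + c 2 * c (suc l) * η               ∎
  where
  open ℚ.≤-Reasoning
  fewer : c 2 * c l * η ≤ c 2 * c (suc l) * η
  fewer = *-monoˡ-≤ η 0≤η (*-monoʳ-≤ (c 2) (0≤c 2) (c-mono (ℕ.n≤1+n l)))

∣∣-≤ : ∀ {p q} → p ≤ q → - p ≤ q → ℚ.∣ p ∣ ≤ q
∣∣-≤ {mkℚᵘ (+ _) _}    p≤q -p≤q = p≤q
∣∣-≤ {mkℚᵘ -[1+ _ ] _} p≤q -p≤q = -p≤q

relative-error : ∀ {ε x y m b} → 0ℚᵘ ≤ x → 0ℚᵘ ≤ y → x ≤ b * y → y ≤ b * x → b ≤ 1ℚᵘ + m → 0ℚᵘ ≤ m → m ≤ ε →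
                 ℚ.∣ x - y ∣ ≤ ε * y
relative-error {ε} {x} {y} {m} {b} 0≤x 0≤y x≤by y≤bx b≤1+m 0≤m m≤ε = ∣∣-≤ upper lower
  where
  open ℚ.≤-Reasoning
  difference : ∀ {x y} → 0ℚᵘ ≤ y → x ≤ b * y → x - y ≤ m * y
  difference {x} {y} 0≤y x≤by = begin
    x - y                 ≤⟨ ℚ.+-monoˡ-≤ (- y) (ℚ.≤-trans x≤by (*-monoˡ-≤ y 0≤y b≤1+m)) ⟩
    (1ℚᵘ + m) * y - y     ≃⟨ solve 2 (λ m y → (k 1 :+ m) :* y :- y := m :* y) ≃-refl m y ⟩
    m * y                 ∎
  upper : x - y ≤ ε * y
  upper = ℚ.≤-trans (difference 0≤y x≤by) (*-monoˡ-≤ y 0≤y m≤ε)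
  lower : - (x - y) ≤ ε * y
  lower with ℚ.≤-total x y
  ... | inj₁ x≤y = begin
    - (x - y)     ≃⟨ ℚ.≃-trans (≃-sym (ℚ.+-identityˡ (- (x - y)))) (solve 2 (λ x y → k 0 :- (x :- y) := y :- x) ≃-refl x y) ⟩
    y - x         ≤⟨ difference 0≤x y≤bx ⟩
    m * x         ≤⟨ *-mono-≤ 0≤m 0≤x m≤ε x≤y ⟩
    ε * y         ∎
  ... | inj₂ y≤x = begin
    - (x - y)     ≤⟨ ℚ.neg-mono-≤ (gap-≥0 y≤x) ⟩
    0ℚᵘ           ≤⟨ *-≥0 (ℚ.≤-trans 0≤m m≤ε) 0≤y ⟩
    ε * y         ∎

error-even : ∀ s → c 100 * error (2 ℕ.* s) ≃ c 16 * (+ 97 / 100) ^ s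
error-even zero    = *≡* refl
error-even (suc s) rewrite ℕ.+-suc s (s ℕ.+ 0) = begin-equality
  c 100 * (u * error (2 ℕ.* s))       ≃⟨ solve 3 (λ h u e → h :* (u :* e) := u :* (h :* e)) ≃-refl (c 100) u (error (2 ℕ.* s)) ⟩
  u * (c 100 * error (2 ℕ.* s))       ≃⟨ ℚ.*-congˡ {u} (error-even s) ⟩
  u * (c 16 * u ^ s)                  ≃⟨ solve 3 (λ u h p → u :* (h :* p) := h :* (u :* p)) ≃-refl u (c 16) (u ^ s) ⟩
  c 16 * (u * u ^ s)                  ∎
  where
  open ℚ.≤-Reasoning
  u = + 97 / 100

fractions-^≤ : ∀ a a′ b e x y .{{_ : ℕ.NonZero b}} → x ℕ.* a ℕ.^ e ℕ.≤ y ℕ.* a′ ℕ.^ e →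
               c x * (+ a / b) ^ e ≤ c y * (+ a′ / b) ^ e
fractions-^≤ a a′ b e x y le = *-cancelˡ-≤ (c (b ℕ.^ e)) (0<c^ b e) (begin
  c (b ℕ.^ e) * (c x * (+ a / b) ^ e)    ≃⟨ numerator a x ⟩
  c (x ℕ.* a ℕ.^ e)                      ≤⟨ c-mono le ⟩
  c (y ℕ.* a′ ℕ.^ e)                     ≃⟨ numerator a′ y ⟨
  c (b ℕ.^ e) * (c y * (+ a′ / b) ^ e)   ∎)
  where
  open ℚ.≤-Reasoning
  numerator : ∀ a x → c (b ℕ.^ e) * (c x * (+ a / b) ^ e) ≃ c (x ℕ.* a ℕ.^ e)
  numerator a x = begin-equality
    c (b ℕ.^ e) * (c x * (+ a / b) ^ e)    ≃⟨ solve 3 (λ b x f → b :* (x :* f) := x :* (b :* f)) ≃-refl (c (b ℕ.^ e)) (c x) ((+ a / b) ^ e) ⟩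
    c x * (c (b ℕ.^ e) * (+ a / b) ^ e)    ≃⟨ ℚ.*-congˡ {c x} (fraction-^ a b e) ⟩
    c x * c (a ℕ.^ e)                      ≃⟨ c-* x (a ℕ.^ e) ⟨
    c (x ℕ.* a ℕ.^ e)                      ∎

-- Once the constant 16 has been exchanged for 9 at level `b`, each further level only replaces
-- 97/100 by the larger 49/50. The latter is written as 98/100 so that the comparison at level `b`
-- has a common denominator.
error-≤ : ∀ b → c 16 * (+ 97 / 100) ^ b ≤ c 9 * (+ 98 / 100) ^ b → ∀ s → b ℕ.≤ s →
          c 100 * error (2 ℕ.* s) ≤ c 9 * r ^ s
error-≤ b base s b≤s with ℕ.m≤n⇒∃[o]m+o≡n b≤s
... | j , refl = begin
  c 100 * error (2 ℕ.* (b ℕ.+ j))      ≃⟨ error-even (b ℕ.+ j) ⟩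
  c 16 * u ^ (b ℕ.+ j)                 ≃⟨ split u 16 ⟩
  (c 16 * u ^ b) * u ^ j               ≤⟨ *-mono-≤ (*-≥0 (0≤c 16) (^-≥0 b 0≤u)) (^-≥0 j 0≤u) base (^-monoˡ j 0≤u (ℚ.≤ᵇ⇒≤ tt)) ⟩
  (c 9 * v ^ b) * v ^ j                ≃⟨ split v 9 ⟨
  c 9 * v ^ (b ℕ.+ j)                  ≃⟨ ℚ.*-congˡ {c 9} (^-cong (b ℕ.+ j) (*≡* refl)) ⟩
  c 9 * r ^ (b ℕ.+ j)                  ∎
  where
  open ℚ.≤-Reasoning
  u v : ℚᵘ
  u = + 97 / 100
  v = + 98 / 100
  0≤u = ℚ.nonNegative⁻¹ u
  split : ∀ v m → c m * v ^ (b ℕ.+ j) ≃ (c m * v ^ b) * v ^ j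
  split v m = ℚ.≃-trans (ℚ.*-congˡ {c m} (^-+ v b j)) (≃-sym (ℚ.*-assoc (c m) (v ^ b) (v ^ j)))

-- From 60 levels on, the gap between 97/100 and 49/50 makes up for the
-- initial error.
error-≤-60 : ∀ s → 60 ℕ.≤ s → c 100 * error (2 ℕ.* s) ≤ c 9 * r ^ s
error-≤-60 = error-≤ 60 (fractions-^≤ 97 98 100 60 16 9 (ℕ.≤ᵇ⇒≤ (16 ℕ.* 97 ℕ.^ 60) (9 ℕ.* 98 ℕ.^ 60) tt))

size-c : ∀ n → Size (n ℕ.+ 1) (c n)
size-c n = sized (ℕ.<-≤-trans (n<2^n n) (ℕ.^-monoʳ-≤ 2 (ℕ.m≤m+n n 1))) (ℕ.^-monoʳ-≤ 2 (ℕ.m≤n+m 1 n))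
  where
  n<2^n : ∀ n → n ℕ.< 2 ℕ.^ n
  n<2^n zero    = s≤s z≤n
  n<2^n (suc n) = ℕ.+-mono-≤ (ℕ.m^n>0 2 n) (ℕ.≤-trans (n<2^n n) (ℕ.m≤m+n _ 0))

module Levels (n : ℕ) (ε : ℚᵘ) (0<ε : 0ℚᵘ < ε) where

  m : ℚᵘ
  m = ε ⊓ 1ℚᵘ

  m≤1 : m ≤ 1ℚᵘ
  m≤1 = ℚ.p⊓q≤q ε 1ℚᵘ

  m≤ε : m ≤ ε
  m≤ε = ℚ.p⊓q≤p ε 1ℚᵘ

  private
    d : ℕ
    d = ↧ₙ ε

    1≤εd : 1ℚᵘ ≤ ε * c d
    1≤εd = go ε 0<ε
      where
      go : ∀ ε → 0ℚᵘ < ε → 1ℚᵘ ≤ ε * c (↧ₙ ε)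
      go (mkℚᵘ (+ 0) x)    0<ε = contradiction 0<ε (ℚ.<-irrefl (≃-sym (*≡* refl)))
      go (mkℚᵘ +[1+ a ] x) 0<ε = ℚ.≤-respʳ-≃ (≃-sym (ℚ.≃-trans (ℚ.*-comm (mkℚᵘ +[1+ a ] x) (c (suc x))) (c-/ (suc a) (suc x)))) (c-mono (s≤s (z≤n {a})))
      go (mkℚᵘ -[1+ a ] x) (*<* ())

  m-cases : m ≃ ε ⊎ m ≃ 1ℚᵘ
  m-cases with ℚ.≤-total ε 1ℚᵘ
  ... | inj₁ ε≤1 = inj₁ (ℚ.p≤q⇒p⊓q≃p ε≤1)
  ... | inj₂ 1≤ε = inj₂ (ℚ.p≥q⇒p⊓q≃q 1≤ε)

  0<m : 0ℚᵘ < m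
  0<m with m-cases
  ... | inj₁ m≃ε = ℚ.<-respʳ-≃ (≃-sym m≃ε) 0<ε
  ... | inj₂ m≃1 = ℚ.<-respʳ-≃ (≃-sym m≃1) (0<c 0)

  1≤md : 1ℚᵘ ≤ m * c d
  1≤md with m-cases
  ... | inj₁ m≃ε = ℚ.≤-respʳ-≃ (ℚ.*-congʳ {c d} (≃-sym m≃ε)) 1≤εd
  ... | inj₂ m≃1 = ℚ.≤-respʳ-≃ (≃-sym (ℚ.≃-trans (ℚ.*-congʳ {c d} m≃1) (ℚ.*-identityˡ (c d)))) (1≤c-↧ ε)
    where
    1≤c-↧ : ∀ ε → 1ℚᵘ ≤ c (↧ₙ ε)
    1≤c-↧ (mkℚᵘ _ x) = c-mono (s≤s (z≤n {x}))

  searched : Searched ε (c (18 ℕ.* n)) (882 ℕ.* n ℕ.* d) 0 (18 ℕ.* n ℕ.+ 1) (logSteps n ε)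
  searched = search-spec ε (882 ℕ.* n ℕ.* d) 0 (c (18 ℕ.* n)) (size-c (18 ℕ.* n))

  open Searched searched public using (minimal; time≤) renaming (steps to s; value≡ to s≡)

  to-R : ∀ i → c (18 ℕ.* n) * r ^ i ≤ m → c (18 ℕ.* n) ≤ m * R ^ i
  to-R i le = begin
    c (18 ℕ.* n)                       ≃⟨ ℚ.*-identityʳ (c (18 ℕ.* n)) ⟨
    c (18 ℕ.* n) * 1ℚᵘ                 ≃⟨ ℚ.*-congˡ {c (18 ℕ.* n)} (r^R^ i) ⟨
    c (18 ℕ.* n) * (r ^ i * R ^ i)     ≃⟨ ℚ.*-assoc (c (18 ℕ.* n)) (r ^ i) (R ^ i) ⟨
    c (18 ℕ.* n) * r ^ i * R ^ i       ≤⟨ *-monoˡ-≤ (R ^ i) (^-≥0 i (ℚ.<⇒≤ 0<R)) le ⟩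
    m * R ^ i                          ∎
    where open ℚ.≤-Reasoning

  from-R : ∀ {p q} i → p ≤ q * R ^ i → p * r ^ i ≤ q
  from-R {p} {q} i le = begin
    p * r ^ i                ≤⟨ *-monoˡ-≤ (r ^ i) (^-≥0 i (ℚ.<⇒≤ 0<r)) le ⟩
    q * R ^ i * r ^ i        ≃⟨ solve 3 (λ q x y → q :* x :* y := q :* (y :* x)) ≃-refl q (R ^ i) (r ^ i) ⟩
    q * (r ^ i * R ^ i)      ≃⟨ ℚ.*-congˡ {q} (r^R^ i) ⟩
    q * 1ℚᵘ                  ≃⟨ ℚ.*-identityʳ q ⟩
    q                        ∎
    where open ℚ.≤-Reasoning

  -- If the fuel ran out, then s = 49 · 18 n d, and Bernoulli's inequality gives R^s ≥ 18 n d. This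
  -- suffices because m d ≥ 1, where d is the denominator of ε.
  s-suffices : c (18 ℕ.* n) * r ^ s ≤ m
  s-suffices with Searched.stops searched
  ... | inj₁ le  = le
  ... | inj₂ all = subst (λ i → c (18 ℕ.* n) * r ^ i ≤ m) (sym all) (from-R f (begin
    c (18 ℕ.* n)                   ≃⟨ ℚ.*-identityʳ (c (18 ℕ.* n)) ⟨
    c (18 ℕ.* n) * 1ℚᵘ             ≤⟨ *-monoʳ-≤ (c (18 ℕ.* n)) (0≤c (18 ℕ.* n)) 1≤md ⟩
    c (18 ℕ.* n) * (m * c d)       ≃⟨ solve 3 (λ a m d → a :* (m :* d) := m :* (a :* d)) ≃-refl (c (18 ℕ.* n)) m (c d) ⟩
    m * (c (18 ℕ.* n) * c d)       ≤⟨ *-monoʳ-≤ m (ℚ.<⇒≤ 0<m) enough ⟩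
    m * R ^ f                      ∎))
    where
    open ℚ.≤-Reasoning
    f = 882 ℕ.* n ℕ.* d
    regroup : ∀ n d → 882 ℕ.* n ℕ.* d ≡ 49 ℕ.* (18 ℕ.* n ℕ.* d)
    regroup = solve-∀
    enough : c (18 ℕ.* n) * c d ≤ R ^ f
    enough = *-cancelˡ-≤ (c 49) (0<c 48) (begin
      c 49 * (c (18 ℕ.* n) * c d)  ≃⟨ ℚ.*-congˡ {c 49} (c-* (18 ℕ.* n) d) ⟨
      c 49 * c (18 ℕ.* n ℕ.* d)    ≃⟨ c-* 49 (18 ℕ.* n ℕ.* d) ⟨
      c (49 ℕ.* (18 ℕ.* n ℕ.* d))  ≃⟨ ℚ.≃-reflexive (cong c (regroup n d)) ⟨
      c f                          ≤⟨ ≤-gap (c 49) (0≤c 49) (ℚ.+-comm (c f) (c 49)) ⟩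
      c 49 + c f                   ≤⟨ bernoulli f ⟩
      c 49 * R ^ f                 ∎)

  -- (50/49)^60 is still below 4, whereas stopping requires R^s ≥ 18 n / m ≥ 18. The range in which
  -- `error-≤-60` applies is therefore always reached.
  60≤s : 1 ℕ.≤ n → 60 ℕ.≤ s
  60≤s 1≤n = ℕ.≮⇒≥ λ s<60 → contradiction (c-cancel-≤ {18} {4} (begin
    c 18               ≤⟨ c-mono (ℕ.*-monoʳ-≤ 18 1≤n) ⟩
    c (18 ℕ.* n)       ≤⟨ to-R s s-suffices ⟩
    m * R ^ s          ≤⟨ *-mono-≤ (ℚ.<⇒≤ 0<m) (^-≥0 s (ℚ.<⇒≤ 0<R)) m≤1 (^-monoʳ 1≤R (ℕ.<⇒≤ s<60)) ⟩
    1ℚᵘ * R ^ 60       ≤⟨ fraction-^≤ 50 49 60 4 1 (ℕ.≤ᵇ⇒≤ (1 ℕ.* 50 ℕ.^ 60) (49 ℕ.^ 60 ℕ.* 4) tt) ⟩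
    c 4                ∎)) (ℕ.<⇒≱ (ℕ.≤ᵇ⇒≤ 5 18 tt))
    where open ℚ.≤-Reasoning

  -- The constant 18 of the algorithm splits here into the 2 from `ρ^n≤` and the 9 from
  -- `error-≤-60`.
  2nη≤m : c 2 * c n * (c 100 * error (2 ℕ.* s)) ≤ m
  2nη≤m with n ℕ.≟ 0
  ... | yes refl = ℚ.≤-trans (ℚ.≤-reflexive (solve 1 (λ e → k 2 :* k 0 :* e := k 0) ≃-refl (c 100 * error (2 ℕ.* s)))) (ℚ.<⇒≤ 0<m)
  ... | no n≢0   = begin
    c 2 * c n * (c 100 * error (2 ℕ.* s))  ≤⟨ *-monoʳ-≤ (c 2 * c n) (*-≥0 (0≤c 2) (0≤c n)) (error-≤-60 s (60≤s (ℕ.n≢0⇒n>0 n≢0))) ⟩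
    c 2 * c n * (c 9 * r ^ s)              ≃⟨ solve 2 (λ n p → k 2 :* n :* (k 9 :* p) := k 18 :* n :* p) ≃-refl (c n) (r ^ s) ⟩
    c 18 * c n * r ^ s                     ≃⟨ ℚ.*-congʳ {r ^ s} (c-* 18 n) ⟨
    c (18 ℕ.* n) * r ^ s                   ≤⟨ s-suffices ⟩
    m                                      ∎
    where open ℚ.≤-Reasoning

module Instance (tieBreak : TieBreak) (H : Hypergraph) (isKR : IsKR 3 3 H) (ε : ℚᵘ) (0<ε : 0ℚᵘ < ε) where

  open Hypergraph H
  open Intersections H
  open Levels #E ε 0<ε public

  private
    local = intersection-local isKR
    t = 2 ℕ.* s

  module _ where
    open Accuracy local tieBreak t

    accurate : ℚ.∣ value (countMatchings tieBreak H t) - c (Z-M H) ∣ ≤ ε * c (Z-M H)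
    accurate = relative-error 0≤x 0≤y x≤y y≤x
      (ℚ.≤-trans (ρ^n≤ #E 0≤η (ℚ.≤-trans 2nη≤m m≤1)) (ℚ.+-monoʳ-≤ 1ℚᵘ 2nη≤m)) (ℚ.<⇒≤ 0<m) m≤ε
      where
      open Within (subst (λ z → Within #E (value (countMatchings tieBreak H t)) (c z)) (sym matching⇔independent) countComponents-within)

  module _ where
    open TotalTime local tieBreak t

    intersect-time : ∀ i j → time (intersectᵀ H i j) ℕ.≤ 15
    intersect-time i j = s≤s (s≤s (ℕ.≤-trans (anyᵀ-time (_∈ᵀ members (edge j)) {4} (members (edge i)) λ x →
        ℕ.≤-trans (∈ᵀ-time x (members (edge j))) (ℕ.≤-reflexive (cong (ℕ._+ 1) (members-length isKR j))))
      (ℕ.≤-reflexive (cong (λ l → l ℕ.* 4 ℕ.+ 1) (members-length isKR i)))))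

    -- The entry function is again supplied by unification. The alternative produces an entry that
    -- is too slow, because its time can be examined by cases on `i Fin.≟ j` once the entry is
    -- known.
    matrix-time : ∀ (f : Fin #E → Fin #E → Timed Bool) M → M ≡ tabulateᵀ (λ i → tabulateᵀ (f i)) →
      time M ℕ.≤ #E ℕ.* suc (#E ℕ.* 17 ℕ.+ 1) ℕ.+ 1 ⊎ ∃[ i ] ∃[ j ] ¬ time (f i j) ℕ.≤ 16
    matrix-time f M refl with Fin.all? (λ i → Fin.all? λ j → time (f i j) ℕ.≤? 16)
    ... | yes fast = inj₁ (tabulateᵀ-time (λ i → tabulateᵀ (f i)) λ i → tabulateᵀ-time (f i) (fast i))
    ... | no ¬fast with Fin.¬∀⟶∃¬ #E _ (λ i → Fin.all? λ j → time (f i j) ℕ.≤? 16) ¬fast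
    ...   | i , ¬fastᵢ with Fin.¬∀⟶∃¬ #E _ (λ j → time (f i j) ℕ.≤? 16) ¬fastᵢ
    ...     | j , slow = inj₂ (i , j , slow)

    intersectionGraph-time : time (intersectionGraph H) ℕ.≤ #E ℕ.* suc (#E ℕ.* 17 ℕ.+ 1) ℕ.+ 1
    intersectionGraph-time with matrix-time _ (intersectionGraph H) refl
    ... | inj₁ le             = le
    ... | inj₂ (i , j , slow) with i Fin.≟ j | slow
    ...   | yes _ | slow′ = contradiction (s≤s (s≤s z≤n)) slow′
    ...   | no _  | slow′ = contradiction (s≤s (intersect-time i j)) slow′

    -- The search takes time quadratic in s up to a factor linear in n, and (s + 1)² ≤ 7^s · 7^s =
    -- 7^t.
    search-bound : Bound 1 1 (time (logSteps #E ε))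
    search-bound = bound (begin
      time (logSteps #E ε)                                            ≤⟨ time≤ ⟩
      suc s ℕ.* (4 ℕ.* (18 ℕ.* #E ℕ.+ 1 ℕ.+ 6 ℕ.* s) ℕ.+ 15)          ≤⟨ ≤-slack _ (regroup #E s) ⟩
      100 ℕ.* suc #E ℕ.* (suc s ℕ.* suc s)                            ≤⟨ ℕ.*-monoʳ-≤ (100 ℕ.* suc #E) (ℕ.*-mono-≤ (s<7^s s) (s<7^s s)) ⟩
      base ℕ.* (7 ℕ.^ s ℕ.* 7 ℕ.^ s)                                  ≡⟨ cong₂ ℕ._*_ (sym (ℕ.*-identityʳ base)) (trans (sym (ℕ.^-distribˡ-+-* 7 s s)) (cong (λ j → 7 ℕ.^ (s ℕ.+ j)) (sym (ℕ.+-identityʳ s)))) ⟩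
      W 1                                                             ≡⟨ ℕ.*-identityˡ (W 1) ⟨
      1 ℕ.* W 1                                                       ∎)
      where
      open ℕ.≤-Reasoning
      regroup : ∀ n s → suc s ℕ.* (4 ℕ.* (18 ℕ.* n ℕ.+ 1 ℕ.+ 6 ℕ.* s) ℕ.+ 15)
        ℕ.+ (suc s ℕ.* (100 ℕ.* n ℕ.* s ℕ.+ 28 ℕ.* n ℕ.+ 76 ℕ.* s ℕ.+ 81)) ≡ 100 ℕ.* suc n ℕ.* (suc s ℕ.* suc s)
      regroup = solve-∀
      s<7^s : ∀ s → s ℕ.< 7 ℕ.^ s
      s<7^s zero    = s≤s z≤n
      s<7^s (suc s) = ℕ.≤-trans (ℕ.+-mono-≤ (ℕ.m^n>0 7 s) (s<7^s s)) (≤-slack (5 ℕ.* 7 ℕ.^ s) (seven (7 ℕ.^ s)))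
        where
        seven : ∀ x → (x ℕ.+ x) ℕ.+ 5 ℕ.* x ≡ 7 ℕ.* x
        seven = solve-∀

    countMatchings-time : time (countMatchings tieBreak H t) ≡
      time (intersectionGraph H) ℕ.+ (suc #E ℕ.+ (time (components (List.allFin #E)) ℕ.+
        time (productᵀ (λ G → countConnected tieBreak G t) (value (components (List.allFin #E))))))
    countMatchings-time = refl

    intersectionGraph-bound : Bound 18 13 (time (intersectionGraph H))
    intersectionGraph-bound = bound-≤ intersectionGraph-time (lift {18} {2} 11
      (bound-loop {17} {1} {#E} ℕ.≤-refl (bound-+ {1} {17} {1} (one 1) (bound-loop {16} {0} {#E} ℕ.≤-refl (bound-const 17 0)))))

    all-components-bound : Bound 5 13 (time (components (List.allFin #E)))
    all-components-bound = bound-≤ (components-time {List.allFin #E} (ℕ.≤-reflexive (List.length-tabulate {n = #E} id)))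
      (lift {5} {4} 9 components-bound)

    product-bound : Bound 1 13 (time (productᵀ (λ G → countConnected tieBreak G t) (value (components (List.allFin #E)))))
    product-bound = bound-≤ (Cost.time-≤ is-cost) time-≤
      where open Polynomial-cost countComponents-polynomial

    sum-bound : Bound 26 13 (time (logSteps #E ε) ℕ.+ time (countMatchings tieBreak H t))
    sum-bound = subst (λ x → Bound 26 13 (time (logSteps #E ε) ℕ.+ x)) (sym countMatchings-time)
      (bound-+ {1} {25} {13} (lift {1} {1} 12 search-bound) (bound-+ {18} {7} {13} intersectionGraph-bound
        (bound-+ {1} {6} {13} (bound-n 12) (bound-+ {5} {1} {13} all-components-bound product-bound))))

    abstract

      -- The exponent 14 consists of 12 for the product over the components, one for time as against
      -- size, and one for the coefficient 26. The base `b` stays opaque and is known later only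
      -- through its equation.
      total-time : ∃[ b ] b ≡ 100 ℕ.* suc #E ×
        time (logSteps #E ε) ℕ.+ time (countMatchings tieBreak H t) ℕ.≤ b ℕ.^ 14 ℕ.* 7 ℕ.^ t
      total-time = base , refl ,
        ℕ.≤-trans (Bound.holds (bound-raise {26} {13} (ℕ.≤ᵇ⇒≤ 26 100 tt) sum-bound)) (ℕ.≤-reflexive (ℕ.*-identityˡ (W 14)))

-- Input length, comparison of exponents and final bounds

length-encodeList : ∀ {A : Set} (enc : A → List Bool) xs → length xs ℕ.≤ length (encodeList enc xs)
length-encodeList enc []       = z≤n
length-encodeList enc (x ∷ xs) = s≤s (ℕ.≤-trans (length-encodeList enc xs)
  (ℕ.≤-trans (ℕ.m≤n+m _ (length (enc x))) (ℕ.≤-reflexive (sym (List.length-++ (enc x))))))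

#E≤length-encode : ∀ H → Hypergraph.#E H ℕ.≤ length (encodeHypergraph H)
#E≤length-encode H = begin
  #E                                  ≡⟨ List.length-tabulate {n = #E} id ⟨
  length (List.allFin #E)             ≤⟨ length-encodeList _ (List.allFin #E) ⟩
  length edges                        ≤⟨ ℕ.m≤n+m (length edges) (length (encodeℕ #V)) ⟩
  length (encodeℕ #V) ℕ.+ length edges ≡⟨ List.length-++ (encodeℕ #V) ⟨
  length (encodeHypergraph H)         ∎
  where
  open Hypergraph H
  open ℕ.≤-Reasoning
  edges = encodeList (λ i → encodeList (λ v → encodeℕ (toℕ v)) (members (edge i))) (List.allFin #E)

÷-* : ∀ p q .{{_ : ℚ.NonZero q}} → (p ÷ q) * q ≃ p
÷-* p@(mkℚᵘ _ _) q@(mkℚᵘ _ _) = ℚ.≃-trans (ℚ.*-assoc p (1/ q) q)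
  (ℚ.≃-trans (ℚ.*-congˡ {p} (ℚ.*-inverseˡ q)) (ℚ.*-identityʳ p))

-- If p < γ q, then R^p · R ≤ R^(γ q) ≤ 144^q ≤ R^p, hence R ≤ 1, which `≤⇒≤ᵇ` refutes by
-- evaluation.
R^-cancel : ∀ {γ p q} → R ^ γ ≤ c 144 → c 144 ^ q ≤ R ^ p → γ ℕ.* q ℕ.≤ p
R^-cancel {γ} {p} {q} R^γ≤144 144^q≤R^p = ℕ.≮⇒≥ λ p<γq → contradiction (*-cancelˡ-≤ (R ^ p) (^->0 p 0<R) (begin
  R ^ p * R          ≃⟨ ℚ.*-comm (R ^ p) R ⟩
  R ^ suc p          ≤⟨ ^-monoʳ 1≤R p<γq ⟩
  R ^ (γ ℕ.* q)      ≃⟨ ^-^ R γ q ⟨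
  (R ^ γ) ^ q        ≤⟨ ^-monoˡ q (^-≥0 γ (ℚ.<⇒≤ 0<R)) R^γ≤144 ⟩
  c 144 ^ q          ≤⟨ 144^q≤R^p ⟩
  R ^ p              ≃⟨ ℚ.*-identityʳ (R ^ p) ⟨
  R ^ p * 1ℚᵘ        ∎)) ℚ.≤⇒≤ᵇ
  where open ℚ.≤-Reasoning

-- The bound has enough slack for an integral exponent γ below the
-- logarithm of 144 to the base 50/49.
integral-exponent : ∀ {T y x γ} → 0ℚᵘ ≤ T → 0ℚᵘ ≤ y → 1ℚᵘ ≤ x → R ^ γ ≤ c 144 → T ≤ y * x ^ γ →
                    BoundedByLogPower T y x R (c 144)
integral-exponent {T} {y} {x} {γ} 0≤T 0≤y 1≤x R^γ≤144 T≤ p q 144^q≤R^p = begin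
  T ^ q                      ≤⟨ ^-monoˡ q 0≤T T≤ ⟩
  (y * x ^ γ) ^ q            ≃⟨ ^-* y (x ^ γ) q ⟩
  y ^ q * (x ^ γ) ^ q        ≃⟨ ℚ.*-congˡ {y ^ q} (^-^ x γ q) ⟩
  y ^ q * x ^ (γ ℕ.* q)      ≤⟨ *-monoʳ-≤ (y ^ q) (^-≥0 q 0≤y) (^-monoʳ 1≤x (R^-cancel {γ} {p} {q} R^γ≤144 144^q≤R^p)) ⟩
  y ^ q * x ^ p              ∎
  where open ℚ.≤-Reasoning

-- A search that has not yet stopped at `i` means m R^i < 18 n. With n ≤ x m this bounds the number
-- of levels from above, the tolerance being hidden in `x`.
level-power : ∀ {m x} n i → 0ℚᵘ < m → c n ≤ x * m → ¬ (c (18 ℕ.* n) * r ^ i ≤ m) → R ^ i ≤ c 18 * x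
level-power {m} {x} n i 0<m n≤xm not-yet = *-cancelˡ-≤ m 0<m (begin
  m * R ^ i                          ≤⟨ *-monoˡ-≤ (R ^ i) (^-≥0 i (ℚ.<⇒≤ 0<R)) (ℚ.<⇒≤ (ℚ.≰⇒> not-yet)) ⟩
  c (18 ℕ.* n) * r ^ i * R ^ i       ≃⟨ ℚ.*-assoc (c (18 ℕ.* n)) (r ^ i) (R ^ i) ⟩
  c (18 ℕ.* n) * (r ^ i * R ^ i)     ≃⟨ ℚ.*-congˡ {c (18 ℕ.* n)} (r^R^ i) ⟩
  c (18 ℕ.* n) * 1ℚᵘ                 ≃⟨ ℚ.*-identityʳ (c (18 ℕ.* n)) ⟩
  c (18 ℕ.* n)                       ≃⟨ c-* 18 n ⟩
  c 18 * c n                         ≤⟨ *-monoʳ-≤ (c 18) (0≤c 18) n≤xm ⟩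
  c 18 * (x * m)                     ≃⟨ solve 3 (λ k x m → k :* (x :* m) := m :* (k :* x)) ≃-refl (c 18) x m ⟩
  m * (c 18 * x)                     ∎)
  where open ℚ.≤-Reasoning

module Exponents (β e : ℕ) (49≤R^β : c 49 ≤ R ^ β) where

  C : ℕ
  C = 18 ℕ.^ β ℕ.* 49 ℕ.* 200 ℕ.^ (2 ℕ.+ e)

  -- The step from the last unsuccessful `i` to the number of levels `suc i` costs one factor 49.
  -- The remaining 49^i is at most (R^β)^i = (R^i)^β and so becomes a power of `x`.
  forty-nine : ∀ {i x} → R ^ i ≤ c 18 * x → c (7 ℕ.^ (2 ℕ.* suc i)) ≤ c 49 * (c 18 ^ β * x ^ β)
  forty-nine {i} {x} R^i≤18x = begin
    c (7 ℕ.^ (2 ℕ.* suc i))        ≃⟨ ℚ.≃-reflexive (cong c (sym (ℕ.^-*-assoc 7 2 (suc i)))) ⟩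
    c (49 ℕ.^ suc i)               ≃⟨ c-^ 49 (suc i) ⟩
    c 49 * c 49 ^ i                ≤⟨ *-monoʳ-≤ (c 49) (0≤c 49) (^-monoˡ i (0≤c 49) 49≤R^β) ⟩
    c 49 * (R ^ β) ^ i             ≃⟨ ℚ.*-congˡ {c 49} (ℚ.≃-trans (^-^ R β i) (ℚ.≃-trans (ℚ.≃-reflexive (cong (R ^_) (ℕ.*-comm β i))) (≃-sym (^-^ R i β)))) ⟩
    c 49 * (R ^ i) ^ β             ≤⟨ *-monoʳ-≤ (c 49) (0≤c 49) (^-monoˡ β (^-≥0 i (ℚ.<⇒≤ 0<R)) R^i≤18x) ⟩
    c 49 * (c 18 * x) ^ β          ≃⟨ ℚ.*-congˡ {c 49} (^-* (c 18) x β) ⟩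
    c 49 * (c 18 ^ β * x ^ β)      ∎
    where open ℚ.≤-Reasoning

  -- Of the 2 + e powers of `n` only two remain as n²; the others are moved into powers of x ≥ n.
  -- For n ≥ 1 the base is at most 200 n.
  base-power : ∀ {b n x} → b ≡ 100 ℕ.* suc n → 1 ℕ.≤ n → c n ≤ x → c (b ℕ.^ (2 ℕ.+ e)) ≤ c (200 ℕ.^ (2 ℕ.+ e)) * (c n ^ 2 * x ^ e)
  base-power {b} {n} {x} b≡ 1≤n n≤x = begin
    c (b ℕ.^ (2 ℕ.+ e))                        ≤⟨ c-mono (ℕ.^-monoˡ-≤ (2 ℕ.+ e) doubled) ⟩
    c ((200 ℕ.* n) ℕ.^ (2 ℕ.+ e))              ≃⟨ ℚ.≃-trans (c-^ (200 ℕ.* n) (2 ℕ.+ e)) (^-cong (2 ℕ.+ e) (c-* 200 n)) ⟩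
    (c 200 * c n) ^ (2 ℕ.+ e)                  ≃⟨ ^-* (c 200) (c n) (2 ℕ.+ e) ⟩
    c 200 ^ (2 ℕ.+ e) * c n ^ (2 ℕ.+ e)        ≃⟨ ℚ.*-cong (≃-sym (c-^ 200 (2 ℕ.+ e))) (^-+ (c n) 2 e) ⟩
    c (200 ℕ.^ (2 ℕ.+ e)) * (c n ^ 2 * c n ^ e) ≤⟨ *-monoʳ-≤ (c (200 ℕ.^ (2 ℕ.+ e))) (0≤c (200 ℕ.^ (2 ℕ.+ e)))
                                                     (*-monoʳ-≤ (c n ^ 2) (^-≥0 2 (0≤c n)) (^-monoˡ e (0≤c n) n≤x)) ⟩
    c (200 ℕ.^ (2 ℕ.+ e)) * (c n ^ 2 * x ^ e)  ∎
    where
    open ℚ.≤-Reasoning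
    doubled : b ℕ.≤ 200 ℕ.* n
    doubled = ℕ.≤-trans (ℕ.≤-reflexive b≡) (ℕ.≤-trans (ℕ.*-monoʳ-≤ 100 (ℕ.+-monoˡ-≤ n 1≤n)) (ℕ.≤-reflexive (two n)))
      where
      two : ∀ n → 100 ℕ.* (n ℕ.+ n) ≡ 200 ℕ.* n
      two = solve-∀

  total-bound : ∀ {T b n i m x} → b ≡ 100 ℕ.* suc n → 1 ℕ.≤ n → c n ≤ x → 0ℚᵘ < m → c n ≤ x * m → ¬ (c (18 ℕ.* n) * r ^ i ≤ m) →
    T ℕ.≤ b ℕ.^ (2 ℕ.+ e) ℕ.* 7 ℕ.^ (2 ℕ.* suc i) → c T ≤ c C * c n ^ 2 * x ^ (e ℕ.+ β)
  total-bound {T} {b} {n} {i} {m} {x} b≡ 1≤n n≤x 0<m n≤xm not-yet T≤ = begin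
    c T
      ≤⟨ c-mono T≤ ⟩
    c (b ℕ.^ (2 ℕ.+ e) ℕ.* 7 ℕ.^ (2 ℕ.* suc i))
      ≃⟨ c-* (b ℕ.^ (2 ℕ.+ e)) (7 ℕ.^ (2 ℕ.* suc i)) ⟩
    c (b ℕ.^ (2 ℕ.+ e)) * c (7 ℕ.^ (2 ℕ.* suc i))
      ≤⟨ *-mono-≤ (0≤c (b ℕ.^ (2 ℕ.+ e))) (0≤c (7 ℕ.^ (2 ℕ.* suc i))) (base-power b≡ 1≤n n≤x)
           (forty-nine {i} {x} (level-power {m} {x} n i 0<m n≤xm not-yet)) ⟩
    A * (c n ^ 2 * x ^ e) * (c 49 * (c 18 ^ β * x ^ β))
      ≃⟨ solve 6 (λ A B X K P Y → A :* (B :* X) :* (K :* (P :* Y)) := P :* K :* A :* B :* (X :* Y)) ≃-refl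
           A (c n ^ 2) (x ^ e) (c 49) (c 18 ^ β) (x ^ β) ⟩
    c 18 ^ β * c 49 * A * c n ^ 2 * (x ^ e * x ^ β)
      ≃⟨ ℚ.*-cong (ℚ.*-congʳ {c n ^ 2} constant) (≃-sym (^-+ x e β)) ⟩
    c C * c n ^ 2 * x ^ (e ℕ.+ β) ∎
    where
    open ℚ.≤-Reasoning
    A = c (200 ℕ.^ (2 ℕ.+ e))
    constant : c 18 ^ β * c 49 * A ≃ c C
    constant = begin-equality
      c 18 ^ β * c 49 * A           ≃⟨ ℚ.*-congʳ {A} (ℚ.*-congʳ {c 49} (c-^ 18 β)) ⟨
      c (18 ℕ.^ β) * c 49 * A       ≃⟨ ℚ.*-congʳ {A} (c-* (18 ℕ.^ β) 49) ⟨
      c (18 ℕ.^ β ℕ.* 49) * A       ≃⟨ c-* (18 ℕ.^ β ℕ.* 49) (200 ℕ.^ (2 ℕ.+ e)) ⟨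
      c C                           ∎

module Conclusion (tieBreak : TieBreak) (β : ℕ) (49≤R^β : c 49 ≤ R ^ β) where

  open Exponents β 12 49≤R^β

  -- 12 is what the exponent 14 leaves after n² has been split off. `K` is the time bound for n = 0,
  -- where the search stops at once and the power of 7 is 1.
  γ K : ℕ
  γ = 12 ℕ.+ β
  K = 100 ℕ.^ 14 ℕ.* 1

  module _ (H : Hypergraph) (isKR : IsKR 3 3 H) (ε : ℚᵘ) .{{_ : Positive ε}} where

    open Instance tieBreak H isKR ε (ℚ.positive⁻¹ ε) using (m; m≤1; 0<m; m-cases; s; s≡; minimal; 60≤s; accurate; total-time)

    private
      n = Hypergraph.#E H
      τ = time (approximateMatchings tieBreak ε H)

    approximation : ℚ.∣ value (approximateMatchings tieBreak ε H) - c (Z-M H) ∣ ≤ ε * c (Z-M H)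
    approximation = subst (λ s → ℚ.∣ value (countMatchings tieBreak H (2 ℕ.* s)) - c (Z-M H) ∣ ≤ ε * c (Z-M H)) (sym s≡) accurate

    b : ℕ
    b = proj₁ total-time

    b≡ : b ≡ 100 ℕ.* suc n
    b≡ = proj₁ (proj₂ total-time)

    τ≤ : τ ℕ.≤ b ℕ.^ 14 ℕ.* 7 ℕ.^ (2 ℕ.* s)
    τ≤ = subst (λ s′ → time (logSteps n ε) ℕ.+ time (countMatchings tieBreak H (2 ℕ.* s′)) ℕ.≤ b ℕ.^ 14 ℕ.* 7 ℕ.^ (2 ℕ.* s))
      (sym s≡) (proj₂ (proj₂ total-time))

    -- `x` is left open for two uses: n (1 + 1/ε), which works for every positive ε, and n / ε,
    -- which satisfies both hypotheses for ε ≤ 1.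
    nonempty-bound : ∀ {x} → 1 ℕ.≤ n → c n ≤ x → c n ≤ x * m → c τ ≤ c C * c n ^ 2 * x ^ γ
    nonempty-bound {x} 1≤n n≤x n≤xm = go (ℕ.m≤n⇒∃[o]m+o≡n (ℕ.≤-trans (s≤s (z≤n {59})) (60≤s 1≤n)))
      where
      go : ∃[ i ] suc i ≡ s → c τ ≤ c C * c n ^ 2 * x ^ γ
      go (i , 1+i≡s) = total-bound {τ} {b} {n} {i} {m} {x} b≡ 1≤n n≤x 0<m n≤xm (minimal i (ℕ.≤-reflexive 1+i≡s))
        (subst (λ s → τ ℕ.≤ b ℕ.^ 14 ℕ.* 7 ℕ.^ (2 ℕ.* s)) (sym 1+i≡s) τ≤)

    empty-bound : n ≡ 0 → τ ℕ.≤ K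
    empty-bound n≡0 = subst₂ (λ b s → τ ℕ.≤ b ℕ.^ 14 ℕ.* 7 ℕ.^ (2 ℕ.* s)) (trans b≡ (cong (λ n → 100 ℕ.* suc n) n≡0)) s≡0 τ≤
      where
      s≡0 : s ≡ 0
      s≡0 = ℕ.n<1⇒n≡0 (ℕ.≰⇒> λ 1≤s → minimal 0 1≤s (ℚ.≤-trans (ℚ.≤-reflexive (ℚ.≃-trans (ℚ.*-identityʳ (c (18 ℕ.* n)))
        (ℚ.≃-reflexive (cong (λ n → c (18 ℕ.* n)) n≡0)))) (ℚ.<⇒≤ 0<m)))

    private
      L = length (encodeHypergraph H)
      1/ε = (1/ ε) {{pos⇒nonZero ε}}
      Y = 1ℚᵘ + 1/ε + c L

    0≤1/ε : 0ℚᵘ ≤ 1/ε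
    0≤1/ε = ℚ.<⇒≤ (ℚ.positive⁻¹ 1/ε {{ℚ.1/pos⇒pos ε}})

    1+1/ε≤Y : 1ℚᵘ + 1/ε ≤ Y
    1+1/ε≤Y = ≤-gap (c L) (0≤c L) ≃-refl

    1≤Y : 1ℚᵘ ≤ Y
    1≤Y = ℚ.≤-trans (≤-gap 1/ε 0≤1/ε ≃-refl) 1+1/ε≤Y

    0≤Y : 0ℚᵘ ≤ Y
    0≤Y = ℚ.≤-trans (0≤c 1) 1≤Y

    n≤Y : c n ≤ Y
    n≤Y = ℚ.≤-trans (c-mono (#E≤length-encode H)) (≤-gap (1ℚᵘ + 1/ε) (+-≥0 (0≤c 1) 0≤1/ε) (ℚ.+-comm (c L) (1ℚᵘ + 1/ε)))

    1≤[1+1/ε]m : 1ℚᵘ ≤ (1ℚᵘ + 1/ε) * m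
    1≤[1+1/ε]m with m-cases
    ... | inj₁ m≃ε = begin
      1ℚᵘ                        ≤⟨ ≤-gap ε (ℚ.<⇒≤ (ℚ.positive⁻¹ ε)) (ℚ.+-comm 1ℚᵘ ε) ⟩
      ε + 1ℚᵘ                    ≃⟨ ℚ.+-congʳ ε (ℚ.*-inverseˡ ε {{pos⇒nonZero ε}}) ⟨
      ε + 1/ε * ε                ≃⟨ solve 2 (λ e i → e :+ i :* e := (k 1 :+ i) :* e) ≃-refl ε 1/ε ⟩
      (1ℚᵘ + 1/ε) * ε            ≃⟨ ℚ.*-congˡ {1ℚᵘ + 1/ε} m≃ε ⟨
      (1ℚᵘ + 1/ε) * m            ∎
      where open ℚ.≤-Reasoning
    ... | inj₂ m≃1 = begin
      1ℚᵘ                        ≤⟨ ≤-gap 1/ε 0≤1/ε ≃-refl ⟩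
      1ℚᵘ + 1/ε                  ≃⟨ ℚ.*-identityʳ (1ℚᵘ + 1/ε) ⟨
      (1ℚᵘ + 1/ε) * 1ℚᵘ          ≃⟨ ℚ.*-congˡ {1ℚᵘ + 1/ε} m≃1 ⟨
      (1ℚᵘ + 1/ε) * m            ∎
      where open ℚ.≤-Reasoning

    -- The quantity n (1 + 1/ε) is at most `Y * Y`, so that its power γ contributes 2 γ to the
    -- exponent and n² contributes 2. The constant `K` accounts for n = 0.
    polynomial-bound : c τ ≤ c (C ℕ.+ K) * Y ^ (2 ℕ.+ (γ ℕ.+ γ))
    polynomial-bound = go (n ℕ.≟ 0)
      where
      go : Dec (n ≡ 0) → c τ ≤ c (C ℕ.+ K) * Y ^ (2 ℕ.+ (γ ℕ.+ γ))
      go (yes n≡0) = begin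
        c τ                                     ≤⟨ c-mono (ℕ.≤-trans (empty-bound n≡0) (ℕ.m≤n+m K C)) ⟩
        c (C ℕ.+ K)                             ≃⟨ ℚ.*-identityʳ (c (C ℕ.+ K)) ⟨
        c (C ℕ.+ K) * 1ℚᵘ                       ≤⟨ *-monoʳ-≤ (c (C ℕ.+ K)) (0≤c (C ℕ.+ K)) (^-monoʳ {Y} {0} {2 ℕ.+ (γ ℕ.+ γ)} 1≤Y z≤n) ⟩
        c (C ℕ.+ K) * Y ^ (2 ℕ.+ (γ ℕ.+ γ))     ∎
        where open ℚ.≤-Reasoning
      go (no n≢0) = begin
        c τ                                     ≤⟨ nonempty-bound (ℕ.n≢0⇒n>0 n≢0) n≤x n≤xm ⟩
        c C * c n ^ 2 * x ^ γ                   ≤⟨ *-mono-≤ (*-≥0 (0≤c C) (^-≥0 2 (0≤c n))) (^-≥0 γ 0≤x)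
                                                     (*-mono-≤ (0≤c C) (^-≥0 2 (0≤c n)) (c-mono (ℕ.m≤m+n C K)) (^-monoˡ 2 (0≤c n) n≤Y)) (^-monoˡ γ 0≤x x≤YY) ⟩
        c (C ℕ.+ K) * Y ^ 2 * (Y * Y) ^ γ       ≃⟨ ℚ.*-assoc (c (C ℕ.+ K)) (Y ^ 2) ((Y * Y) ^ γ) ⟩
        c (C ℕ.+ K) * (Y ^ 2 * (Y * Y) ^ γ)     ≃⟨ ℚ.*-congˡ {c (C ℕ.+ K)} (ℚ.≃-trans
                                                     (ℚ.*-congˡ {Y ^ 2} (ℚ.≃-trans (^-* Y Y γ) (≃-sym (^-+ Y γ γ)))) (≃-sym (^-+ Y 2 (γ ℕ.+ γ)))) ⟩
        c (C ℕ.+ K) * Y ^ (2 ℕ.+ (γ ℕ.+ γ))     ∎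
        where
        open ℚ.≤-Reasoning
        x = c n * (1ℚᵘ + 1/ε)
        0≤x = *-≥0 (0≤c n) (+-≥0 (0≤c 1) 0≤1/ε)
        x≤YY : x ≤ Y * Y
        x≤YY = *-mono-≤ (0≤c n) (+-≥0 (0≤c 1) 0≤1/ε) n≤Y 1+1/ε≤Y
        n≤x : c n ≤ x
        n≤x = ℚ.≤-respˡ-≃ (ℚ.*-identityʳ (c n)) (*-monoʳ-≤ (c n) (0≤c n) (≤-gap 1/ε 0≤1/ε ≃-refl))
        n≤xm : c n ≤ x * m
        n≤xm = ℚ.≤-respʳ-≃ (≃-sym (ℚ.*-assoc (c n) (1ℚᵘ + 1/ε) m))
          (ℚ.≤-respˡ-≃ (ℚ.*-identityʳ (c n)) (*-monoʳ-≤ (c n) (0≤c n) 1≤[1+1/ε]m))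

    power-bound : R ^ γ ≤ c 144 → ε ≤ 1ℚᵘ → 1 ℕ.≤ n →
      BoundedByLogPower (c τ) (c C * c n ^ 2) ((c n ÷ ε) {{pos⇒nonZero ε}}) R (c 144)
    power-bound R^γ≤144 ε≤1 1≤n = integral-exponent {γ = γ} (0≤c τ) (*-≥0 (0≤c C) (^-≥0 2 (0≤c n)))
      (ℚ.≤-trans (c-mono 1≤n) n≤x) R^γ≤144 (nonempty-bound 1≤n n≤x n≤xm)
      where
      x = (c n ÷ ε) {{pos⇒nonZero ε}}
      xε≃n : x * ε ≃ c n
      xε≃n = ÷-* (c n) ε {{pos⇒nonZero ε}}
      0≤x : 0ℚᵘ ≤ x
      0≤x = *-cancel-≥0 ε (ℚ.positive⁻¹ ε) (ℚ.≤-respʳ-≃ (≃-sym (ℚ.≃-trans (ℚ.*-comm ε x) xε≃n)) (0≤c n))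
      n≤x : c n ≤ x
      n≤x = ℚ.≤-respˡ-≃ xε≃n (ℚ.≤-respʳ-≃ (ℚ.*-identityʳ x) (*-monoʳ-≤ x 0≤x ε≤1))
      n≤xm : c n ≤ x * m
      n≤xm = ℚ.≤-reflexive (≃-sym (ℚ.≃-trans (ℚ.*-congˡ {x} (ℚ.p≤q⇒p⊓q≃p ε≤1)) xε≃n))

  fptas : IsFPTAS (#M 3 3) (λ ε (H , _) → approximateMatchings tieBreak ε H)
  fptas = record
    { accurate   = λ ε (H , isKR) → approximation H isKR ε
    ; polynomial = C ℕ.+ K , 2 ℕ.+ (γ ℕ.+ γ) , λ ε (H , isKR) → polynomial-bound H isKR ε }

  running-time : R ^ γ ≤ c 144 → ∃[ C ] ∀ (ε : ℚᵘ) .{{_ : Positive ε}} → ε ≤ 1ℚᵘ →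
    ∀ ((H , _) : KRGraph 3 3) → let n = Hypergraph.#E H in .{{_ : ℕ.NonZero n}} →
    BoundedByLogPower (c (time (approximateMatchings tieBreak ε H))) (c C * c n ^ 2) ((c n ÷ ε) {{pos⇒nonZero ε}}) R (c 144)
  running-time R^γ≤144 = C , λ ε ε≤1 (H , isKR) → power-bound H isKR ε R^γ≤144 ε≤1 (ℕ.>-nonZero⁻¹ (Hypergraph.#E H))

-- The logarithm of 49 to the base 50/49 is about 192.6, so 193 is the least possible exponent.
-- Together with the 12 from the polynomial in n it gives 205, while the logarithm of 144 is about
-- 246.
49≤R^193 : c 49 ≤ R ^ 193
49≤R^193 = ℚ.≤-respʳ-≃ (ℚ.*-identityˡ (R ^ 193))
  (≤fraction-^ 50 49 193 49 1 (ℕ.≤ᵇ⇒≤ (49 ℕ.^ 193 ℕ.* 49) (1 ℕ.* 50 ℕ.^ 193) tt))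

R^205≤144 : R ^ 205 ≤ c 144
R^205≤144 = ℚ.≤-respˡ-≃ (ℚ.*-identityˡ (R ^ 205))
  (fraction-^≤ 50 49 205 144 1 (ℕ.≤ᵇ⇒≤ (1 ℕ.* 50 ℕ.^ 205) (49 ℕ.^ 205 ℕ.* 144) tt))

theorem2 : (tieBreak : TieBreak) →
    IsFPTAS (#M 3 3) (λ ε (H , _) → approximateMatchings tieBreak ε H)
    ×
    (∃[ C ] ∀ (ε : ℚᵘ) .{{_ : Positive ε}} → ε ≤ 1ℚᵘ →
    ∀ ((H , _) : KRGraph 3 3) → let n = Hypergraph.#E H in .{{_ : ℕ.NonZero n}} →
    BoundedByLogPower
    (fromℕ (time (approximateMatchings tieBreak ε H)))
    (fromℕ C * fromℕ n ^ 2)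
    ((fromℕ n ÷ ε) {{pos⇒nonZero ε}})
    (+ 50 / 49)
    (fromℕ 144))
theorem2 tieBreak = fptas , running-time R^205≤144
  where open Conclusion tieBreak 193 49≤R^193
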